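{- Let $N,k$ be positive integers with $N\ge 2k+1$ and let $\mathcal P$ be the Petersen graph. Assume that all roots of $D_{k,2}(x)$ and $D_{k,5}(x)$ are simple. Then, for $a\in V(\mathcal P)$ and $0\le\ell\le N-1$, we have $$h_{C_N^k\square\mathcal P}((0,a),(\ell,a))=\frac{2k+3}{2k}h_{C_N^k}(0,\ell)-\frac{N(2k+3)}{2}\left(5\mathcal A_{k,2}^{(N)}(\ell)+4\mathcal A_{k,5}^{(N)}(\ell)\right).$$ In particular, when $k=1$, $$h_{C_N\square\mathcal P}((0,a),(\ell,a))=\frac52\,\ell(N-\ell)+5N\left(\frac{5}{\sqrt6}\frac{V_\ell^{(2)}V_{N-\ell}^{(2)}}{V_N^{(2)}}+\frac43\frac{V_\ell^{(5)}V_{N-\ell}^{(5)}}{V_N^{(5)}}\right),$$ where $V_0^{(2)}=V_0^{(5)}=0$, $V_1^{(2)}=V_1^{(5)}=1$, $V_{n+2}^{(2)}=\sqrt6\,V_{n+1}^{(2)}-V_n^{(2)}$ and $V_{n+2}^{(5)}=3V_{n+1}^{(5)}-V_n^{(5)}$.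
   Context: All graphs are finite, simple and undirected; $\mathbb Z_N=\mathbb Z/N\mathbb Z$. $C_N^k$ is the graph with vertex set $\mathbb Z_N$ in which $x,y$ are adjacent iff $x-y\equiv\pm s\pmod N$ for some $1\le s\le k$; $C_N=C_N^1$. The Cartesian product $C_N^k\square G$ has vertex set $\mathbb Z_N\times V(G)$, with $(x,a)$ and $(y,b)$ adjacent iff ($a=b$ and $x,y$ are adjacent in $C_N^k$) or ($x=y$ and $a,b$ are adjacent in $G$). For a finite connected graph $Y$ and $u,v\in V(Y)$, $h_Y(u,v)$ is the expected value of $T_v=\inf\{t\ge 0: Z_t=v\}$ for the simple random walk $(Z_t)$ on $Y$ started at $u$ (each step moves to a uniformly random neighbour). For $\nu>0$, $D_{k,\nu}(x)=k+\frac{\nu}{2}-\sum_{s=1}^{k}T_s\left(\frac{x}{2}\right)$, where $T_s$ is the Chebyshev polynomial of the first kind; it has degree $k$. When its roots are simple, they are denoted $\phi_{\nu,1},\ldots,\phi_{\nu,k}\in\mathbb C$, and one chooses complex numbers with $\rho_{\nu,c}+\rho_{\nu,c}^{ -1}=\phi_{\nu,c}$, $\rho_{\nu,c}=\eta_{\nu,c}^{2}$, and puts $\gamma_{\nu,c}=\eta_{\nu,c}+\eta_{\nu,c}^{ -1}$. The sequence $(V_n^{(\nu,c)})_{n\ge0}$ is defined by $V_0^{(\nu,c)}=0$, $V_1^{(\nu,c)}=1$, $V_{n+2}^{(\nu,c)}=\gamma_{\nu,c}V_{n+1}^{(\nu,c)}-V_n^{(\nu,c)}$, and $$\mathcal A_{k,\nu}^{(N)}(\ell)=\sum_{c=1}^{k}\frac{1}{\gamma_{\nu,c}D_{k,\nu}'(\phi_{\nu,c})}\frac{V_\ell^{(\nu,c)}V_{N-\ell}^{(\nu,c)}}{V_N^{(\nu,c)}}.$$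 -}

module Defs where

open import Algebra.Bundles using (CommutativeRing)
open import Data.Bool.Base using (Bool; true; false; not; _∧_; if_then_else_)
open import Data.Empty using (⊥-elim)
open import Data.Fin.Base using (Fin; toℕ)
import Data.Fin.Properties as Fin
open import Data.Integer.Base as ℤ using (ℤ)
import Data.Integer.Divisibility as ℤ using (_∣_)
import Data.Integer.Properties as ℤ
open import Data.List.Base as List using (List; []; _∷_)
open import Data.Nat.Base as ℕ using (ℕ; zero; suc)
import Data.Nat.Divisibility as ℕ
import Data.Nat.Properties as ℕ
open import Data.Product.Base using (∃; _×_; _,_; proj₁; proj₂)
open import Data.Product.Function.NonDependent.Propositional using (_×-↔_)
open import Data.Rational.Base as ℚ using (ℚ; 0ℚ; 1ℚ; ½)
import Data.Rational.Properties as ℚ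
open import Data.Rational.Solver using (module +-*-Solver)
import Data.Integer.Solver as ℤSolver
open import Data.Sum.Base using (_⊎_; inj₁; inj₂)
open import Data.Vec.Base using (Vec; []; _∷_)
open import Function.Base using (_∘_)
open import Function.Bundles using (_↔_)
import Function.Bundles as F
open import Function.Construct.Composition using (_↔-∘_)
open import Function.Construct.Identity using (↔-id)
open import Function.Construct.Symmetry using (↔-sym)
open import Function.Properties.Inverse using (Inverse⇒Injection)
open import Level using (0ℓ)
open import Relation.Binary.Core using (Rel)
open import Relation.Binary.Definitions
  using (Decidable; DecidableEquality; Irreflexive; Symmetric)
open import Relation.Binary.PropositionalEquality.Core
  using (_≡_; refl; sym; trans; cong; cong₂; subst)
open import Relation.Binary.Structures using (IsEquivalence)
open import Relation.Nullary.Decidable.Core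
  using (does; yes; no; _×-dec_; _⊎-dec_; map′)
open import Relation.Nullary.Negation.Core using (¬_)
import Algebra.Properties.CommutativeMonoid.Sum as Sum

-- Real numbers: Cauchy sequences of rationals, two of them being equal
-- when their difference tends to 0.

Small : (ℕ → ℕ → ℚ) → Set
Small d = ∀ ε → 0ℚ ℚ.< ε →
  ∃ λ M → ∀ m n → M ℕ.≤ m → M ℕ.≤ n → ℚ.∣ d m n ∣ ℚ.< ε

Null : (ℕ → ℚ) → Set
Null s = ∀ ε → 0ℚ ℚ.< ε → ∃ λ M → ∀ n → M ℕ.≤ n → ℚ.∣ s n ∣ ℚ.< ε

record ℝ : Set where
  no-eta-equality
  constructor mkℝ
  field
    seq    : ℕ → ℚ
    cauchy : Small (λ m n → seq m ℚ.- seq n)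

open ℝ public

infix 4 _≃ʳ_ _#ʳ_

-- Wrapped in a record so that both arguments can be inferred.
record _≃ʳ_ (x y : ℝ) : Set where
  no-eta-equality
  constructor mk≃
  field null : Null (λ n → seq x n ℚ.- seq y n)

open _≃ʳ_ public

-- The constructive inequality: |x - y| is bounded away from 0.
_#ʳ_ : ℝ → ℝ → Set
x #ʳ y = ∃ λ δ → 0ℚ ℚ.< δ × ∃ λ M → ∀ n → M ℕ.≤ n →
  δ ℚ.≤ ℚ.∣ seq x n ℚ.- seq y n ∣

NonNegativeʳ : ℝ → Set
NonNegativeʳ x = ∀ ε → 0ℚ ℚ.< ε → ∃ λ M → ∀ n → M ℕ.≤ n → ℚ.- ε ℚ.≤ seq x n

private
  open +-*-Solver using (solve; _:+_; _:*_; _:-_; :-_; _:=_)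

  abs-neg : ∀ p q → ℚ.∣ p ℚ.- q ∣ ≡ ℚ.∣ q ℚ.- p ∣
  abs-neg p q = trans (sym (ℚ.∣-p∣≡∣p∣ (p ℚ.- q)))
    (cong ℚ.∣_∣ (solve 2 (λ p q → (:- (p :- q)) := (q :- p)) refl p q))

  half : ∀ {ε} → 0ℚ ℚ.< ε → 0ℚ ℚ.< ½ ℚ.* ε
  half {ε} 0<ε = subst (ℚ._< ½ ℚ.* ε) (ℚ.*-zeroʳ ½) (ℚ.*-monoʳ-<-pos ½ 0<ε)

  halves : ∀ ε → ½ ℚ.* ε ℚ.+ ½ ℚ.* ε ≡ ε
  halves ε = trans (sym (ℚ.*-distribʳ-+ ε ½ ½)) (ℚ.*-identityˡ ε)

  small-≤ : ∀ {d e} → (∀ m n → ℚ.∣ e m n ∣ ℚ.≤ ℚ.∣ d m n ∣) → Small d → Small e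
  small-≤ le sd ε 0<ε with sd ε 0<ε
  ... | M , p = M , λ m n M≤m M≤n → ℚ.≤-<-trans (le m n) (p m n M≤m M≤n)

  small-≗ : ∀ {d e} → (∀ m n → e m n ≡ d m n) → Small d → Small e
  small-≗ eq = small-≤ λ m n → ℚ.≤-reflexive (cong ℚ.∣_∣ (eq m n))

  small-+ : ∀ {d e} → Small d → Small e → Small (λ m n → d m n ℚ.+ e m n)
  small-+ {d} {e} sd se ε 0<ε with sd (½ ℚ.* ε) (half 0<ε) | se (½ ℚ.* ε) (half 0<ε)
  ... | M , p | M′ , q = M ℕ.⊔ M′ , λ m n M≤m M≤n →
    ℚ.≤-<-trans (ℚ.∣p+q∣≤∣p∣+∣q∣ (d m n) (e m n))
      (subst (ℚ.∣ d m n ∣ ℚ.+ ℚ.∣ e m n ∣ ℚ.<_) (halves ε)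
        (ℚ.+-mono-<
          (p m n (ℕ.m⊔n≤o⇒m≤o M M′ M≤m) (ℕ.m⊔n≤o⇒m≤o M M′ M≤n))
          (q m n (ℕ.m⊔n≤o⇒n≤o M M′ M≤m) (ℕ.m⊔n≤o⇒n≤o M M′ M≤n))))

  Bounded : (ℕ → ℕ → ℚ) → Set
  Bounded b = ∃ λ B → 0ℚ ℚ.< B × ∃ λ M → ∀ m n → M ℕ.≤ m → M ℕ.≤ n →
    ℚ.∣ b m n ∣ ℚ.≤ B

  small-* : ∀ {b d} → Bounded b → Small d → Small (λ m n → b m n ℚ.* d m n)
  small-* {b} {d} (B , 0<B , M , p) sd ε 0<ε = go
    where
    instance
      B-pos : ℚ.Positive B
      B-pos = ℚ.positive 0<B
      B-nonNeg : ℚ.NonNegative B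
      B-nonNeg = ℚ.pos⇒nonNeg B
      B-nonZero : ℚ.NonZero B
      B-nonZero = ℚ.pos⇒nonZero B
      B⁻¹-pos : ℚ.Positive (ℚ.1/ B)
      B⁻¹-pos = ℚ.1/pos⇒pos B
    δ = ℚ.1/ B ℚ.* ε
    0<δ : 0ℚ ℚ.< δ
    0<δ = subst (ℚ._< δ) (ℚ.*-zeroʳ (ℚ.1/ B)) (ℚ.*-monoʳ-<-pos (ℚ.1/ B) 0<ε)
    Bδ≡ε : B ℚ.* δ ≡ ε
    Bδ≡ε = trans (sym (ℚ.*-assoc B (ℚ.1/ B) ε))
      (trans (cong (ℚ._* ε) (ℚ.*-inverseʳ B)) (ℚ.*-identityˡ ε))
    go : ∃ λ K → ∀ m n → K ℕ.≤ m → K ℕ.≤ n → ℚ.∣ b m n ℚ.* d m n ∣ ℚ.< ε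
    go with sd δ 0<δ
    ... | M′ , q = M ℕ.⊔ M′ , λ m n K≤m K≤n →
      let instance
            d-nonNeg : ℚ.NonNegative ℚ.∣ d m n ∣
            d-nonNeg = ℚ.∣-∣-nonNeg (d m n)
      in subst (ℚ._< ε) (sym (ℚ.∣p*q∣≡∣p∣*∣q∣ (b m n) (d m n)))
        (ℚ.≤-<-trans
          (ℚ.*-monoʳ-≤-nonNeg ℚ.∣ d m n ∣
            (p m n (ℕ.m⊔n≤o⇒m≤o M M′ K≤m) (ℕ.m⊔n≤o⇒m≤o M M′ K≤n)))
          (subst (B ℚ.* ℚ.∣ d m n ∣ ℚ.<_) Bδ≡ε
            (ℚ.*-monoʳ-<-pos B
              (q m n (ℕ.m⊔n≤o⇒n≤o M M′ K≤m) (ℕ.m⊔n≤o⇒n≤o M M′ K≤n)))))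

  bounded : ∀ x → ∃ λ B → 0ℚ ℚ.< B × ∃ λ M → ∀ n → M ℕ.≤ n → ℚ.∣ seq x n ∣ ℚ.≤ B
  bounded x with cauchy x 1ℚ (ℚ.positive⁻¹ 1ℚ)
  ... | M , p = ℚ.∣ seq x M ∣ ℚ.+ 1ℚ
    , ℚ.+-mono-≤-< (ℚ.0≤∣p∣ (seq x M)) (ℚ.positive⁻¹ 1ℚ)
    , M , λ n M≤n → near (seq x M) (seq x n) (p n M M≤n ℕ.≤-refl)
    where
    shift : ∀ a b → a ℚ.+ (b ℚ.- a) ≡ b
    shift = solve 2 (λ a b → (a :+ (b :- a)) := b) refl
    near : ∀ a b → ℚ.∣ b ℚ.- a ∣ ℚ.< 1ℚ → ℚ.∣ b ∣ ℚ.≤ ℚ.∣ a ∣ ℚ.+ 1ℚ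
    near a b lt = ℚ.≤-trans (ℚ.≤-reflexive (cong ℚ.∣_∣ (sym (shift a b))))
      (ℚ.≤-trans (ℚ.∣p+q∣≤∣p∣+∣q∣ a (b ℚ.- a)) (ℚ.+-monoʳ-≤ ℚ.∣ a ∣ (ℚ.<⇒≤ lt)))

  bounded₁ : ∀ x → Bounded (λ m _ → seq x m)
  bounded₁ x = let (B , 0<B , M , p) = bounded x in
    B , 0<B , M , λ m _ M≤m _ → p m M≤m

  bounded₂ : ∀ x → Bounded (λ _ n → seq x n)
  bounded₂ x = let (B , 0<B , M , p) = bounded x in
    B , 0<B , M , λ _ n _ M≤n → p n M≤n

  ≃⇒small : ∀ {x y} → x ≃ʳ y → Small (λ m _ → seq x m ℚ.- seq y m)
  ≃⇒small x≃y ε 0<ε with null x≃y ε 0<ε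
  ... | M , p = M , λ m _ M≤m _ → p m M≤m

  small⇒≃ : ∀ {x y} → Small (λ m _ → seq x m ℚ.- seq y m) → x ≃ʳ y
  small⇒≃ sd .null ε 0<ε with sd ε 0<ε
  ... | M , p = M , λ n M≤n → p n n M≤n M≤n

  ≗⇒≃ : ∀ {x y} → (∀ n → seq x n ≡ seq y n) → x ≃ʳ y
  ≗⇒≃ {x} {y} eq .null ε 0<ε = 0 , λ n _ →
    subst (λ q → ℚ.∣ q ∣ ℚ.< ε)
      (sym (trans (cong (ℚ._- seq y n) (eq n)) (ℚ.+-inverseʳ (seq y n)))) 0<ε

fromℚ : ℚ → ℝ
fromℚ q .seq _ = q
fromℚ q .cauchy ε 0<ε = 0 , λ _ _ _ _ →
  subst (λ p → ℚ.∣ p ∣ ℚ.< ε) (sym (ℚ.+-inverseʳ q)) 0<ε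

ℕ→ℚ : ℕ → ℚ
ℕ→ℚ n = ℤ.+ n ℚ./ 1

fromℕ : ℕ → ℝ
fromℕ n = fromℚ (ℕ→ℚ n)

0ʳ 1ʳ : ℝ
0ʳ = fromℚ 0ℚ
1ʳ = fromℚ 1ℚ

infixl 6 _+ʳ_ _-ʳ_
infixl 7 _*ʳ_
infix  8 -ʳ_

_+ʳ_ : ℝ → ℝ → ℝ
(x +ʳ y) .seq n = seq x n ℚ.+ seq y n
(x +ʳ y) .cauchy = small-≗
  (λ m n → solve 4 (λ a b c d → ((a :+ b) :- (c :+ d)) := ((a :- c) :+ (b :- d)))
    refl (seq x m) (seq y m) (seq x n) (seq y n))
  (small-+ (cauchy x) (cauchy y))

-ʳ_ : ℝ → ℝ
(-ʳ x) .seq n = ℚ.- seq x n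
(-ʳ x) .cauchy = small-≤
  (λ m n → ℚ.≤-reflexive (trans
    (cong ℚ.∣_∣ (solve 2 (λ a b → ((:- a) :- (:- b)) := (b :- a)) refl (seq x m) (seq x n)))
    (abs-neg (seq x n) (seq x m))))
  (cauchy x)

_-ʳ_ : ℝ → ℝ → ℝ
x -ʳ y = x +ʳ (-ʳ y)

_*ʳ_ : ℝ → ℝ → ℝ
(x *ʳ y) .seq n = seq x n ℚ.* seq y n
(x *ʳ y) .cauchy = small-≗
  (λ m n → solve 4
    (λ a b c d → ((a :* b) :- (c :* d)) := ((a :* (b :- d)) :+ (d :* (a :- c))))
    refl (seq x m) (seq y m) (seq x n) (seq y n))
  (small-+ (small-* (bounded₁ x) (cauchy y)) (small-* (bounded₂ y) (cauchy x)))

private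
  ≃ʳ-isEquivalence : IsEquivalence _≃ʳ_
  ≃ʳ-isEquivalence = record
    { refl  = ≗⇒≃ λ _ → refl
    ; sym   = λ {x} {y} x≃y → small⇒≃ (small-≤
        (λ m _ → ℚ.≤-reflexive (abs-neg (seq y m) (seq x m))) (≃⇒small x≃y))
    ; trans = λ {x} {y} {z} x≃y y≃z → small⇒≃ (small-≗
        (λ m _ → solve 3 (λ a b c → (a :- c) := ((a :- b) :+ (b :- c)))
          refl (seq x m) (seq y m) (seq z m))
        (small-+ (≃⇒small x≃y) (≃⇒small y≃z)))
    }

  +ʳ-cong : ∀ {x y u v} → x ≃ʳ y → u ≃ʳ v → (x +ʳ u) ≃ʳ (y +ʳ v)
  +ʳ-cong {x} {y} {u} {v} x≃y u≃v = small⇒≃ (small-≗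
    (λ m _ → solve 4 (λ a b c d → ((a :+ c) :- (b :+ d)) := ((a :- b) :+ (c :- d)))
      refl (seq x m) (seq y m) (seq u m) (seq v m))
    (small-+ (≃⇒small x≃y) (≃⇒small u≃v)))

  *ʳ-cong : ∀ {x y u v} → x ≃ʳ y → u ≃ʳ v → (x *ʳ u) ≃ʳ (y *ʳ v)
  *ʳ-cong {x} {y} {u} {v} x≃y u≃v = small⇒≃ (small-≗
    (λ m _ → solve 4
      (λ a b c d → ((a :* c) :- (b :* d)) := ((a :* (c :- d)) :+ (d :* (a :- b))))
      refl (seq x m) (seq y m) (seq u m) (seq v m))
    (small-+ (small-* (bounded₁ x) (≃⇒small u≃v)) (small-* (bounded₁ v) (≃⇒small x≃y))))

  -ʳ-cong : ∀ {x y} → x ≃ʳ y → (-ʳ x) ≃ʳ (-ʳ y)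
  -ʳ-cong {x} {y} x≃y = small⇒≃ (small-≤
    (λ m _ → ℚ.≤-reflexive (trans
      (cong ℚ.∣_∣ (solve 2 (λ a b → ((:- a) :- (:- b)) := (b :- a)) refl (seq x m) (seq y m)))
      (abs-neg (seq y m) (seq x m))))
    (≃⇒small x≃y))

  module ℝLaws where
    open import Algebra.Definitions _≃ʳ_

    +ʳ-assoc : Associative _+ʳ_
    +ʳ-assoc x y z = ≗⇒≃ λ n → ℚ.+-assoc (seq x n) (seq y n) (seq z n)

    +ʳ-comm : Commutative _+ʳ_
    +ʳ-comm x y = ≗⇒≃ λ n → ℚ.+-comm (seq x n) (seq y n)

    +ʳ-identity : Identity 0ʳ _+ʳ_
    +ʳ-identity = (λ x → ≗⇒≃ λ n → ℚ.+-identityˡ (seq x n))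
                , (λ x → ≗⇒≃ λ n → ℚ.+-identityʳ (seq x n))

    +ʳ-inverse : Inverse 0ʳ (λ x → -ʳ x) _+ʳ_
    +ʳ-inverse = (λ x → ≗⇒≃ λ n → ℚ.+-inverseˡ (seq x n))
               , (λ x → ≗⇒≃ λ n → ℚ.+-inverseʳ (seq x n))

    *ʳ-assoc : Associative _*ʳ_
    *ʳ-assoc x y z = ≗⇒≃ λ n → ℚ.*-assoc (seq x n) (seq y n) (seq z n)

    *ʳ-comm : Commutative _*ʳ_
    *ʳ-comm x y = ≗⇒≃ λ n → ℚ.*-comm (seq x n) (seq y n)

    *ʳ-identity : Identity 1ʳ _*ʳ_
    *ʳ-identity = (λ x → ≗⇒≃ λ n → ℚ.*-identityˡ (seq x n))
                , (λ x → ≗⇒≃ λ n → ℚ.*-identityʳ (seq x n))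

    *ʳ-distrib-+ʳ : _*ʳ_ DistributesOver _+ʳ_
    *ʳ-distrib-+ʳ = (λ x y z → ≗⇒≃ λ n → ℚ.*-distribˡ-+ (seq x n) (seq y n) (seq z n))
                  , (λ x y z → ≗⇒≃ λ n → ℚ.*-distribʳ-+ (seq x n) (seq y n) (seq z n))

ℝ-commutativeRing : CommutativeRing 0ℓ 0ℓ
ℝ-commutativeRing = record
  { Carrier = ℝ ; _≈_ = _≃ʳ_ ; _+_ = _+ʳ_ ; _*_ = _*ʳ_ ; -_ = λ x → -ʳ x ; 0# = 0ʳ ; 1# = 1ʳ
  ; isCommutativeRing = record
    { isRing = record
      { +-isAbelianGroup = record
        { isGroup = record
          { isMonoid = record
            { isSemigroup = record
              { isMagma = record { isEquivalence = ≃ʳ-isEquivalence ; ∙-cong = +ʳ-cong }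
              ; assoc   = ℝLaws.+ʳ-assoc
              }
            ; identity = ℝLaws.+ʳ-identity
            }
          ; inverse = ℝLaws.+ʳ-inverse
          ; ⁻¹-cong = -ʳ-cong
          }
        ; comm = ℝLaws.+ʳ-comm
        }
      ; *-cong     = *ʳ-cong
      ; *-assoc    = ℝLaws.*ʳ-assoc
      ; *-identity = ℝLaws.*ʳ-identity
      ; distrib    = ℝLaws.*ʳ-distrib-+ʳ
      }
    ; *-comm = ℝLaws.*ʳ-comm
    }
  }

-- recip 0 = 0 is a filler: it affects finitely many terms of an inverse, and
-- degree-0 vertices, from which there are no steps.
recip : ℚ → ℚ
recip q with q ℚ.≟ 0ℚ
... | yes _   = 0ℚ
... | no  q≢0 = ℚ.1/_ q {{ℚ.≢-nonZero q≢0}}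

private
  recip-inverse : ∀ {q δ} → 0ℚ ℚ.< δ → δ ℚ.≤ ℚ.∣ q ∣ → q ℚ.* recip q ≡ 1ℚ
  recip-inverse {q} {δ} 0<δ δ≤∣q∣ with q ℚ.≟ 0ℚ
  ... | yes refl = ⊥-elim (ℚ.<-irrefl refl (ℚ.<-≤-trans 0<δ δ≤∣q∣))
  ... | no  q≢0  = ℚ.*-inverseʳ q {{ℚ.≢-nonZero q≢0}}

  minus-0 : ∀ q → q ℚ.- 0ℚ ≡ q
  minus-0 q = ℚ.+-identityʳ q

  module _ {δ : ℚ} (0<δ : 0ℚ ℚ.< δ) where
    private instance
      δ-pos : ℚ.Positive δ
      δ-pos = ℚ.positive 0<δ
      δ-nonZero : ℚ.NonZero δ
      δ-nonZero = ℚ.pos⇒nonZero δ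
      δ⁻¹-pos : ℚ.Positive (ℚ.1/ δ)
      δ⁻¹-pos = ℚ.1/pos⇒pos δ
      δ⁻¹-nonNeg : ℚ.NonNegative (ℚ.1/ δ)
      δ⁻¹-nonNeg = ℚ.pos⇒nonNeg (ℚ.1/ δ)

    0<δ⁻¹ : 0ℚ ℚ.< ℚ.1/ δ
    0<δ⁻¹ = ℚ.positive⁻¹ (ℚ.1/ δ)

    ∣recip∣≤ : ∀ {q} → δ ℚ.≤ ℚ.∣ q ∣ → ℚ.∣ recip q ∣ ℚ.≤ ℚ.1/ δ
    ∣recip∣≤ {q} δ≤∣q∣ =
      subst (ℚ._≤ ℚ.1/ δ) δ⁻¹δr≡r
        (subst (ℚ.1/ δ ℚ.* (δ ℚ.* r) ℚ.≤_) (ℚ.*-identityʳ (ℚ.1/ δ))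
          (ℚ.*-monoˡ-≤-nonNeg (ℚ.1/ δ) δr≤1))
      where
      r = ℚ.∣ recip q ∣
      instance
        r-nonNeg : ℚ.NonNegative r
        r-nonNeg = ℚ.∣-∣-nonNeg (recip q)
      δ⁻¹δr≡r : ℚ.1/ δ ℚ.* (δ ℚ.* r) ≡ r
      δ⁻¹δr≡r = trans (sym (ℚ.*-assoc (ℚ.1/ δ) δ r))
        (trans (cong (ℚ._* r) (ℚ.*-inverseˡ δ)) (ℚ.*-identityˡ r))
      δr≤1 : δ ℚ.* r ℚ.≤ 1ℚ
      δr≤1 = subst (δ ℚ.* r ℚ.≤_)
        (trans (sym (ℚ.∣p*q∣≡∣p∣*∣q∣ q (recip q)))
          (cong ℚ.∣_∣ (recip-inverse 0<δ δ≤∣q∣)))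
        (ℚ.*-monoʳ-≤-nonNeg r δ≤∣q∣)

invʳ : (x : ℝ) → x #ʳ 0ʳ → ℝ
invʳ x _ .seq n = recip (seq x n)
invʳ x (δ , 0<δ , M , p) .cauchy = subst-eventually
  (small-* {b = λ m n → recip (seq x m) ℚ.* recip (seq x n)} bound
    (small-≤ (λ m n → ℚ.≤-reflexive (abs-neg (seq x n) (seq x m))) (cauchy x)))
  where
  large : ∀ n → M ℕ.≤ n → δ ℚ.≤ ℚ.∣ seq x n ∣
  large n M≤n = subst (λ q → δ ℚ.≤ ℚ.∣ q ∣) (minus-0 (seq x n)) (p n M≤n)
  B : ℚ
  B = ℚ.1/_ δ {{ℚ.pos⇒nonZero δ {{ℚ.positive 0<δ}}}}
  0<B : 0ℚ ℚ.< B
  0<B = 0<δ⁻¹ 0<δ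
  bound : Bounded (λ m n → recip (seq x m) ℚ.* recip (seq x n))
  bound = B ℚ.* B
    , subst (ℚ._< B ℚ.* B) (ℚ.*-zeroʳ B) (ℚ.*-monoʳ-<-pos B {{ℚ.positive 0<B}} 0<B)
    , M , λ m n M≤m M≤n →
      subst (ℚ._≤ B ℚ.* B) (sym (ℚ.∣p*q∣≡∣p∣*∣q∣ (recip (seq x m)) (recip (seq x n))))
        (ℚ.≤-trans
          (ℚ.*-monoʳ-≤-nonNeg ℚ.∣ recip (seq x n) ∣ {{ℚ.∣-∣-nonNeg (recip (seq x n))}}
            (∣recip∣≤ 0<δ (large m M≤m)))
          (ℚ.*-monoˡ-≤-nonNeg B {{ℚ.pos⇒nonNeg B {{ℚ.positive 0<B}}}}
            (∣recip∣≤ 0<δ (large n M≤n))))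
  difference : ∀ a b r s → a ℚ.* r ≡ 1ℚ → b ℚ.* s ≡ 1ℚ →
               (r ℚ.* s) ℚ.* (b ℚ.- a) ≡ r ℚ.- s
  difference a b r s ar≡1 bs≡1 = trans
    (solve 4 (λ a b r s → ((r :* s) :* (b :- a)) := ((r :* (b :* s)) :- (s :* (a :* r))))
      refl a b r s)
    (trans (cong₂ (λ u v → r ℚ.* u ℚ.- s ℚ.* v) bs≡1 ar≡1)
      (cong₂ ℚ._-_ (ℚ.*-identityʳ r) (ℚ.*-identityʳ s)))
  subst-eventually :
    Small (λ m n → (recip (seq x m) ℚ.* recip (seq x n)) ℚ.* (seq x n ℚ.- seq x m)) →
    Small (λ m n → recip (seq x m) ℚ.- recip (seq x n))
  subst-eventually sd ε 0<ε with sd ε 0<ε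
  ... | K , q = M ℕ.⊔ K , λ m n L≤m L≤n →
    subst (λ u → ℚ.∣ u ∣ ℚ.< ε)
      (difference (seq x m) (seq x n) (recip (seq x m)) (recip (seq x n))
        (recip-inverse 0<δ (large m (ℕ.m⊔n≤o⇒m≤o M K L≤m)))
        (recip-inverse 0<δ (large n (ℕ.m⊔n≤o⇒m≤o M K L≤n))))
      (q m n (ℕ.m⊔n≤o⇒n≤o M K L≤m) (ℕ.m⊔n≤o⇒n≤o M K L≤n))

invʳ-inverse : ∀ x (x#0 : x #ʳ 0ʳ) → (x *ʳ invʳ x x#0) ≃ʳ 1ʳ
invʳ-inverse x (δ , 0<δ , M , p) .null ε 0<ε = M , λ n M≤n →
  subst (λ q → ℚ.∣ q ℚ.- 1ℚ ∣ ℚ.< ε)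
    (sym (recip-inverse 0<δ
      (subst (λ q → δ ℚ.≤ ℚ.∣ q ∣) (minus-0 (seq x n)) (p n M≤n))))
    0<ε

IsSqrt : ℝ → ℝ → Set
IsSqrt x r = NonNegativeʳ r × (r *ʳ r) ≃ʳ x

infix 4 _⟶_

-- s n → x.  As seq x n itself tends to x, this is the same as s n - seq x n → 0.
_⟶_ : (ℕ → ℚ) → ℝ → Set
s ⟶ x = Null (λ n → s n ℚ.- seq x n)

⟶-unique : ∀ {s x y} → s ⟶ x → s ⟶ y → x ≃ʳ y
⟶-unique {s} {x} {y} s⟶x s⟶y = small⇒≃ (small-≗
  (λ m _ → solve 3 (λ a b c → (a :- b) := ((c :- b) :+ (a :- c)))
    refl (seq x m) (seq y m) (s m))
  (small-+
    (lift (λ n → s n ℚ.- seq y n) s⟶y)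
    (small-≤ (λ m _ → ℚ.≤-reflexive (abs-neg (seq x m) (s m)))
      (lift (λ n → s n ℚ.- seq x n) s⟶x))))
  where
  lift : ∀ r → Null r → Small (λ m _ → r m)
  lift r nr ε 0<ε with nr ε 0<ε
  ... | M , p = M , λ m _ M≤m _ → p m M≤m

infix  4 _≃_ _#_
infixl 6 _+_ _-_
infixl 7 _*_
infix  8 -_

record ℂ : Set where
  constructor _+i_
  field
    re im : ℝ

open ℂ public

record _≃_ (z w : ℂ) : Set where
  constructor _,_
  field
    re≃ : re z ≃ʳ re w
    im≃ : im z ≃ʳ im w

open _≃_ public

_#_ : ℂ → ℂ → Set
z # w = re z #ʳ re w ⊎ im z #ʳ im w

ofℝ : ℝ → ℂ
ofℝ x = x +i 0ʳ

ofℚ : ℚ → ℂ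
ofℚ q = ofℝ (fromℚ q)

ofℕ : ℕ → ℂ
ofℕ n = ofℝ (fromℕ n)

0ᶜ 1ᶜ : ℂ
0ᶜ = ofℝ 0ʳ
1ᶜ = ofℝ 1ʳ

_+_ : ℂ → ℂ → ℂ
z + w = (re z +ʳ re w) +i (im z +ʳ im w)

-_ : ℂ → ℂ
- z = (-ʳ re z) +i (-ʳ im z)

_-_ : ℂ → ℂ → ℂ
z - w = z + (- w)

_*_ : ℂ → ℂ → ℂ
z * w = (re z *ʳ re w -ʳ im z *ʳ im w) +i (re z *ʳ im w +ʳ im z *ʳ re w)

private
  module R = CommutativeRing ℝ-commutativeRing

  module ℂLaws where
    open import Algebra.Definitions _≃_

    isEquivalence : IsEquivalence _≃_
    isEquivalence = record
      { refl  = R.refl , R.refl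
      ; sym   = λ (p , q) → R.sym p , R.sym q
      ; trans = λ (p , q) (r , s) → R.trans p r , R.trans q s
      }

    open IsEquivalence isEquivalence using () renaming (trans to ≃-trans)

    +-cong : Congruent₂ _+_
    +-cong (p , q) (r , s) = R.+-cong p r , R.+-cong q s

    +-assoc : Associative _+_
    +-assoc (a +i b) (c +i d) (e +i f) = R.+-assoc a c e , R.+-assoc b d f

    +-comm : Commutative _+_
    +-comm (a +i b) (c +i d) = R.+-comm a c , R.+-comm b d

    +-identity : Identity 0ᶜ _+_
    +-identity = (λ (a +i b) → R.+-identityˡ a , R.+-identityˡ b)
               , (λ (a +i b) → R.+-identityʳ a , R.+-identityʳ b)

    neg-cong : Congruent₁ (λ x → - x)
    neg-cong (p , q) = R.-‿cong p , R.-‿cong q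

    +-inverse : Inverse 0ᶜ (λ x → - x) _+_
    +-inverse = (λ (a +i b) → R.-‿inverseˡ a , R.-‿inverseˡ b)
              , (λ (a +i b) → R.-‿inverseʳ a , R.-‿inverseʳ b)

    *-cong : Congruent₂ _*_
    *-cong (p , q) (r , s) =
      R.+-cong (R.*-cong p r) (R.-‿cong (R.*-cong q s)) ,
      R.+-cong (R.*-cong p s) (R.*-cong q r)

    *-assoc : Associative _*_
    *-assoc (a +i b) (c +i d) (e +i f) =
      (≗⇒≃ λ n → solve 6 (λ a b c d e f →
        ((((a :* c) :+ (:- (b :* d))) :* e) :+ (:- (((a :* d) :+ (b :* c)) :* f))) :=
        ((a :* ((c :* e) :+ (:- (d :* f)))) :+ (:- (b :* ((c :* f) :+ (d :* e))))))
        refl (seq a n) (seq b n) (seq c n) (seq d n) (seq e n) (seq f n)) ,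
      (≗⇒≃ λ n → solve 6 (λ a b c d e f →
        ((((a :* c) :+ (:- (b :* d))) :* f) :+ (((a :* d) :+ (b :* c)) :* e)) :=
        ((a :* ((c :* f) :+ (d :* e))) :+ (b :* ((c :* e) :+ (:- (d :* f))))))
        refl (seq a n) (seq b n) (seq c n) (seq d n) (seq e n) (seq f n))

    *-comm : Commutative _*_
    *-comm (a +i b) (c +i d) =
      R.+-cong (R.*-comm a c) (R.-‿cong (R.*-comm b d)) ,
      R.trans (R.+-comm (a *ʳ d) (b *ʳ c)) (R.+-cong (R.*-comm b c) (R.*-comm a d))

    *-identityʳ : RightIdentity 1ᶜ _*_
    *-identityʳ (a +i b) =
      R.trans (R.+-cong (R.*-identityʳ a) (neg-zero b)) (R.+-identityʳ a) ,
      R.trans (R.+-cong (R.zeroʳ a) (R.*-identityʳ b)) (R.+-identityˡ b)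
      where
      neg-zero : ∀ b → (-ʳ (b *ʳ 0ʳ)) ≃ʳ 0ʳ
      neg-zero b = ≗⇒≃ λ n → cong ℚ.-_ (ℚ.*-zeroʳ (seq b n))

    *-identity : Identity 1ᶜ _*_
    *-identity = (λ x → ≃-trans (*-comm 1ᶜ x) (*-identityʳ x)) , *-identityʳ

    *-distribˡ-+ : _*_ DistributesOverˡ _+_
    *-distribˡ-+ (a +i b) (c +i d) (e +i f) =
      (≗⇒≃ λ n → solve 6 (λ a b c d e f →
        ((a :* (c :+ e)) :+ (:- (b :* (d :+ f)))) :=
        (((a :* c) :+ (:- (b :* d))) :+ ((a :* e) :+ (:- (b :* f)))))
        refl (seq a n) (seq b n) (seq c n) (seq d n) (seq e n) (seq f n)) ,
      (≗⇒≃ λ n → solve 6 (λ a b c d e f →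
        ((a :* (d :+ f)) :+ (b :* (c :+ e))) :=
        (((a :* d) :+ (b :* c)) :+ ((a :* f) :+ (b :* e))))
        refl (seq a n) (seq b n) (seq c n) (seq d n) (seq e n) (seq f n))

    distrib : _*_ DistributesOver _+_
    distrib = *-distribˡ-+ , λ x y z →
      ≃-trans (*-comm (y + z) x)
        (≃-trans (*-distribˡ-+ x y z) (+-cong (*-comm x y) (*-comm x z)))

ℂ-commutativeRing : CommutativeRing 0ℓ 0ℓ
ℂ-commutativeRing = record
  { Carrier = ℂ ; _≈_ = _≃_ ; _+_ = _+_ ; _*_ = _*_ ; -_ = λ z → - z ; 0# = 0ᶜ ; 1# = 1ᶜ
  ; isCommutativeRing = record
    { isRing = record
      { +-isAbelianGroup = record
        { isGroup = record
          { isMonoid = record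
            { isSemigroup = record
              { isMagma = record
                { isEquivalence = ℂLaws.isEquivalence ; ∙-cong = ℂLaws.+-cong }
              ; assoc   = ℂLaws.+-assoc
              }
            ; identity = ℂLaws.+-identity
            }
          ; inverse = ℂLaws.+-inverse
          ; ⁻¹-cong = ℂLaws.neg-cong
          }
        ; comm = ℂLaws.+-comm
        }
      ; *-cong     = ℂLaws.*-cong
      ; *-assoc    = ℂLaws.*-assoc
      ; *-identity = ℂLaws.*-identity
      ; distrib    = ℂLaws.distrib
      }
    ; *-comm = ℂLaws.*-comm
    }
  }

normSq : ℂ → ℝ
normSq z = re z *ʳ re z +ʳ im z *ʳ im z

private
  square-nonNeg : ∀ q → 0ℚ ℚ.≤ q ℚ.* q
  square-nonNeg q = subst (0ℚ ℚ.≤_) ∣q∣∣q∣≡qq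
    (ℚ.≤-trans (ℚ.≤-reflexive (sym (ℚ.*-zeroʳ ℚ.∣ q ∣)))
      (ℚ.*-monoˡ-≤-nonNeg ℚ.∣ q ∣ {{ℚ.∣-∣-nonNeg q}} (ℚ.0≤∣p∣ q)))
    where
    ∣q∣∣q∣≡qq : ℚ.∣ q ∣ ℚ.* ℚ.∣ q ∣ ≡ q ℚ.* q
    ∣q∣∣q∣≡qq with ℚ.∣p∣≡p∨∣p∣≡-p q
    ... | inj₁ eq = cong₂ ℚ._*_ eq eq
    ... | inj₂ eq = trans (cong₂ ℚ._*_ eq eq)
      (solve 1 (λ q → ((:- q) :* (:- q)) := (q :* q)) refl q)

  square-≥ : ∀ {δ} q → 0ℚ ℚ.< δ → δ ℚ.≤ ℚ.∣ q ∣ → δ ℚ.* δ ℚ.≤ q ℚ.* q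
  square-≥ {δ} q 0<δ δ≤∣q∣ =
    subst (δ ℚ.* δ ℚ.≤_)
      (trans (sym (ℚ.∣p*q∣≡∣p∣*∣q∣ q q)) (ℚ.0≤p⇒∣p∣≡p (square-nonNeg q)))
      (ℚ.≤-trans
        (ℚ.*-monoˡ-≤-nonNeg δ {{ℚ.pos⇒nonNeg δ {{ℚ.positive 0<δ}}}} δ≤∣q∣)
        (ℚ.*-monoʳ-≤-nonNeg ℚ.∣ q ∣ {{ℚ.∣-∣-nonNeg q}} δ≤∣q∣))

  sumSq#0 : ∀ x y → x #ʳ 0ʳ → (x *ʳ x +ʳ y *ʳ y) #ʳ 0ʳ
  sumSq#0 x y (δ , 0<δ , M , p) =
    δ ℚ.* δ
    , subst (ℚ._< δ ℚ.* δ) (ℚ.*-zeroʳ δ) (ℚ.*-monoʳ-<-pos δ {{ℚ.positive 0<δ}} 0<δ)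
    , M , λ n M≤n →
      let a = seq x n
          b = seq y n
          0≤aa+bb = ℚ.+-mono-≤ (square-nonNeg a) (square-nonNeg b)
          δ≤∣a∣   = subst (λ q → δ ℚ.≤ ℚ.∣ q ∣) (minus-0 a) (p n M≤n)
      in subst (δ ℚ.* δ ℚ.≤_)
           (sym (trans (cong ℚ.∣_∣ (minus-0 (a ℚ.* a ℚ.+ b ℚ.* b))) (ℚ.0≤p⇒∣p∣≡p 0≤aa+bb)))
           (subst (ℚ._≤ a ℚ.* a ℚ.+ b ℚ.* b) (ℚ.+-identityʳ (δ ℚ.* δ))
             (ℚ.+-mono-≤ (square-≥ a 0<δ δ≤∣a∣) (square-nonNeg b)))

  normSq#0 : ∀ z → z # 0ᶜ → normSq z #ʳ 0ʳ
  normSq#0 z (inj₁ re#0) = sumSq#0 (re z) (im z) re#0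
  normSq#0 z (inj₂ im#0) with sumSq#0 (im z) (re z) im#0
  ... | δ , 0<δ , M , p = δ , 0<δ , M , λ n M≤n →
    subst (λ q → δ ℚ.≤ ℚ.∣ q ℚ.- 0ℚ ∣)
      (ℚ.+-comm (seq (im z) n ℚ.* seq (im z) n) (seq (re z) n ℚ.* seq (re z) n))
      (p n M≤n)

inv : (z : ℂ) → z # 0ᶜ → ℂ
inv z z#0 = (re z *ʳ r) +i ((-ʳ im z) *ʳ r)
  where r = invʳ (normSq z) (normSq#0 z z#0)

inv-inverse : ∀ z (z#0 : z # 0ᶜ) → (z * inv z z#0) ≃ 1ᶜ
inv-inverse z@(a +i b) z#0 =
  R.trans
    (≗⇒≃ λ n → solve 3 (λ a b r →
      ((a :* (a :* r)) :+ (:- (b :* ((:- b) :* r)))) := (((a :* a) :+ (b :* b)) :* r))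
      refl (seq a n) (seq b n) (seq r n))
    (invʳ-inverse (normSq z) (normSq#0 z z#0)) ,
  R.trans
    (≗⇒≃ λ n → solve 3 (λ a b r →
      ((a :* ((:- b) :* r)) :+ (b :* (a :* r))) := ((a :* (b :* r)) :+ (:- (a :* (b :* r)))))
      refl (seq a n) (seq b n) (seq r n))
    (R.-‿inverseʳ (a *ʳ (b *ʳ r)))
  where r = invʳ (normSq z) (normSq#0 z z#0)

-- Coefficients in order of increasing degree
Poly : Set
Poly = List ℂ

infixl 6 _+ₚ_
infixl 7 _*ₚ_ _·ₚ_
infixr 9 _∘ₚ_

_+ₚ_ : Poly → Poly → Poly
[]      +ₚ q       = q
(a ∷ p) +ₚ []      = a ∷ p
(a ∷ p) +ₚ (b ∷ q) = (a + b) ∷ (p +ₚ q)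

_·ₚ_ : ℂ → Poly → Poly
a ·ₚ p = List.map (a *_) p

-ₚ_ : Poly → Poly
-ₚ p = List.map (λ a → - a) p

_*ₚ_ : Poly → Poly → Poly
[]      *ₚ q = []
(a ∷ p) *ₚ q = a ·ₚ q +ₚ (0ᶜ ∷ p *ₚ q)

_∘ₚ_ : Poly → Poly → Poly
[]      ∘ₚ q = []
(a ∷ p) ∘ₚ q = (a ∷ []) +ₚ q *ₚ (p ∘ₚ q)

deriv : Poly → Poly
deriv []      = []
deriv (a ∷ p) = p +ₚ (0ᶜ ∷ deriv p)

eval : Poly → ℂ → ℂ
eval []      z = 0ᶜ
eval (a ∷ p) z = a + z * eval p z

-- Chebyshev polynomials of the first kind
T : ℕ → Poly
T 0             = 1ᶜ ∷ []
T 1             = 0ᶜ ∷ 1ᶜ ∷ []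
T (suc (suc n)) = (0ᶜ ∷ ofℕ 2 ∷ []) *ₚ T (suc n) +ₚ (-ₚ T n)

X/2 : Poly
X/2 = 0ᶜ ∷ ofℚ ½ ∷ []

ΣT : ℕ → Poly
ΣT zero    = []
ΣT (suc k) = ΣT k +ₚ T (suc k) ∘ₚ X/2

D : ℕ → ℝ → Poly
D k ν = ((ofℕ k + ofℝ ν * ofℚ ½) ∷ []) +ₚ (-ₚ ΣT k)

Root : Poly → ℂ → Set
Root p z = eval p z ≃ 0ᶜ

AllRootsSimple : Poly → Set
AllRootsSimple p = ∀ z → Root p z → eval (deriv p) z # 0ᶜ

-- An enumeration of the (simple) roots of D k ν, together with the choices of ρ and η.
record RootData (k : ℕ) (ν : ℝ) : Set where
  field
    φ          : Fin k → ℂ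
    φ-root     : ∀ c → Root (D k ν) (φ c)
    φ-distinct : ∀ c d → ¬ (c ≡ d) → φ c # φ d
    φ-complete : ∀ z → Root (D k ν) z → ∃ λ c → z ≃ φ c

    ρ   : Fin k → ℂ
    ρ#0 : ∀ c → ρ c # 0ᶜ
    ρ-φ : ∀ c → (ρ c + inv (ρ c) (ρ#0 c)) ≃ φ c

    η   : Fin k → ℂ
    η#0 : ∀ c → η c # 0ᶜ
    η-ρ : ∀ c → ρ c ≃ (η c * η c)

  γ : Fin k → ℂ
  γ c = η c + inv (η c) (η#0 c)

-- V_0 = 0, V_1 = 1, V_{n+2} = g V_{n+1} - V_n, over ℂ and over ℝ.
V : ℂ → ℕ → ℂ
V g 0             = 0ᶜ
V g 1             = 1ᶜ
V g (suc (suc n)) = g * V g (suc n) - V g n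

Vʳ : ℝ → ℕ → ℝ
Vʳ g 0             = 0ʳ
Vʳ g 1             = 1ʳ
Vʳ g (suc (suc n)) = g *ʳ Vʳ g (suc n) -ʳ Vʳ g n

module _ {k : ℕ} {ν : ℝ} (r : RootData k ν) where
  open RootData r

  NonzeroDenominators : ℕ → Set
  NonzeroDenominators N = ∀ c →
    (γ c * eval (deriv (D k ν)) (φ c)) # 0ᶜ × V (γ c) N # 0ᶜ

  𝒜 : (N : ℕ) → NonzeroDenominators N → ℕ → ℂ
  𝒜 N nz ℓ = Sum.sum (CommutativeRing.+-commutativeMonoid ℂ-commutativeRing) {k} λ c →
    inv (γ c * eval (deriv (D k ν)) (φ c)) (proj₁ (nz c)) *
    (V (γ c) ℓ * V (γ c) (N ℕ.∸ ℓ) * inv (V (γ c) N) (proj₂ (nz c)))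

record Graph : Set₁ where
  infix 4 _~_ _~?_
  field
    Vertex   : Set
    order    : ℕ
    finite   : Vertex ↔ Fin order
    _~_      : Rel Vertex 0ℓ
    _~?_     : Decidable _~_
    ~-sym    : Symmetric _~_
    ~-irrefl : Irreflexive _≡_ _~_

  infix 4 _≟ᵛ_
  _≟ᵛ_ : DecidableEquality Vertex
  _≟ᵛ_ = Fin.inj⇒≟ (Inverse⇒Injection finite)

  ∑ᵛ : (Vertex → ℚ) → ℚ
  ∑ᵛ f = Sum.sum ℚ.+-0-commutativeMonoid (f ∘ F.Inverse.from finite)

  degree : Vertex → ℚ
  degree u = ∑ᵛ λ w → if does (u ~? w) then 1ℚ else 0ℚ

open Graph public using (Vertex)

_≡_[mod_] : ℤ → ℤ → ℕ → Set
a ≡ b [mod N ] = ℤ.+ N ℤ.∣ (a ℤ.- b)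

private
  module ℤS = ℤSolver.+-*-Solver

-- x - y ≡ ±s (mod N)
Differ : (N s : ℕ) → Rel (Fin N) 0ℓ
Differ N s x y =
  (ℤ.+ toℕ x ℤ.- ℤ.+ toℕ y) ≡ ℤ.+ s [mod N ] ⊎
  (ℤ.+ toℕ x ℤ.- ℤ.+ toℕ y) ≡ (ℤ.- (ℤ.+ s)) [mod N ]

CycleAdj : (N k : ℕ) → Rel (Fin N) 0ℓ
CycleAdj N k x y = ∃ λ s → 1 ℕ.≤ s × s ℕ.≤ k × Differ N s x y

private
  differ? : ∀ N s → Decidable (Differ N s)
  differ? N s x y = (_ ℕ.∣? _) ⊎-dec (_ ℕ.∣? _)

  cycleAdj? : ∀ N k → Decidable (CycleAdj N k)
  cycleAdj? N k x y = map′
    (λ (s , s<1+k , 1≤s , p) → s , 1≤s , ℕ.s≤s⁻¹ s<1+k , p)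
    (λ (s , 1≤s , s≤k , p) → s , ℕ.s≤s s≤k , 1≤s , p)
    (ℕ.anyUpTo? (λ s → (1 ℕ.≤? s) ×-dec differ? N s x y) (suc k))

  neg-cong : ∀ N i j → ℤ.- i ≡ j → ℤ.+ N ℤ.∣ i → ℤ.+ N ℤ.∣ j
  neg-cong N i j eq = subst (N ℕ.∣_) (trans (sym (ℤ.∣-i∣≡∣i∣ i)) (cong ℤ.∣_∣ eq))

  differ-sym : ∀ N s x y → Differ N s x y → Differ N s y x
  differ-sym N s x y (inj₁ p) = inj₂ (neg-cong N _ _
    (ℤS.solve 3 (λ a b c → ℤS.:- ((a ℤS.:- b) ℤS.:- c) ℤS.:= (b ℤS.:- a) ℤS.:- (ℤS.:- c))
      refl (ℤ.+ toℕ x) (ℤ.+ toℕ y) (ℤ.+ s)) p)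
  differ-sym N s x y (inj₂ p) = inj₁ (neg-cong N _ _
    (ℤS.solve 3 (λ a b c → ℤS.:- ((a ℤS.:- b) ℤS.:- (ℤS.:- c)) ℤS.:= (b ℤS.:- a) ℤS.:- c)
      refl (ℤ.+ toℕ x) (ℤ.+ toℕ y) (ℤ.+ s)) p)

  differ-self : ∀ N s x → Differ N s x x → N ℕ.∣ s
  differ-self N s x (inj₁ p) = neg-cong N _ (ℤ.+ s)
    (ℤS.solve 2 (λ a c → ℤS.:- ((a ℤS.:- a) ℤS.:- c) ℤS.:= c) refl (ℤ.+ toℕ x) (ℤ.+ s)) p
  differ-self N s x (inj₂ p) = subst (λ i → ℤ.+ N ℤ.∣ i)
    (ℤS.solve 2 (λ a c → (a ℤS.:- a) ℤS.:- (ℤS.:- c) ℤS.:= c) refl (ℤ.+ toℕ x) (ℤ.+ s)) p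

  differ-irrefl : ∀ N s x → 1 ℕ.≤ s → s ℕ.< N → ¬ Differ N s x x
  differ-irrefl N (suc s) x _ s<N d = ℕ.<⇒≱ s<N (ℕ.∣⇒≤ (differ-self N (suc s) x d))

  k<N : ∀ {N k} → 2 ℕ.* k ℕ.+ 1 ℕ.≤ N → k ℕ.< N
  k<N {N} {k} 2k<N = ℕ.≤-trans (ℕ.s≤s (ℕ.m≤m+n k (k ℕ.+ 0)))
    (ℕ.≤-trans (ℕ.≤-reflexive (ℕ.+-comm 1 (2 ℕ.* k))) 2k<N)

-- The bound on N rules out loops.
cyclePower : (N k : ℕ) → 2 ℕ.* k ℕ.+ 1 ℕ.≤ N → Graph
cyclePower N k 2k<N = record
  { Vertex   = Fin N
  ; order    = N
  ; finite   = ↔-id (Fin N)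
  ; _~_      = CycleAdj N k
  ; _~?_     = cycleAdj? N k
  ; ~-sym    = λ {x} {y} (s , 1≤s , s≤k , d) → s , 1≤s , s≤k , differ-sym N s x y d
  ; ~-irrefl = λ { {x} refl (s , 1≤s , s≤k , d) →
      differ-irrefl N s x 1≤s (ℕ.≤-<-trans s≤k (k<N 2k<N)) d }
  }

infixr 7 _□_

_□_ : Graph → Graph → Graph
G □ H = record
  { Vertex   = Vertex G × Vertex H
  ; order    = G.order ℕ.* H.order
  ; finite   = ↔-sym Fin.*↔× ↔-∘ (G.finite ×-↔ H.finite)
  ; _~_      = λ (x , a) (y , b) → (a ≡ b × x G.~ y) ⊎ (x ≡ y × a H.~ b)
  ; _~?_     = λ (x , a) (y , b) →
      ((a H.≟ᵛ b) ×-dec (x G.~? y)) ⊎-dec ((x G.≟ᵛ y) ×-dec (a H.~? b))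
  ; ~-sym    = λ { (inj₁ (a≡b , x~y)) → inj₁ (sym a≡b , G.~-sym x~y)
                 ; (inj₂ (x≡y , a~b)) → inj₂ (sym x≡y , H.~-sym a~b) }
  ; ~-irrefl = λ { refl (inj₁ (_ , x~x)) → G.~-irrefl refl x~x
                 ; refl (inj₂ (_ , a~a)) → H.~-irrefl refl a~a }
  }
  where
  module G = Graph G
  module H = Graph H

-- The generalised Petersen graph GP(5,2): an outer 5-cycle (false), an inner
-- pentagram (true), and spokes joining corresponding vertices.
PetersenAdj : Rel (Bool × Fin 5) 0ℓ
PetersenAdj (false , x) (false , y) = Differ 5 1 x y
PetersenAdj (true  , x) (true  , y) = Differ 5 2 x y
PetersenAdj (false , x) (true  , y) = x ≡ y
PetersenAdj (true  , x) (false , y) = x ≡ y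

petersen : Graph
petersen = record
  { Vertex   = Bool × Fin 5
  ; order    = 10
  ; finite   = ↔-sym Fin.*↔× ↔-∘ (↔-sym Fin.2↔Bool ×-↔ ↔-id (Fin 5))
  ; _~_      = PetersenAdj
  ; _~?_     = λ { (false , x) (false , y) → differ? 5 1 x y
                 ; (true  , x) (true  , y) → differ? 5 2 x y
                 ; (false , x) (true  , y) → x Fin.≟ y
                 ; (true  , x) (false , y) → x Fin.≟ y }
  ; ~-sym    = λ { {false , x} {false , y} → differ-sym 5 1 x y
                 ; {true  , x} {true  , y} → differ-sym 5 2 x y
                 ; {false , x} {true  , y} → sym
                 ; {true  , x} {false , y} → sym }
  ; ~-irrefl = λ { {false , x} refl → differ-irrefl 5 1 x (ℕ.s≤s ℕ.z≤n) (ℕ.s≤s (ℕ.s≤s ℕ.z≤n))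
                 ; {true  , x} refl → differ-irrefl 5 2 x (ℕ.s≤s ℕ.z≤n)
                                        (ℕ.s≤s (ℕ.s≤s (ℕ.s≤s ℕ.z≤n))) }
  }

partialSum : (ℕ → ℚ) → ℕ → ℚ
partialSum f zero    = 0ℚ
partialSum f (suc n) = partialSum f n ℚ.+ f n

module RandomWalk (Y : Graph) where
  open Graph Y hiding (Vertex)

  step : Vertex Y → Vertex Y → ℚ
  step u w = if does (u ~? w) then recip (degree u) else 0ℚ

  -- The expectation of F (Z_0 , … , Z_t) for the walk with Z_0 = u.
  𝔼 : (t : ℕ) → Vertex Y → (Vec (Vertex Y) (suc t) → ℚ) → ℚ
  𝔼 zero    u F = F (u ∷ [])
  𝔼 (suc t) u F = ∑ᵛ λ w → step u w ℚ.* 𝔼 t w (λ z → F (u ∷ z))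

  -- On a trajectory (z_0 , … , z_t), whether T_v = t: z_t = v and z_s ≠ v for s < t.
  firstVisit : ∀ {t} → Vertex Y → Vec (Vertex Y) (suc t) → Bool
  firstVisit v (z ∷ [])          = does (z ≟ᵛ v)
  firstVisit v (z ∷ zs@(_ ∷ _)) = not (does (z ≟ᵛ v)) ∧ firstVisit v zs

  -- P(T_v = t) for the walk started at u
  ℙ[_⇝_at_] : Vertex Y → Vertex Y → ℕ → ℚ
  ℙ[ u ⇝ v at t ] = 𝔼 t u λ z → if firstVisit v z then 1ℚ else 0ℚ

-- h is the expectation of T_v, a random variable with values in ℕ ∪ {∞}, for the
-- walk started at u: almost surely T_v < ∞, and Σ_t t P(T_v = t) converges to h.
record IsHittingTime (Y : Graph) (u v : Vertex Y) (h : ℝ) : Set where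
  open RandomWalk Y
  field
    almost-sure : partialSum (λ t → ℙ[ u ⇝ v at t ]) ⟶ 1ʳ
    mean        : partialSum (λ t → ℕ→ℚ t ℚ.* ℙ[ u ⇝ v at t ]) ⟶ h

-- Hitting times.  Let g(v) = 0 and g = 1 + Pg off v, where P is the transition
-- operator.  Iterating, g - Σ_{t<n} P(T_v > t) is bounded by max |g| · P(T_v ≥ n), so
-- n · P(T_v ≥ n) = O(1); by the Markov property P(T_v ≥ 2n) = O(1/n²).  Hence T_v is
-- almost surely finite with expectation g.
--
-- Let Λ be the Laplacian of C_N^k and Γ_ν the rational Green function of Λ + ν at 0
-- (of Λ modulo constants for ν = 0).  The Laplacian of the Petersen graph has the
-- eigenvalues 0, 2, 5 with multiplicities 1, 5, 4, so the function g of the product is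
-- a combination of Γ_0, Γ_2 and Γ_5, moved to the target by the reflection x ↦ v - x.
--
-- It remains to see that 𝒜(ℓ) = 2 (Γ_ν(ℓ) - Γ_ν(0)).  With S f(x) = f(x+1) + f(x-1) one
-- has Λ + ν = 2 D(S), and w(x) = V_x V_{N-x} satisfies (S - φ) w = γ V_N δ_0 - C with
-- C = γ V_N - 2 V_{N-1}.  Lagrange interpolation, Σ_c D(x) / ((x - φ_c) D′(φ_c)) = 1,
-- turns this into (Λ + ν) 𝒜 = 2 δ_0 - const, and Λ + ν is injective.  The denominator V_N
-- is invertible because pairing w with Γ_ν shows that V_N divides C, while
-- C² = (γ² - 4) V_N² + 4.

{-# OPTIONS --safe #-}

module Submission where

open import Algebra.Bundles using (CommutativeRing)
open import Algebra.Solver.Ring.AlmostCommutativeRing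
  using (_-Raw-AlmostCommutative⟶_; fromCommutativeRing; -raw-almostCommutative⟶)
import Algebra.Solver.Ring as RingSolver
import Algebra.Properties.Semiring.Sum as SemiringSum
open import Data.Bool.Base using (true; false; if_then_else_; not; _∧_)
open import Data.Fin.Base as Fin using (Fin; zero; suc; toℕ; punchIn; punchOut)
import Data.Fin.Properties as Fin
open import Data.List.Base using ([]; _∷_)
import Data.Integer.Base as ℤ
import Data.Integer.Divisibility.Signed as ℤ
import Data.Integer.Solver as ℤ
import Data.Nat.Divisibility as ℕ
import Data.Nat.Solver as ℕ
import Data.Integer.Properties as ℤ
open import Data.Maybe.Base as Maybe using ()
open import Data.Nat.Base as ℕ using (ℕ; zero; suc; NonZero)
open import Data.Nat.DivMod using (_mod_)
import Data.Nat.DivMod as ℕ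
import Data.Nat.Properties as ℕ
open import Data.Product.Base using (Σ-syntax; ∃; _×_; _,_; proj₁; proj₂)
open import Data.Rational.Base as ℚ using (ℚ; 0ℚ; 1ℚ; ½)
import Data.Rational.Properties as ℚ
open import Data.Rational.Unnormalised.Base as ℚᵘ using (ℚᵘ; mkℚᵘ; *≡*)
import Data.Rational.Unnormalised.Properties as ℚᵘ
open import Data.Sum.Base using (_⊎_; inj₁; inj₂; [_,_]′)
open import Data.Unit.Base using (⊤; tt)
open import Data.Vec.Base as Vec using (Vec)
open import Function.Base using (_∘_)
import Function.Bundles as F
open import Level using (0ℓ)
open import Relation.Binary.Consequences using (dec⇒weaklyDec)
open import Relation.Binary.PropositionalEquality as ≡
  using (_≡_; _≢_; refl; cong; cong₂; subst)
open import Relation.Nullary.Decidable.Core using (Dec; does; yes; no; decidable-stable; _×-dec_; _⊎-dec_; from-yes)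
open import Relation.Nullary.Decidable using (¬?; dec-true; dec-false)
open import Relation.Nullary.Negation.Core using (¬_; contradiction)
open import Defs

-- Equality in ℝ and ℂ is undecidable here, and this decides where each argument lives. Whatever
-- needs case distinctions or an order (elimination, positivity of the Dirichlet form, convergence
-- of the walk) happens in ℚ; the hitting times are rational, so `h` and `h′` are constant
-- sequences. ℝ and ℂ receive only equations, carried along a ring map from ℚ. Even the injectivity
-- of Λ + ν is regained there algebraically, by pairing with a rational Green function. In the same
-- spirit, no denominator in ℝ or ℂ is shown to be apart from 0 by estimating it: an inverse is
-- produced by algebra, and whatever has an inverse is apart from 0. Polynomials are not compared by
-- coefficients. They act on functions through a linear operator, so that evaluation at a number and
-- application to the shift operator of the cycle are instances of one calculus. Green functions are
-- the common yardstick: the hitting times and 𝒜 are each expressed by them, and only rational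
-- arithmetic remains.

ℚ-ring : CommutativeRing 0ℓ 0ℓ
ℚ-ring = ℚ.+-*-commutativeRing

-- Sums and indicators over a commutative ring receiving ℚ

-- One map serves both as the embedding of rational data and as the coefficient map of the ring
-- solver. Coefficients are then compared in ℚ, where equality is decidable, even if equality in `R`
-- is not.
ScalarMap : CommutativeRing 0ℓ 0ℓ → Set
ScalarMap R = CommutativeRing.rawRing ℚ-ring -Raw-AlmostCommutative⟶ fromCommutativeRing R

ℚ-scalars : ScalarMap ℚ-ring
ℚ-scalars = -raw-almostCommutative⟶ (fromCommutativeRing ℚ-ring)

module Algebraic (R : CommutativeRing 0ℓ 0ℓ) (scalars : ScalarMap R) where

  open CommutativeRing R public
    renaming ( Carrier to K; _+_ to _⊕_; _*_ to _⊗_; -_ to ⊖_; _-_ to _⊝_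
             ; refl to ≈-refl
             ; zero to ⊗-zero )
  open import Relation.Binary.Reasoning.Setoid setoid public
  open SemiringSum semiring public
  open _-Raw-AlmostCommutative⟶_ scalars public renaming (⟦_⟧ to ι)

  module Solver = RingSolver (CommutativeRing.rawRing ℚ-ring) (fromCommutativeRing R) scalars
    (λ p q → Maybe.map (λ p≡q → reflexive (cong ι p≡q)) (dec⇒weaklyDec ℚ._≟_ p q))

  open Solver public using (solve; _:+_; _:*_; _:-_; :-_; _:=_; con)

  num : ∀ {n} → ℕ → Solver.Polynomial n
  num n = con (ℕ→ℚ n)

  -- Branching on `does d` makes `degree` and `step` sums of this kind by definition.
  indicator : {A : Set} → Dec A → K → K
  indicator d x = if does d then x else 0#

  indicator-cong : {A : Set} (d : Dec A) {x y : K} → (A → x ≈ y) → indicator d x ≈ indicator d y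
  indicator-cong (yes a) eq = eq a
  indicator-cong (no _)  eq = ≈-refl

  indicator-⊗ : {A : Set} (d : Dec A) (x y : K) → indicator d (x ⊗ y) ≈ x ⊗ indicator d y
  indicator-⊗ (yes _) x y = ≈-refl
  indicator-⊗ (no _)  x y = sym (zeroʳ x)

  sum-cong : ∀ {n} {f g : Fin n → K} → (∀ i → f i ≈ g i) → sum f ≈ sum g
  sum-cong = sum-cong-≋

  sum-zero : ∀ {n} {f : Fin n → K} → (∀ i → f i ≈ 0#) → sum f ≈ 0#
  sum-zero {n} eq = trans (sum-cong eq) (sum-replicate-zero n)

  sum-⊕ : ∀ {n} (f g : Fin n → K) → sum (λ i → f i ⊕ g i) ≈ sum f ⊕ sum g
  sum-⊕ = ∑-distrib-+

  sum-⊗ : ∀ {n} (x : K) (f : Fin n → K) → sum (λ i → x ⊗ f i) ≈ x ⊗ sum f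
  sum-⊗ x f = sym (*-distribˡ-sum x f)

  sum-linear : ∀ {n} (a b : K) (f g : Fin n → K) →
    sum (λ i → a ⊗ f i ⊕ b ⊗ g i) ≈ a ⊗ sum f ⊕ b ⊗ sum g
  sum-linear {n} a b f g = trans (sum-⊕ {n} _ _) (+-cong (sum-⊗ a f) (sum-⊗ b g))

  sum-indicator : ∀ {n} (z : Fin n) (f : Fin n → K) → sum (λ i → indicator (z Fin.≟ i) (f i)) ≈ f z
  sum-indicator {suc n} zero f = trans (+-congˡ (sum-zero {n} λ _ → ≈-refl)) (+-identityʳ _)
  sum-indicator {suc n} (suc z) f = trans (+-identityˡ _)
    (trans (sum-cong {n} indicator-suc) (sum-indicator z (f ∘ suc)))
    where
    indicator-suc : ∀ i → indicator (suc z Fin.≟ suc i) (f (suc i)) ≈ indicator (z Fin.≟ i) (f (suc i))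
    indicator-suc i with z Fin.≟ i
    ... | yes _ = ≈-refl
    ... | no  _ = ≈-refl

  ι-indicator : {A : Set} (d : Dec A) → ι (if does d then 1ℚ else 0ℚ) ≈ indicator d 1#
  ι-indicator (yes _) = 1-homo
  ι-indicator (no _)  = 0-homo

module ℚ-Algebra = Algebraic ℚ-ring ℚ-scalars

-- Linear systems over ℚ

module LinearSystems where
  open ℚ-Algebra

  Matrix : ℕ → ℕ → Set
  Matrix m n = Fin m → Fin n → ℚ

  _·_ : ∀ {m n} → Matrix m n → (Fin n → ℚ) → Fin m → ℚ
  (A · x) i = sum λ j → A i j ⊗ x j

  inverse : ∀ {q} → q ≢ 0ℚ → ∃ λ r → q ⊗ r ≡ 1ℚ
  inverse {q} q≢0 = ℚ.1/_ q {{ℚ.≢-nonZero q≢0}} , ℚ.*-inverseʳ q {{ℚ.≢-nonZero q≢0}}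

  -- Here `p` stands for the inverse of the pivot `A i zero`. Row `i` and the column of unknown 0,
  -- which the elimination clears, are left out of the result.
  eliminate : ∀ {m n} → Matrix (suc m) (suc n) → Fin (suc m) → ℚ → Matrix m n
  eliminate A i p r c = A (punchIn i r) (suc c) ⊝ A (punchIn i r) zero ⊗ p ⊗ A i (suc c)

  -- Gaussian elimination of the unknown 0; if it occurs in no equation, it is free.
  dependence : ∀ n (A : Matrix n (suc n)) →
    ∃ λ x → (∀ i → (A · x) i ≡ 0ℚ) × ∃ λ j → x j ≢ 0ℚ
  dependence zero A = (λ _ → 1ℚ) , (λ ()) , zero , λ ()
  dependence (suc n) A with Fin.any? (λ i → ¬? (A i zero ℚ.≟ 0ℚ))
  ... | no none = x , x-solves , zero , λ ()
    where
    x : Fin (suc (suc n)) → ℚ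
    x zero    = 1ℚ
    x (suc _) = 0ℚ
    x-solves : ∀ i → (A · x) i ≡ 0ℚ
    x-solves i = trans
      (+-cong (cong (_⊗ 1ℚ) (decidable-stable (A i zero ℚ.≟ 0ℚ) λ ne → none (i , ne)))
        (sum-zero {suc n} λ j → zeroʳ (A i (suc j))))
      refl
  ... | yes (i , pivot) with inverse pivot
  ... | p , pivot⊗p with dependence n (eliminate A i p)
  ... | y , y-solves , j , y≢0 = x , x-solves , suc j , y≢0
    where
    tail-sum : Fin (suc n) → ℚ
    tail-sum r = sum λ c → A r (suc c) ⊗ y c
    x : Fin (suc (suc n)) → ℚ
    x zero    = ⊖ (p ⊗ tail-sum i)
    x (suc c) = y c
    pivot-row : (A · x) i ≡ 0ℚ
    pivot-row = trans
      (solve 3 (λ a p t → a :* (:- (p :* t)) :+ t := t :- (a :* p) :* t) refl (A i zero) p (tail-sum i))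
      (trans (cong (λ u → tail-sum i ⊝ u ⊗ tail-sum i) pivot⊗p)
        (solve 1 (λ t → t :- con 1ℚ :* t := con 0ℚ) refl (tail-sum i)))
    other-row : ∀ r → (A · x) (punchIn i r) ≡ 0ℚ
    other-row r = trans
      (solve 4 (λ a p t u → a :* (:- (p :* t)) :+ u := con 1ℚ :* u :+ (:- (a :* p)) :* t)
        refl (A (punchIn i r) zero) p (tail-sum i) (tail-sum (punchIn i r)))
      (trans (sym (sum-linear {suc n} 1ℚ (⊖ (A (punchIn i r) zero ⊗ p))
        (λ c → A (punchIn i r) (suc c) ⊗ y c) (λ c → A i (suc c) ⊗ y c)))
      (trans (sum-cong {suc n} λ c →
        solve 5 (λ a b e p y → con 1ℚ :* (b :* y) :+ (:- (a :* p)) :* (e :* y) := (b :- a :* p :* e) :* y)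
          refl (A (punchIn i r) zero) (A (punchIn i r) (suc c)) (A i (suc c)) p (y c))
        (y-solves r)))
    x-solves : ∀ r → (A · x) r ≡ 0ℚ
    x-solves r with i Fin.≟ r
    ... | yes refl = pivot-row
    ... | no  i≢r  = subst (λ r → (A · x) r ≡ 0ℚ) (Fin.punchIn-punchOut i≢r) (other-row (punchOut i≢r))

  _∣_ : ∀ {m n} → (Fin m → ℚ) → Matrix m n → Matrix m (suc n)
  (b ∣ A) i zero    = b i
  (b ∣ A) i (suc j) = A i j

  -- The n columns of A and b are dependent; b must occur in the dependence.
  solvable : ∀ n (A : Matrix n n) → (∀ x → (∀ i → (A · x) i ≡ 0ℚ) → ∀ j → x j ≡ 0ℚ) →
    ∀ b → ∃ λ x → ∀ i → (A · x) i ≡ b i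
  solvable n A injective b with dependence n (b ∣ A)
  ... | x , x-solves , j , x≢0 with x zero ℚ.≟ 0ℚ
  ... | yes x₀≡0 = contradiction (x≡0 j) x≢0
    where
    kernel : ∀ i → (A · (x ∘ suc)) i ≡ 0ℚ
    kernel i = trans (sym (+-identityˡ _)) (trans
      (cong (_⊕ (A · (x ∘ suc)) i) (trans (sym (zeroʳ (b i))) (cong (b i ⊗_) (≡.sym x₀≡0))))
      (x-solves i))
    x≡0 : ∀ j → x j ≡ 0ℚ
    x≡0 zero    = x₀≡0
    x≡0 (suc j) = injective (x ∘ suc) kernel j
  ... | no x₀≢0 with inverse x₀≢0
  ... | p , x₀⊗p = (λ j → (⊖ p) ⊗ x (suc j)) , λ i → trans
    (sum-cong {n} λ j → solve 3 (λ a p x → a :* ((:- p) :* x) := (:- p) :* (a :* x)) refl (A i j) p (x (suc j)))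
    (trans (sum-⊗ {n} (⊖ p) _) (trans
      (solve 4 (λ b x p t → (:- p) :* t := b :* (x :* p) :+ (:- p) :* (b :* x :+ t))
        refl (b i) (x zero) p ((A · (x ∘ suc)) i))
      (trans (cong₂ (λ u v → b i ⊗ u ⊕ (⊖ p) ⊗ v) x₀⊗p (x-solves i))
        (solve 2 (λ b p → b :* con 1ℚ :+ (:- p) :* con 0ℚ := b) refl (b i) p))))

-- Order and Archimedean estimates in ℚ

0≤-* : ∀ {p q} → 0ℚ ℚ.≤ p → 0ℚ ℚ.≤ q → 0ℚ ℚ.≤ p ℚ.* q
0≤-* {p} {q} 0≤p 0≤q = subst (ℚ._≤ p ℚ.* q) (ℚ.*-zeroʳ p)
  (ℚ.*-monoˡ-≤-nonNeg p {{ℚ.nonNegative 0≤p}} 0≤q)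

0≤-+ : ∀ {p q} → 0ℚ ℚ.≤ p → 0ℚ ℚ.≤ q → 0ℚ ℚ.≤ p ℚ.+ q
0≤-+ = ℚ.+-mono-≤

0≤⇒≤ : ∀ {p q} e → q ℚ.- p ≡ e → 0ℚ ℚ.≤ e → p ℚ.≤ q
0≤⇒≤ {p} {q} e eq 0≤e = ℚ.≤-trans (ℚ.≤-reflexive (≡.sym (ℚ.+-identityʳ p)))
  (ℚ.≤-trans (ℚ.+-monoʳ-≤ p 0≤e) (ℚ.≤-reflexive (≡.trans (cong (p ℚ.+_) (≡.sym eq))
    (solve 2 (λ p q → p :+ (q :- p) := q) refl p q))))
  where open ℚ-Algebra using (solve; _:+_; _:*_; _:-_; _:=_)

≤⇒0≤ : ∀ {p q} → p ℚ.≤ q → 0ℚ ℚ.≤ q ℚ.- p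
≤⇒0≤ {p} {q} p≤q = subst (ℚ._≤ q ℚ.- p) (ℚ.+-inverseʳ p) (ℚ.+-monoˡ-≤ (ℚ.- p) p≤q)

fromℚᵘ-+ : ∀ {x y z} → x ℚᵘ.+ y ℚᵘ.≃ z → ℚ.fromℚᵘ x ℚ.+ ℚ.fromℚᵘ y ≡ ℚ.fromℚᵘ z
fromℚᵘ-+ {x} {y} {z} eq = ℚ.toℚᵘ-injective (ℚᵘ.≃-trans (ℚ.toℚᵘ-homo-+ (ℚ.fromℚᵘ x) (ℚ.fromℚᵘ y))
  (ℚᵘ.≃-trans (ℚᵘ.+-cong (ℚ.toℚᵘ-fromℚᵘ x) (ℚ.toℚᵘ-fromℚᵘ y))
  (ℚᵘ.≃-trans eq (ℚᵘ.≃-sym (ℚ.toℚᵘ-fromℚᵘ z)))))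

fromℚᵘ-* : ∀ {x y z} → x ℚᵘ.* y ℚᵘ.≃ z → ℚ.fromℚᵘ x ℚ.* ℚ.fromℚᵘ y ≡ ℚ.fromℚᵘ z
fromℚᵘ-* {x} {y} {z} eq = ℚ.toℚᵘ-injective (ℚᵘ.≃-trans (ℚ.toℚᵘ-homo-* (ℚ.fromℚᵘ x) (ℚ.fromℚᵘ y))
  (ℚᵘ.≃-trans (ℚᵘ.*-cong (ℚ.toℚᵘ-fromℚᵘ x) (ℚ.toℚᵘ-fromℚᵘ y))
  (ℚᵘ.≃-trans eq (ℚᵘ.≃-sym (ℚ.toℚᵘ-fromℚᵘ z)))))

ℕ→ℚ-+ : ∀ m n → ℕ→ℚ (m ℕ.+ n) ≡ ℕ→ℚ m ℚ.+ ℕ→ℚ n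
ℕ→ℚ-+ m n = ≡.sym (fromℚᵘ-+ {mkℚᵘ (ℤ.+ m) 0} {mkℚᵘ (ℤ.+ n) 0} {mkℚᵘ (ℤ.+ (m ℕ.+ n)) 0}
  (*≡* (cong (ℤ._* ℤ.+ 1) (cong₂ ℤ._+_ (ℤ.*-identityʳ (ℤ.+ m)) (ℤ.*-identityʳ (ℤ.+ n))))))

ℕ→ℚ-suc : ∀ n → ℕ→ℚ (suc n) ≡ ℕ→ℚ n ℚ.+ 1ℚ
ℕ→ℚ-suc n = ≡.trans (ℕ→ℚ-+ 1 n) (ℚ.+-comm 1ℚ (ℕ→ℚ n))

ℕ→ℚ-* : ∀ m n → ℕ→ℚ (m ℕ.* n) ≡ ℕ→ℚ m ℚ.* ℕ→ℚ n
ℕ→ℚ-* m n = ≡.sym (fromℚᵘ-* {mkℚᵘ (ℤ.+ m) 0} {mkℚᵘ (ℤ.+ n) 0} {mkℚᵘ (ℤ.+ (m ℕ.* n)) 0}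
  (*≡* (cong (ℤ._* ℤ.+ 1) (≡.sym (ℤ.pos-* m n)))))

/-* : ∀ m n .{{_ : NonZero n}} → (ℤ.+ m ℚ./ n) ℚ.* ℕ→ℚ n ≡ ℕ→ℚ m
/-* m (suc n) = fromℚᵘ-* {mkℚᵘ (ℤ.+ m) n} {mkℚᵘ (ℤ.+ suc n) 0} {mkℚᵘ (ℤ.+ m) 0}
  (*≡* (≡.trans (ℤ.*-identityʳ _) (cong (λ d → ℤ.+ m ℤ.* ℤ.+ d) (≡.sym (ℕ.*-identityʳ (suc n))))))

0≤ℕ→ℚ : ∀ n → 0ℚ ℚ.≤ ℕ→ℚ n
0≤ℕ→ℚ n = ℚ.nonNegative⁻¹ (ℕ→ℚ n) {{ℚ.normalize-nonNeg n 1}}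

0<ℕ→ℚ : ∀ n .{{_ : NonZero n}} → 0ℚ ℚ.< ℕ→ℚ n
0<ℕ→ℚ (suc n) = ℚ.positive⁻¹ (ℕ→ℚ (suc n)) {{ℚ.normalize-pos (suc n) 1}}

ℕ→ℚ≢0 : ∀ n .{{_ : NonZero n}} → ℕ→ℚ n ≢ 0ℚ
ℕ→ℚ≢0 n eq = ℚ.<-irrefl (≡.sym eq) (0<ℕ→ℚ n)

ℕ→ℚ-mono : ∀ {m n} → m ℕ.≤ n → ℕ→ℚ m ℚ.≤ ℕ→ℚ n
ℕ→ℚ-mono {m} {n} m≤n = subst (λ l → ℕ→ℚ m ℚ.≤ ℕ→ℚ l) (ℕ.m+[n∸m]≡n m≤n)
  (0≤⇒≤ (ℕ→ℚ (n ℕ.∸ m)) (≡.trans (cong (ℚ._- ℕ→ℚ m) (ℕ→ℚ-+ m (n ℕ.∸ m)))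
    (solve 2 (λ m d → (m :+ d) :- m := d) refl (ℕ→ℚ m) (ℕ→ℚ (n ℕ.∸ m)))) (0≤ℕ→ℚ (n ℕ.∸ m)))
  where open ℚ-Algebra using (solve; _:+_; _:*_; _:-_; _:=_)

recip-inverse : ∀ {q} → q ≢ 0ℚ → q ℚ.* recip q ≡ 1ℚ
recip-inverse {q} q≢0 with q ℚ.≟ 0ℚ
... | yes q≡0 = contradiction q≡0 q≢0
... | no  q≢0 = ℚ.*-inverseʳ q {{ℚ.≢-nonZero q≢0}}

0≤recip : ∀ {q} → 0ℚ ℚ.≤ q → 0ℚ ℚ.≤ recip q
0≤recip {q} 0≤q with q ℚ.≟ 0ℚ
... | yes _ = ℚ.≤-refl
... | no q≢0 = ℚ.<⇒≤ (ℚ.positive⁻¹ _ {{ℚ.1/pos⇒pos q {{q>0}}}})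
  where
  instance
    q>0 : ℚ.Positive q
    q>0 = ℚ.nonNeg∧nonZero⇒pos q {{ℚ.nonNegative 0≤q}} {{ℚ.≢-nonZero q≢0}}

archimedean : ∀ q → ∃ λ n → q ℚ.< ℕ→ℚ n
archimedean q@(ℚ.mkℚ n d c) = suc ℤ.∣ n ∣ , ℚ.toℚᵘ-cancel-<
  (ℚᵘ.<-respʳ-≃ (ℚᵘ.≃-sym (ℚ.toℚᵘ-fromℚᵘ (mkℚᵘ (ℤ.+ suc ℤ.∣ n ∣) 0))) (ℚᵘ.*<* (less n)))
  where
  less : ∀ n → n ℤ.* ℤ.+ 1 ℤ.< ℤ.+ suc ℤ.∣ n ∣ ℤ.* ℤ.+ suc d
  less (ℤ.+ n) = subst (ℤ._< ℤ.+ suc n ℤ.* ℤ.+ suc d) (≡.sym (ℤ.*-identityʳ (ℤ.+ n)))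
    (ℤ.+<+ (ℕ.<-≤-trans (ℕ.n<1+n n) (ℕ.m≤m*n (suc n) (suc d))))
  less (ℤ.-[1+ n ]) = ℤ.-<+

-- By Archimedes some `M` exceeds `C/ε`. The bound is asked only from 2 on because the quadratic
-- survival estimate cuts `n` into two nonempty halves.
null-if-O[1/n] : ∀ {d : ℕ → ℚ} C → (∀ n → 2 ℕ.≤ n → ℕ→ℚ n ℚ.* ℚ.∣ d n ∣ ℚ.≤ C) → Null d
null-if-O[1/n] {d} C bound ε 0<ε with archimedean (C ℚ.* recip ε)
... | M , C/ε<M = 2 ℕ.⊔ M , λ n M≤n → ℚ.≰⇒> λ ε≤d →
  let 2≤n  = ℕ.m⊔n≤o⇒m≤o 2 M M≤n
      nε≤C = ℚ.≤-trans (ℚ.*-monoˡ-≤-nonNeg (ℕ→ℚ n) {{ℚ.nonNegative (0≤ℕ→ℚ n)}} ε≤d) (bound n 2≤n)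
  in ℚ.<-irrefl refl (ℚ.<-≤-trans C/ε<M (ℚ.≤-trans (ℕ→ℚ-mono (ℕ.m⊔n≤o⇒n≤o 2 M M≤n))
       (subst (ℚ._≤ C ℚ.* recip ε)
         (≡.trans (solve 3 (λ n ε r → n :* ε :* r := n :* (ε :* r)) refl (ℕ→ℚ n) ε (recip ε))
           (≡.trans (cong (ℕ→ℚ n ℚ.*_) (recip-inverse {ε} λ { refl → ℚ.<-irrefl refl 0<ε }))
             (ℚ.*-identityʳ (ℕ→ℚ n))))
         (ℚ.*-monoʳ-≤-nonNeg (recip ε) {{ℚ.nonNegative (0≤recip (ℚ.<⇒≤ 0<ε))}} nε≤C))))
  where open ℚ-Algebra using (solve; _:+_; _:*_; _:-_; _:=_)

p≤∣p∣ : ∀ p → p ℚ.≤ ℚ.∣ p ∣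
p≤∣p∣ p with ℚ.≤-total 0ℚ p
... | inj₁ 0≤p = ℚ.≤-reflexive (≡.sym (ℚ.0≤p⇒∣p∣≡p 0≤p))
... | inj₂ p≤0 = ℚ.≤-trans p≤0 (ℚ.0≤∣p∣ p)

module _ where
  open ℚ-Algebra using (sum; solve; _:+_; _:*_; _:-_; _:=_)

  0≤sum : ∀ {n} {f : Fin n → ℚ} → (∀ i → 0ℚ ℚ.≤ f i) → 0ℚ ℚ.≤ sum f
  0≤sum {zero}  0≤f = ℚ.≤-refl
  0≤sum {suc n} 0≤f = 0≤-+ (0≤f zero) (0≤sum (0≤f ∘ suc))

  ≤sum : ∀ {n} {f : Fin n → ℚ} → (∀ i → 0ℚ ℚ.≤ f i) → ∀ i → f i ℚ.≤ sum f
  ≤sum {f = f} 0≤f zero = 0≤⇒≤ _ (solve 2 (λ x s → (x :+ s) :- x := s) refl (f zero) (sum (f ∘ suc)))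
    (0≤sum (0≤f ∘ suc))
  ≤sum {f = f} 0≤f (suc i) = ℚ.≤-trans (≤sum (0≤f ∘ suc) i)
    (0≤⇒≤ _ (solve 2 (λ x s → (x :+ s) :- s := x) refl (f zero) (sum (f ∘ suc))) (0≤f zero))

  sum≡0⇒≡0 : ∀ {n} {f : Fin n → ℚ} → (∀ i → 0ℚ ℚ.≤ f i) → sum f ≡ 0ℚ → ∀ i → f i ≡ 0ℚ
  sum≡0⇒≡0 0≤f Σf≡0 i = ℚ.≤-antisym (ℚ.≤-trans (≤sum 0≤f i) (ℚ.≤-reflexive Σf≡0)) (0≤f i)

0≤square : ∀ p → 0ℚ ℚ.≤ p ℚ.* p
0≤square p with ℚ.∣p∣≡p∨∣p∣≡-p p
... | inj₁ eq = subst (0ℚ ℚ.≤_) (cong₂ ℚ._*_ eq eq) (0≤-* (ℚ.0≤∣p∣ p) (ℚ.0≤∣p∣ p))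
... | inj₂ eq = subst (0ℚ ℚ.≤_) (≡.trans (cong₂ ℚ._*_ eq eq)
    (solve 1 (λ p → (:- p) :* (:- p) := p :* p) refl p)) (0≤-* (ℚ.0≤∣p∣ p) (ℚ.0≤∣p∣ p))
  where open ℚ-Algebra using (solve; _:*_; :-_; _:=_)

p*q≡0⇒q≡0 : ∀ {p q} → p ≢ 0ℚ → p ℚ.* q ≡ 0ℚ → q ≡ 0ℚ
p*q≡0⇒q≡0 {p} {q} p≢0 pq≡0 = ≡.trans (≡.sym (ℚ.*-identityˡ q)) (≡.trans
  (cong (ℚ._* q) (≡.trans (≡.sym (recip-inverse p≢0)) (ℚ.*-comm p (recip p))))
  (≡.trans (ℚ.*-assoc (recip p) p q) (≡.trans (cong (recip p ℚ.*_) pq≡0) (ℚ.*-zeroʳ (recip p)))))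

square≡0⇒≡0 : ∀ p → p ℚ.* p ≡ 0ℚ → p ≡ 0ℚ
square≡0⇒≡0 p p²≡0 with p ℚ.≟ 0ℚ
... | yes p≡0 = p≡0
... | no  p≢0 = p*q≡0⇒q≡0 p≢0 p²≡0

-- Hitting times from solutions of the harmonic equation

module HittingTimes (Y : Graph) where

  open Graph Y hiding (Vertex)
  open RandomWalk Y
  open ℚ-Algebra

  ∑-cong : ∀ {f g : Vertex Y → ℚ} → (∀ w → f w ≡ g w) → ∑ᵛ f ≡ ∑ᵛ g
  ∑-cong eq = sum-cong {order} λ i → eq _

  ∑-⊗ : ∀ x (f : Vertex Y → ℚ) → ∑ᵛ (λ w → x ⊗ f w) ≡ x ⊗ ∑ᵛ f
  ∑-⊗ x f = sum-⊗ {order} x _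

  ∑-linear : ∀ a b (f g : Vertex Y → ℚ) → ∑ᵛ (λ w → a ⊗ f w ⊕ b ⊗ g w) ≡ a ⊗ ∑ᵛ f ⊕ b ⊗ ∑ᵛ g
  ∑-linear a b f g = sum-linear {order} a b _ _

  0≤∑ : ∀ {f : Vertex Y → ℚ} → (∀ w → 0ℚ ℚ.≤ f w) → 0ℚ ℚ.≤ ∑ᵛ f
  0≤∑ 0≤f = 0≤sum {order} λ i → 0≤f _

  ≤∑ : ∀ {f : Vertex Y → ℚ} → (∀ w → 0ℚ ℚ.≤ f w) → ∀ w → f w ℚ.≤ ∑ᵛ f
  ≤∑ {f} 0≤f w = subst (λ w → f w ℚ.≤ ∑ᵛ f) (F.Inverse.strictlyInverseʳ finite w)
    (≤sum (λ i → 0≤f _) (F.Inverse.to finite w))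

  0≤degree : ∀ u → 0ℚ ℚ.≤ degree u
  0≤degree u = 0≤∑ λ w → 0≤if (does (u ~? w))
    where
    0≤if : ∀ b → 0ℚ ℚ.≤ (if b then 1ℚ else 0ℚ)
    0≤if true  = ℚ.*≤* (ℤ.+≤+ ℕ.z≤n)
    0≤if false = ℚ.≤-refl

  0≤step : ∀ u w → 0ℚ ℚ.≤ step u w
  0≤step u w with does (u ~? w)
  ... | true  = 0≤recip (0≤degree u)
  ... | false = ℚ.≤-refl

  neighbourSum : (Vertex Y → ℚ) → Vertex Y → ℚ
  neighbourSum f u = ∑ᵛ λ w → indicator (u ~? w) (f w)

  average : (Vertex Y → ℚ) → Vertex Y → ℚ
  average f u = ∑ᵛ λ w → step u w ⊗ f w

  average-neighbourSum : ∀ f u → average f u ≡ recip (degree u) ⊗ neighbourSum f u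
  average-neighbourSum f u = trans (∑-cong term) (∑-⊗ (recip (degree u)) λ w → indicator (u ~? w) (f w))
    where
    term : ∀ w → step u w ⊗ f w ≡ recip (degree u) ⊗ indicator (u ~? w) (f w)
    term w with does (u ~? w)
    ... | true  = refl
    ... | false = trans (zeroˡ (f w)) (sym (zeroʳ (recip (degree u))))

  average-1 : ∀ u → degree u ≢ 0ℚ → average (λ _ → 1ℚ) u ≡ 1ℚ
  average-1 u d≢0 = trans (average-neighbourSum (λ _ → 1ℚ) u)
    (trans (*-comm (recip (degree u)) (degree u)) (recip-inverse d≢0))

  module _ (v : Vertex Y) where

    killed : (Vertex Y → ℚ) → Vertex Y → ℚ
    killed f u = if does (u ≟ᵛ v) then 0ℚ else average f u

    killed-at : ∀ f → killed f v ≡ 0ℚ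
    killed-at f = cong (if_then 0ℚ else average f v) (dec-true (v ≟ᵛ v) refl)

    killed-away : ∀ f {u} → u ≢ v → killed f u ≡ average f u
    killed-away f {u} u≢v = cong (if_then 0ℚ else average f u) (dec-false (u ≟ᵛ v) u≢v)

    killed-cong : ∀ {f g : Vertex Y → ℚ} → (∀ w → f w ≡ g w) → ∀ u → killed f u ≡ killed g u
    killed-cong {f} {g} eq u with does (u ≟ᵛ v)
    ... | true  = refl
    ... | false = ∑-cong {λ w → step u w ⊗ f w} {λ w → step u w ⊗ g w} λ w → cong (step u w ⊗_) (eq w)

    killed-linear : ∀ a b (f g : Vertex Y → ℚ) u →
      killed (λ w → a ⊗ f w ⊕ b ⊗ g w) u ≡ a ⊗ killed f u ⊕ b ⊗ killed g u
    killed-linear a b f g u with does (u ≟ᵛ v)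
    ... | true  = solve 2 (λ a b → con 0ℚ := a :* con 0ℚ :+ b :* con 0ℚ) refl a b
    ... | false = trans
      (∑-cong {λ w → step u w ⊗ (a ⊗ f w ⊕ b ⊗ g w)} λ w → solve 5 (λ s a b x y → s :* (a :* x :+ b :* y) := a :* (s :* x) :+ b :* (s :* y))
        refl (step u w) a b (f w) (g w))
      (∑-linear a b (λ w → step u w ⊗ f w) (λ w → step u w ⊗ g w))

    0≤killed : ∀ {f : Vertex Y → ℚ} → (∀ w → 0ℚ ℚ.≤ f w) → ∀ u → 0ℚ ℚ.≤ killed f u
    0≤killed 0≤f u with does (u ≟ᵛ v)
    ... | true  = ℚ.≤-refl
    ... | false = 0≤∑ λ w → 0≤-* (0≤step u w) (0≤f w)

    killed-mono : ∀ {f g : Vertex Y → ℚ} → (∀ w → f w ℚ.≤ g w) → ∀ u → killed f u ℚ.≤ killed g u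
    killed-mono {f} {g} f≤g u = 0≤⇒≤ _
      (trans (solve 2 (λ x y → y :- x := con 1ℚ :* y :+ con (ℚ.- 1ℚ) :* x) refl (killed f u) (killed g u))
        (sym (killed-linear 1ℚ (ℚ.- 1ℚ) g f u)))
      (0≤killed (λ w → subst (0ℚ ℚ.≤_)
        (solve 2 (λ x y → y :- x := con 1ℚ :* y :+ con (ℚ.- 1ℚ) :* x) refl (f w) (g w))
        (≤⇒0≤ (f≤g w))) u)

    killed-⊗ : ∀ a (f : Vertex Y → ℚ) u → killed (λ w → a ⊗ f w) u ≡ a ⊗ killed f u
    killed-⊗ a f u = trans
      (killed-cong (λ w → solve 2 (λ a x → a :* x := a :* x :+ con 0ℚ :* x) refl a (f w)) u)
      (trans (killed-linear a 0ℚ f f u)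
        (solve 2 (λ a x → a :* x :+ con 0ℚ :* x := a :* x) refl a (killed f u)))

    iterate : (Vertex Y → ℚ) → ℕ → Vertex Y → ℚ
    iterate f zero    = f
    iterate f (suc t) = killed (iterate f t)

    -- This is P(T_v ≥ t), not P(T_v > t): at time 0 it equals 1 even at `v`, and `survival 1` is
    -- the indicator of the complement of `v`.
    survival : ℕ → Vertex Y → ℚ
    survival = iterate λ _ → 1ℚ

    𝔼-cong : ∀ t u {F G : Vec (Vertex Y) (suc t) → ℚ} → (∀ z → F z ≡ G z) → 𝔼 t u F ≡ 𝔼 t u G
    𝔼-cong zero    u eq = eq _
    𝔼-cong (suc t) u eq = ∑-cong λ w → cong (step u w ⊗_) (𝔼-cong t w λ z → eq _)

    𝔼-zero : ∀ t u → 𝔼 t u (λ _ → 0ℚ) ≡ 0ℚ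
    𝔼-zero zero    u = refl
    𝔼-zero (suc t) u = sum-zero {order} λ i →
      trans (cong (step u (F.Inverse.from finite i) ⊗_) (𝔼-zero t _)) (zeroʳ (step u (F.Inverse.from finite i)))

    -- First-step analysis. From `v` the visit at time 0 falsifies `firstVisit` on every longer
    -- trajectory; from elsewhere the leading factor of `firstVisit` is true and drops out.
    ℙ-suc : ∀ t u → ℙ[ u ⇝ v at suc t ] ≡ killed (λ w → ℙ[ w ⇝ v at t ]) u
    ℙ-suc t u with does (u ≟ᵛ v) in u≟v
    ... | true = sum-zero {order} λ i → trans
      (cong (step u (F.Inverse.from finite i) ⊗_)
        (trans (𝔼-cong t _ λ { (z Vec.∷ zs) → cong
          (λ b → if not b ∧ firstVisit v (z Vec.∷ zs) then 1ℚ else 0ℚ) u≟v }) (𝔼-zero t _)))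
      (zeroʳ (step u (F.Inverse.from finite i)))
    ... | false = ∑-cong
      {λ w → step u w ⊗ 𝔼 t w (λ z → if firstVisit v (u Vec.∷ z) then 1ℚ else 0ℚ)}
      {λ w → step u w ⊗ ℙ[ w ⇝ v at t ]} λ w → cong (step u w ⊗_)
      (𝔼-cong t w λ { (z Vec.∷ zs) → cong
          (λ b → if not b ∧ firstVisit v (z Vec.∷ zs) then 1ℚ else 0ℚ) u≟v })

    module _ (degree≢0 : ∀ u → degree u ≢ 0ℚ) where

      -- Both sides obey the first-step recursion given by `killed`. Nonzero degrees enter at time
      -- 0, where the steps out of `u` must have total mass 1.
      ℙ-survival : ∀ t u → ℙ[ u ⇝ v at t ] ≡ survival t u ⊝ survival (suc t) u
      ℙ-survival zero u with does (u ≟ᵛ v)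
      ... | true  = refl
      ... | false = sym (cong (λ q → 1ℚ ⊝ q) (average-1 u (degree≢0 u)))
      ℙ-survival (suc t) u = trans (ℙ-suc t u) (trans
        (killed-cong (λ w → trans (ℙ-survival t w)
          (solve 2 (λ x y → x :- y := con 1ℚ :* x :+ con (ℚ.- 1ℚ) :* y) refl (survival t w) (survival (suc t) w))) u)
        (trans (killed-linear 1ℚ (ℚ.- 1ℚ) (survival t) (survival (suc t)) u)
          (solve 2 (λ x y → con 1ℚ :* x :+ con (ℚ.- 1ℚ) :* y := x :- y) refl
            (survival (suc t) u) (survival (suc (suc t)) u))))

      0≤survival : ∀ t u → 0ℚ ℚ.≤ survival t u
      0≤survival zero    u = ℚ.*≤* (ℤ.+≤+ ℕ.z≤n)
      0≤survival (suc t) u = 0≤killed (0≤survival t) u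

      survival-decreasing : ∀ t u → survival (suc t) u ℚ.≤ survival t u
      survival-decreasing zero u with does (u ≟ᵛ v)
      ... | true  = ℚ.*≤* (ℤ.+≤+ ℕ.z≤n)
      ... | false = ℚ.≤-reflexive (average-1 u (degree≢0 u))
      survival-decreasing (suc t) u = killed-mono (survival-decreasing t) u

      survival≤1 : ∀ t u → survival t u ℚ.≤ 1ℚ
      survival≤1 zero    u = ℚ.≤-refl
      survival≤1 (suc t) u = ℚ.≤-trans (survival-decreasing t u) (survival≤1 t u)

      partialSum-ℙ : ∀ u n → partialSum (λ t → ℙ[ u ⇝ v at t ]) n ≡ 1ℚ ⊝ survival n u
      partialSum-ℙ u zero    = refl
      partialSum-ℙ u (suc n) = trans (cong₂ _⊕_ (partialSum-ℙ u n) (ℙ-survival n u))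
        (solve 2 (λ x y → (con 1ℚ :- x) :+ (x :- y) := con 1ℚ :- y) refl (survival n u) (survival (suc n) u))

      -- No sign condition on g: its remainder after n steps is at most max |g| times survival n.
      module _ (g : Vertex Y → ℚ) (g-harmonic : ∀ u → g u ≡ survival 1 u ⊕ killed g u) where

        -- The expectation of g(Z_n) on the event T_v ≥ n. As `survival 1` vanishes at `v`, the
        -- single equation `g-harmonic` also contains the boundary condition g(v) = 0.
        remainder : ℕ → Vertex Y → ℚ
        remainder = iterate g

        remainder-step : ∀ t u → remainder t u ≡ survival (suc t) u ⊕ remainder (suc t) u
        remainder-step zero    u = g-harmonic u
        remainder-step (suc t) u = trans
          (killed-cong (λ w → trans (remainder-step t w)
            (solve 2 (λ x y → x :+ y := con 1ℚ :* x :+ con 1ℚ :* y) refl (survival (suc t) w) (remainder (suc t) w))) u)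
          (trans (killed-linear 1ℚ 1ℚ (survival (suc t)) (remainder (suc t)) u)
            (solve 2 (λ x y → con 1ℚ :* x :+ con 1ℚ :* y := x :+ y) refl
              (survival (suc (suc t)) u) (remainder (suc (suc t)) u)))

        -- Summation by parts. Its boundary term `n · survival n` must tend to 0, for which P(T_v ≥
        -- n) = O(1/n) would not suffice; hence the quadratic estimate below.
        partialSum-mean : ∀ u n → partialSum (λ t → ℕ→ℚ t ⊗ ℙ[ u ⇝ v at t ]) n ≡
          g u ⊝ (remainder n u ⊕ ℕ→ℚ n ⊗ survival n u)
        partialSum-mean u zero = solve 1 (λ g → con 0ℚ := g :- (g :+ con 0ℚ :* con 1ℚ)) refl (g u)
        partialSum-mean u (suc n) = begin
          partialSum (λ t → ℕ→ℚ t ⊗ ℙ[ u ⇝ v at t ]) n ⊕ ℕ→ℚ n ⊗ ℙ[ u ⇝ v at n ]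
            ≈⟨ cong₂ (λ p q → p ⊕ ℕ→ℚ n ⊗ q) (partialSum-mean u n) (ℙ-survival n u) ⟩
          (g u ⊝ (remainder n u ⊕ ℕ→ℚ n ⊗ survival n u)) ⊕ ℕ→ℚ n ⊗ (survival n u ⊝ survival (suc n) u)
            ≈⟨ cong (λ q → (g u ⊝ (q ⊕ ℕ→ℚ n ⊗ survival n u)) ⊕ ℕ→ℚ n ⊗ (survival n u ⊝ survival (suc n) u))
                 (remainder-step n u) ⟩
          (g u ⊝ ((survival (suc n) u ⊕ remainder (suc n) u) ⊕ ℕ→ℚ n ⊗ survival n u))
            ⊕ ℕ→ℚ n ⊗ (survival n u ⊝ survival (suc n) u)
            ≈⟨ solve 5 (λ g s r n s′ →
                 (g :- ((s :+ r) :+ n :* s′)) :+ n :* (s′ :- s) := g :- (r :+ (n :+ con 1ℚ) :* s))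
                 refl (g u) (survival (suc n) u) (remainder (suc n) u) (ℕ→ℚ n) (survival n u) ⟩
          g u ⊝ (remainder (suc n) u ⊕ (ℕ→ℚ n ⊕ 1ℚ) ⊗ survival (suc n) u)
            ≈⟨ cong (λ q → g u ⊝ (remainder (suc n) u ⊕ q ⊗ survival (suc n) u)) (ℕ→ℚ-suc n) ⟨
          g u ⊝ (remainder (suc n) u ⊕ ℕ→ℚ (suc n) ⊗ survival (suc n) u) ∎

        -- The sum over all vertices stands in for max |g| and needs no choice of a maximiser. `R`
        -- bounds the difference of `g` and any remainder.
        B R : ℚ
        B = ∑ᵛ (ℚ.∣_∣ ∘ g)
        R = B ⊕ B

        0≤B : 0ℚ ℚ.≤ B
        0≤B = 0≤∑ λ w → ℚ.0≤∣p∣ (g w)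

        0≤R : 0ℚ ℚ.≤ R
        0≤R = 0≤-+ 0≤B 0≤B

        ∣g∣≤B : ∀ u → ℚ.∣ g u ∣ ℚ.≤ B
        ∣g∣≤B = ≤∑ λ w → ℚ.0≤∣p∣ (g w)

        remainder-upper : ∀ t u → remainder t u ℚ.≤ B ⊗ survival t u
        remainder-upper zero u = ℚ.≤-trans (p≤∣p∣ (g u))
          (ℚ.≤-trans (∣g∣≤B u) (ℚ.≤-reflexive (≡.sym (ℚ.*-identityʳ B))))
        remainder-upper (suc t) u = ℚ.≤-trans (killed-mono (remainder-upper t) u)
          (ℚ.≤-reflexive (killed-⊗ B (survival t) u))

        remainder-lower : ∀ t u → (⊖ B) ⊗ survival t u ℚ.≤ remainder t u
        remainder-lower zero u = 0≤⇒≤ _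
          (solve 2 (λ g B → g :- (:- B) :* con 1ℚ := (:- (:- B)) :- (:- g)) refl (g u) B)
          (≤⇒0≤ (ℚ.≤-trans (p≤∣p∣ (⊖ g u)) (ℚ.≤-trans (ℚ.≤-reflexive (ℚ.∣-p∣≡∣p∣ (g u)))
            (ℚ.≤-trans (∣g∣≤B u) (ℚ.≤-reflexive (solve 1 (λ B → B := :- (:- B)) refl B))))))
        remainder-lower (suc t) u = ℚ.≤-trans
          (ℚ.≤-reflexive (≡.sym (killed-⊗ (⊖ B) (survival t) u))) (killed-mono (remainder-lower t) u)

        ∣remainder∣≤ : ∀ t u → ℚ.∣ remainder t u ∣ ℚ.≤ B ⊗ survival t u
        ∣remainder∣≤ t u with ℚ.∣p∣≡p∨∣p∣≡-p (remainder t u)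
        ... | inj₁ eq = ℚ.≤-trans (ℚ.≤-reflexive eq) (remainder-upper t u)
        ... | inj₂ eq = ℚ.≤-trans (ℚ.≤-reflexive eq) (0≤⇒≤ _
          (solve 3 (λ r B s → B :* s :- (:- r) := r :- (:- B) :* s) refl (remainder t u) B (survival t u))
          (≤⇒0≤ (remainder-lower t u)))

        -- The right-hand side is the sum of `survival 1`, ..., `survival n`, and the last of these
        -- terms is the smallest.
        n·survival≤telescope : ∀ n u → ℕ→ℚ n ⊗ survival n u ℚ.≤ g u ⊝ remainder n u
        n·survival≤telescope zero u = ℚ.≤-reflexive
          (solve 1 (λ g → con 0ℚ :* con 1ℚ := g :- g) refl (g u))
        n·survival≤telescope (suc n) u = 0≤⇒≤ _
          (begin
            (g u ⊝ remainder (suc n) u) ⊝ ℕ→ℚ (suc n) ⊗ survival (suc n) u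
              ≈⟨ cong (λ q → (g u ⊝ remainder (suc n) u) ⊝ q ⊗ survival (suc n) u) (ℕ→ℚ-suc n) ⟩
            (g u ⊝ remainder (suc n) u) ⊝ (ℕ→ℚ n ⊕ 1ℚ) ⊗ survival (suc n) u
              ≈⟨ solve 5 (λ g r n s s′ → (g :- r) :- (n :+ con 1ℚ) :* s :=
                   ((g :- (s :+ r)) :- n :* s′) :+ n :* (s′ :- s)) refl
                   (g u) (remainder (suc n) u) (ℕ→ℚ n) (survival (suc n) u) (survival n u) ⟩
            ((g u ⊝ (survival (suc n) u ⊕ remainder (suc n) u)) ⊝ ℕ→ℚ n ⊗ survival n u)
              ⊕ ℕ→ℚ n ⊗ (survival n u ⊝ survival (suc n) u)
              ≈⟨ cong (λ q → ((g u ⊝ q) ⊝ ℕ→ℚ n ⊗ survival n u) ⊕ ℕ→ℚ n ⊗ (survival n u ⊝ survival (suc n) u))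
                   (sym (remainder-step n u)) ⟩
            ((g u ⊝ remainder n u) ⊝ ℕ→ℚ n ⊗ survival n u)
              ⊕ ℕ→ℚ n ⊗ (survival n u ⊝ survival (suc n) u) ∎)
          (0≤-+ (≤⇒0≤ (n·survival≤telescope n u))
            (0≤-* (0≤ℕ→ℚ n) (≤⇒0≤ (survival-decreasing n u))))

        n·survival≤R : ∀ n u → ℕ→ℚ n ⊗ survival n u ℚ.≤ R
        n·survival≤R n u = ℚ.≤-trans (n·survival≤telescope n u) (0≤⇒≤ _
          (solve 4 (λ B g r s → (B :+ B) :- (g :- r) :=
             (B :- g) :+ ((r :- (:- B) :* s) :+ B :* (con 1ℚ :- s))) refl B (g u) (remainder n u) (survival n u))
          (0≤-+ (≤⇒0≤ (ℚ.≤-trans (p≤∣p∣ (g u)) (∣g∣≤B u)))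
            (0≤-+ (≤⇒0≤ (remainder-lower n u)) (0≤-* 0≤B (≤⇒0≤ (survival≤1 n u))))))

        -- The Markov property at time `m`: the bound `n·survival≤R` holds from every starting
        -- vertex, and the monotone operator `killed` carries it through `m` steps.
        n·survival[m+n]≤ : ∀ n m u → ℕ→ℚ n ⊗ survival (m ℕ.+ n) u ℚ.≤ R ⊗ survival m u
        n·survival[m+n]≤ n zero u = ℚ.≤-trans (n·survival≤R n u)
          (ℚ.≤-reflexive (≡.sym (ℚ.*-identityʳ R)))
        n·survival[m+n]≤ n (suc m) u = ℚ.≤-trans
          (ℚ.≤-reflexive (≡.sym (killed-⊗ (ℕ→ℚ n) (survival (m ℕ.+ n)) u)))
          (ℚ.≤-trans (killed-mono (n·survival[m+n]≤ n m) u)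
            (ℚ.≤-reflexive (killed-⊗ R (survival m) u)))

        -- Cut `n` into its halves p ≤ q and spend one factor `n` on each. The 6 is 3 · 2, from n ≤
        -- 3p and n ≤ 2q; the first is sharp at n = 3.
        n²·survival≤ : ∀ n u → 2 ℕ.≤ n → ℕ→ℚ n ⊗ (ℕ→ℚ n ⊗ survival n u) ℚ.≤ ℕ→ℚ 6 ⊗ (R ⊗ R)
        n²·survival≤ n u 2≤n = ℚ.≤-trans
          (ℚ.≤-reflexive (trans (sym (*-assoc (ℕ→ℚ n) (ℕ→ℚ n) (survival n u)))
            (cong (_⊗ survival n u) (sym (ℕ→ℚ-* n n)))))
          (ℚ.≤-trans (ℚ.*-monoʳ-≤-nonNeg (survival n u) {{ℚ.nonNegative (0≤survival n u)}}
            (ℕ→ℚ-mono n²≤6pq))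
          (ℚ.≤-trans (ℚ.≤-reflexive (trans (cong₂ _⊗_
              (trans (ℕ→ℚ-* 6 (p ℕ.* q)) (cong (ℕ→ℚ 6 ⊗_) (ℕ→ℚ-* p q)))
              (cong (λ m → survival m u) (≡.sym p+q≡n)))
            (solve 4 (λ c p q s → (c :* (p :* q)) :* s := (c :* p) :* (q :* s)) refl
              (ℕ→ℚ 6) (ℕ→ℚ p) (ℕ→ℚ q) (survival (p ℕ.+ q) u))))
          (ℚ.≤-trans (ℚ.*-monoˡ-≤-nonNeg (ℕ→ℚ 6 ⊗ ℕ→ℚ p)
              {{ℚ.nonNegative (0≤-* (0≤ℕ→ℚ 6) (0≤ℕ→ℚ p))}} (n·survival[m+n]≤ q p u))
          (ℚ.≤-trans (ℚ.≤-reflexive (solve 4 (λ c p R s → (c :* p) :* (R :* s) := (c :* R) :* (p :* s)) refl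
              (ℕ→ℚ 6) (ℕ→ℚ p) R (survival p u)))
          (ℚ.≤-trans (ℚ.*-monoˡ-≤-nonNeg (ℕ→ℚ 6 ⊗ R)
              {{ℚ.nonNegative (0≤-* (0≤ℕ→ℚ 6) 0≤R)}} (n·survival≤R p u))
            (ℚ.≤-reflexive (*-assoc (ℕ→ℚ 6) R R)))))))
          where
          p q : ℕ
          p = ℕ.⌊ n /2⌋
          q = ℕ.⌈ n /2⌉
          p+q≡n : p ℕ.+ q ≡ n
          p+q≡n = ℕ.⌊n/2⌋+⌈n/2⌉≡n n
          1≤p : 1 ℕ.≤ p
          1≤p = ℕ.⌊n/2⌋-mono 2≤n
          q≤1+p : q ℕ.≤ suc p
          q≤1+p = ℕ.⌊n/2⌋-mono (ℕ.n≤1+n (suc n))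
          n≤3p : n ℕ.≤ 3 ℕ.* p
          n≤3p = ℕ.≤-trans (ℕ.≤-reflexive (≡.sym p+q≡n)) (ℕ.+-monoʳ-≤ p (ℕ.≤-trans q≤1+p
            (ℕ.≤-trans (ℕ.+-monoˡ-≤ p 1≤p) (ℕ.≤-reflexive (cong (p ℕ.+_) (≡.sym (ℕ.+-identityʳ p)))))))
          n≤2q : n ℕ.≤ 2 ℕ.* q
          n≤2q = ℕ.≤-trans (ℕ.≤-reflexive (≡.sym p+q≡n)) (ℕ.≤-trans (ℕ.+-monoˡ-≤ q (ℕ.⌊n/2⌋≤⌈n/2⌉ n))
            (ℕ.≤-reflexive (cong (q ℕ.+_) (≡.sym (ℕ.+-identityʳ q)))))
          n²≤6pq : n ℕ.* n ℕ.≤ 6 ℕ.* (p ℕ.* q)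
          n²≤6pq = ℕ.≤-trans (ℕ.*-mono-≤ n≤3p n≤2q) (ℕ.≤-reflexive (ℕ.[m*n]*[o*p]≡[m*o]*[n*p] 3 p 2 q))

        hittingTime : ∀ u → IsHittingTime Y u v (fromℚ (g u))
        hittingTime u = record
          { almost-sure = null-if-O[1/n] R λ n _ → ℚ.≤-trans
              (ℚ.≤-reflexive (cong (ℕ→ℚ n ⊗_) (trans (cong ℚ.∣_∣ (trans
                (cong (_⊝ 1ℚ) (partialSum-ℙ u n))
                (solve 1 (λ s → (con 1ℚ :- s) :- con 1ℚ := :- s) refl (survival n u))))
                (trans (ℚ.∣-p∣≡∣p∣ (survival n u)) (ℚ.0≤p⇒∣p∣≡p (0≤survival n u))))))
              (n·survival≤R n u)
          ; mean = null-if-O[1/n] (B ⊗ R ⊕ ℕ→ℚ 6 ⊗ (R ⊗ R)) λ n 2≤n → ℚ.≤-trans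
              (ℚ.*-monoˡ-≤-nonNeg (ℕ→ℚ n) {{ℚ.nonNegative (0≤ℕ→ℚ n)}} (ℚ.≤-trans
                (ℚ.≤-reflexive (trans (cong ℚ.∣_∣ (trans
                    (cong (_⊝ g u) (partialSum-mean u n))
                    (solve 2 (λ g e → (g :- e) :- g := :- e) refl (g u)
                      (remainder n u ⊕ ℕ→ℚ n ⊗ survival n u))))
                  (ℚ.∣-p∣≡∣p∣ (remainder n u ⊕ ℕ→ℚ n ⊗ survival n u))))
                (ℚ.≤-trans (ℚ.∣p+q∣≤∣p∣+∣q∣ (remainder n u) (ℕ→ℚ n ⊗ survival n u))
                  (ℚ.+-mono-≤ (∣remainder∣≤ n u)
                    (ℚ.≤-reflexive (ℚ.0≤p⇒∣p∣≡p (0≤-* (0≤ℕ→ℚ n) (0≤survival n u))))))))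
              (ℚ.≤-trans (ℚ.≤-reflexive (solve 3 (λ n B s →
                  n :* (B :* s :+ n :* s) := B :* (n :* s) :+ n :* (n :* s)) refl (ℕ→ℚ n) B (survival n u)))
                (ℚ.+-mono-≤ (ℚ.*-monoˡ-≤-nonNeg B {{ℚ.nonNegative 0≤B}} (n·survival≤R n u))
                  (n²·survival≤ n u 2≤n)))
          }

  -- Multiplying g = 1 + Pg by the common degree turns it into an equation for the graph Laplacian,
  -- free of division and ready for spectral decomposition.
  hittingTime-regular : ∀ d → d ≢ 0ℚ → (∀ u → degree u ≡ d) → ∀ v (g : Vertex Y → ℚ) →
    g v ≡ 0ℚ → (∀ u → u ≢ v → d ⊗ g u ⊝ neighbourSum g u ≡ d) →
    ∀ u → IsHittingTime Y u v (fromℚ (g u))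
  hittingTime-regular d d≢0 degree≡d v g g-target g-Laplacian =
    hittingTime v degree≢0 g harmonic
    where
    degree≢0 : ∀ u → degree u ≢ 0ℚ
    degree≢0 u = subst (_≢ 0ℚ) (≡.sym (degree≡d u)) d≢0
    harmonic : ∀ u → g u ≡ survival v 1 u ⊕ killed v g u
    harmonic u with u ≟ᵛ v
    ... | yes refl = trans g-target (sym (cong₂ _⊕_ (killed-at v (λ _ → 1ℚ)) (killed-at v g)))
    ... | no  u≢v  = sym (begin
      killed v (λ _ → 1ℚ) u ⊕ killed v g u
        ≈⟨ cong₂ _⊕_ (killed-away v (λ _ → 1ℚ) u≢v) (killed-away v g u≢v) ⟩
      average (λ _ → 1ℚ) u ⊕ average g u
        ≈⟨ cong₂ _⊕_ (average-1 u (degree≢0 u)) (average-neighbourSum g u) ⟩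
      1ℚ ⊕ recip (degree u) ⊗ neighbourSum g u
        ≈⟨ cong (λ q → 1ℚ ⊕ recip q ⊗ neighbourSum g u) (degree≡d u) ⟩
      1ℚ ⊕ recip d ⊗ neighbourSum g u
        ≈⟨ solve 4 (λ r d g s → con 1ℚ :+ r :* s := con 1ℚ :+ ((d :* r) :* g :- r :* (d :* g :- s)))
             refl (recip d) d (g u) (neighbourSum g u) ⟩
      1ℚ ⊕ ((d ⊗ recip d) ⊗ g u ⊝ recip d ⊗ (d ⊗ g u ⊝ neighbourSum g u))
        ≈⟨ cong₂ (λ p q → 1ℚ ⊕ (p ⊗ g u ⊝ recip d ⊗ q)) (recip-inverse d≢0) (g-Laplacian u u≢v) ⟩
      1ℚ ⊕ (1ℚ ⊗ g u ⊝ recip d ⊗ d)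
        ≈⟨ cong (λ q → 1ℚ ⊕ (1ℚ ⊗ g u ⊝ q)) (trans (*-comm (recip d) d) (recip-inverse d≢0)) ⟩
      1ℚ ⊕ (1ℚ ⊗ g u ⊝ 1ℚ)
        ≈⟨ solve 1 (λ g → con 1ℚ :+ (con 1ℚ :* g :- con 1ℚ) := g) refl (g u) ⟩
      g u ∎)

-- The cyclic group Fin N, with N ∸ 1 in the role of -1.
module Cyclic (N : ℕ) .{{_ : NonZero N}} where

  M : ℕ
  M = N ℕ.∸ 1

  1+M≡N : suc M ≡ N
  1+M≡N = ℕ.m+[n∸m]≡n (ℕ.>-nonZero⁻¹ N)

  infixl 6 _⊞_

  _⊞_ : Fin N → ℕ → Fin N
  x ⊞ a = (toℕ x ℕ.+ a) mod N

  toℕ-mod : ∀ a → toℕ (a mod N) ≡ a ℕ.% N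
  toℕ-mod a = Fin.toℕ-fromℕ< (ℕ.m%n<n a N)

  toℕ-⊞ : ∀ x a → toℕ (x ⊞ a) ≡ (toℕ x ℕ.+ a) ℕ.% N
  toℕ-⊞ x a = toℕ-mod (toℕ x ℕ.+ a)

  mod-cong : ∀ {a b} → a ℕ.% N ≡ b ℕ.% N → a mod N ≡ b mod N
  mod-cong {a} {b} eq = Fin.toℕ-injective (≡.trans (toℕ-mod a) (≡.trans eq (≡.sym (toℕ-mod b))))

  mod-toℕ : ∀ x → toℕ x mod N ≡ x
  mod-toℕ x = Fin.toℕ-injective (≡.trans (toℕ-mod (toℕ x)) (ℕ.m<n⇒m%n≡m (Fin.toℕ<n x)))

  %-+ : ∀ a b → (a ℕ.% N ℕ.+ b) ℕ.% N ≡ (a ℕ.+ b) ℕ.% N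
  %-+ a b = ≡.trans (ℕ.%-distribˡ-+ (a ℕ.% N) b N)
    (≡.trans (cong (λ c → (c ℕ.+ b ℕ.% N) ℕ.% N) (ℕ.m%n%n≡m%n a N)) (≡.sym (ℕ.%-distribˡ-+ a b N)))

  ⊞-⊞ : ∀ x a b → x ⊞ a ⊞ b ≡ x ⊞ (a ℕ.+ b)
  ⊞-⊞ x a b = mod-cong (≡.trans (cong (λ c → (c ℕ.+ b) ℕ.% N) (toℕ-⊞ x a))
    (≡.trans (%-+ (toℕ x ℕ.+ a) b) (cong (ℕ._% N) (ℕ.+-assoc (toℕ x) a b))))

  ⊞-+*N : ∀ x a c → x ⊞ (a ℕ.+ c ℕ.* N) ≡ x ⊞ a
  ⊞-+*N x a c = mod-cong (≡.trans (cong (ℕ._% N) (≡.sym (ℕ.+-assoc (toℕ x) a (c ℕ.* N))))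
    (ℕ.[m+kn]%n≡m%n (toℕ x ℕ.+ a) c N))

  ⊞-period : ∀ x {a b} c d → a ℕ.+ c ℕ.* N ≡ b ℕ.+ d ℕ.* N → x ⊞ a ≡ x ⊞ b
  ⊞-period x {a} {b} c d eq = ≡.trans (≡.sym (⊞-+*N x a c)) (≡.trans (cong (x ⊞_) eq) (⊞-+*N x b d))

  open ℕ.+-*-Solver using () renaming (solve to solveℕ; _:+_ to _⟨+⟩_; _:*_ to _⟨*⟩_; _:=_ to _⟨=⟩_; con to conℕ)

  -- 1 - (s + 1) = -s; with `step-forth-back`, these are the cancellations in the product (X +
  -- X⁻¹)(X^(s+1) + X^(-s-1)) of shifts.
  step-back-forth : ∀ x s → x ⊞ (1 ℕ.+ suc s ℕ.* M) ≡ x ⊞ (s ℕ.* M)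
  step-back-forth x s = ⊞-period x 0 1 (≡.trans
    (solveℕ 2 (λ s m → (conℕ 1 ⟨+⟩ (conℕ 1 ⟨+⟩ s) ⟨*⟩ m) ⟨+⟩ conℕ 0 ⟨=⟩
      s ⟨*⟩ m ⟨+⟩ (conℕ 1 ⟨+⟩ m)) refl s M)
    (cong (λ n → s ℕ.* M ℕ.+ n) (≡.trans 1+M≡N (≡.sym (ℕ.*-identityˡ N)))))

  step-forth-back : ∀ x s → x ⊞ (M ℕ.+ suc s) ≡ x ⊞ s
  step-forth-back x s = ⊞-period x 0 1 (≡.trans
    (solveℕ 2 (λ s m → (m ⟨+⟩ (conℕ 1 ⟨+⟩ s)) ⟨+⟩ conℕ 0 ⟨=⟩ s ⟨+⟩ (conℕ 1 ⟨+⟩ m)) refl s M)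
    (cong (λ n → s ℕ.+ n) (≡.trans 1+M≡N (≡.sym (ℕ.*-identityˡ N)))))

  reflect : Fin N → Fin N → Fin N
  reflect v x = v ⊞ (toℕ x ℕ.* M)

  reflect-⊞ : ∀ v x a → reflect v (x ⊞ a) ≡ reflect v x ⊞ (a ℕ.* M)
  reflect-⊞ v x a = ≡.trans (⊞-period v (q ℕ.* M) 0 (begin
      toℕ (x ⊞ a) ℕ.* M ℕ.+ q ℕ.* M ℕ.* N
        ≡⟨ solveℕ 4 (λ r q m n → r ⟨*⟩ m ⟨+⟩ q ⟨*⟩ m ⟨*⟩ n ⟨=⟩ (r ⟨+⟩ q ⟨*⟩ n) ⟨*⟩ m)
             refl (toℕ (x ⊞ a)) q M N ⟩
      (toℕ (x ⊞ a) ℕ.+ q ℕ.* N) ℕ.* M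
        ≡⟨ cong (λ r → (r ℕ.+ q ℕ.* N) ℕ.* M) (toℕ-⊞ x a) ⟩
      ((toℕ x ℕ.+ a) ℕ.% N ℕ.+ q ℕ.* N) ℕ.* M
        ≡⟨ cong (ℕ._* M) (ℕ.m≡m%n+[m/n]*n (toℕ x ℕ.+ a) N) ⟨
      (toℕ x ℕ.+ a) ℕ.* M
        ≡⟨ solveℕ 3 (λ x a m → (x ⟨+⟩ a) ⟨*⟩ m ⟨=⟩ x ⟨*⟩ m ⟨+⟩ a ⟨*⟩ m ⟨+⟩ conℕ 0) refl (toℕ x) a M ⟩
      toℕ x ℕ.* M ℕ.+ a ℕ.* M ℕ.+ 0 ∎))
    (≡.sym (⊞-⊞ v (toℕ x ℕ.* M) (a ℕ.* M)))
    where
    open ≡.≡-Reasoning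
    q : ℕ
    q = (toℕ x ℕ.+ a) ℕ./ N

  ⊞-M² : ∀ x a → x ⊞ (a ℕ.* M ℕ.* M) ≡ x ⊞ a
  ⊞-M² x a = ⊞-period x a (a ℕ.* M) (≡.trans (cong (λ n → a ℕ.* M ℕ.* M ℕ.+ a ℕ.* n) (≡.sym 1+M≡N))
    (≡.trans (solveℕ 2 (λ a m → a ⟨*⟩ m ⟨*⟩ m ⟨+⟩ a ⟨*⟩ (conℕ 1 ⟨+⟩ m) ⟨=⟩ a ⟨+⟩ a ⟨*⟩ m ⟨*⟩ (conℕ 1 ⟨+⟩ m)) refl a M)
      (cong (λ n → a ℕ.+ a ℕ.* M ℕ.* n) 1+M≡N)))

  0ᶠ : Fin N
  0ᶠ = 0 mod N

  toℕ-0ᶠ : toℕ 0ᶠ ≡ 0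
  toℕ-0ᶠ = ≡.trans (toℕ-mod 0) (ℕ.m*n%n≡0 0 N)

  ⊞-0 : ∀ x → x ⊞ 0 ≡ x
  ⊞-0 x = ≡.trans (cong (_mod N) (ℕ.+-identityʳ (toℕ x))) (mod-toℕ x)

  reflect-0 : ∀ v → reflect v 0ᶠ ≡ v
  reflect-0 v = ≡.trans (cong (λ n → v ⊞ (n ℕ.* M)) toℕ-0ᶠ) (⊞-0 v)

  reflect-self : ∀ v → reflect v v ≡ 0ᶠ
  reflect-self v = ≡.trans
    (cong (_mod N) (≡.trans (≡.sym (ℕ.*-suc (toℕ v) M)) (cong (toℕ v ℕ.*_) 1+M≡N)))
    (mod-cong (≡.trans (ℕ.m*n%n≡0 (toℕ v) N) (≡.sym (ℕ.m*n%n≡0 0 N))))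

  reflect-reflect : ∀ v x → reflect v (reflect v x) ≡ x
  reflect-reflect v x = ≡.trans (reflect-⊞ v v (toℕ x ℕ.* M))
    (≡.trans (cong (_⊞ (toℕ x ℕ.* M ℕ.* M)) (reflect-self v))
    (≡.trans (⊞-M² 0ᶠ (toℕ x)) (≡.trans (cong (λ n → (n ℕ.+ toℕ x) mod N) toℕ-0ᶠ) (mod-toℕ x))))

  open ℤ.+-*-Solver using () renaming (solve to solveℤ; _:+_ to _[+]_; _:*_ to _[*]_; _:-_ to _[-]_; :-_ to [-]_; _:=_ to _[=]_)

  ∣⇒⊞ : ∀ x y a → ℤ.+ N ℤ.∣ (ℤ.+ toℕ x ℤ.- ℤ.+ toℕ y) ℤ.- (ℤ.- (ℤ.+ a)) → x ⊞ a ≡ y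
  ∣⇒⊞ x y a (ℤ.divides (ℤ.+ q) eq) = Fin.toℕ-injective (≡.trans (toℕ-⊞ x a) (≡.trans
    (cong (ℕ._% N) (ℤ.+-injective (≡.trans
      (solveℤ 3 (λ x y a → x [+] a [=] y [+] ((x [-] y) [-] ([-] a))) refl (ℤ.+ toℕ x) (ℤ.+ toℕ y) (ℤ.+ a))
      (≡.trans (cong (λ z → ℤ.+ toℕ y ℤ.+ z) (≡.trans eq (≡.sym (ℤ.pos-* q N)))) refl))))
    (≡.trans (ℕ.[m+kn]%n≡m%n (toℕ y) q N) (ℕ.m<n⇒m%n≡m (Fin.toℕ<n y)))))
  -- A negative quotient would give `toℕ y = toℕ x + a + (q + 1) N`, which is too large for a
  -- representative.
  ∣⇒⊞ x y a (ℤ.divides (ℤ.-[1+ q ]) eq) = contradiction (Fin.toℕ<n y) (ℕ.≤⇒≯ (ℕ.≤-trans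
    (ℕ.m≤n+m N (toℕ x ℕ.+ a ℕ.+ q ℕ.* N)) (ℕ.≤-reflexive (≡.sym (≡.trans
      (ℤ.+-injective (≡.trans
        (solveℤ 3 (λ x y a → y [=] (x [+] a) [-] ((x [-] y) [-] ([-] a))) refl (ℤ.+ toℕ x) (ℤ.+ toℕ y) (ℤ.+ a))
        (≡.trans (cong (λ d → (ℤ.+ toℕ x ℤ.+ ℤ.+ a) ℤ.- d) eq)
        (≡.trans (solveℤ 4 (λ x a q n → (x [+] a) [-] (([-] q) [*] n) [=] (x [+] a) [+] q [*] n)
            refl (ℤ.+ toℕ x) (ℤ.+ a) (ℤ.+ suc q) (ℤ.+ N))
          (cong (λ z → ℤ.+ toℕ x ℤ.+ ℤ.+ a ℤ.+ z) (≡.sym (ℤ.pos-* (suc q) N)))))))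
      (solveℕ 4 (λ x a q n → x ⟨+⟩ a ⟨+⟩ (n ⟨+⟩ q ⟨*⟩ n) ⟨=⟩ x ⟨+⟩ a ⟨+⟩ q ⟨*⟩ n ⟨+⟩ n)
        refl (toℕ x) a q N))))))

  ⊞⇒∣ : ∀ x y a → x ⊞ a ≡ y → ℤ.+ N ℤ.∣ (ℤ.+ toℕ x ℤ.- ℤ.+ toℕ y) ℤ.- (ℤ.- (ℤ.+ a))
  ⊞⇒∣ x y a refl = ℤ.divides (ℤ.+ q) (≡.trans
    (solveℤ 3 (λ x y a → (x [-] y) [-] ([-] a) [=] (x [+] a) [-] y) refl (ℤ.+ toℕ x) (ℤ.+ toℕ y) (ℤ.+ a))
    (≡.trans (cong (λ n → n ℤ.- ℤ.+ toℕ y) (≡.trans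
        (cong ℤ.+_ (≡.trans (ℕ.m≡m%n+[m/n]*n (toℕ x ℕ.+ a) N) (cong (ℕ._+ q ℕ.* N) (≡.sym (toℕ-⊞ x a)))))
        (cong (λ z → ℤ.+ toℕ y ℤ.+ z) (ℤ.pos-* q N))))
      (solveℤ 2 (λ y m → (y [+] m) [-] y [=] m) refl (ℤ.+ toℕ y) (ℤ.+ q ℤ.* ℤ.+ N))))
    where
    q : ℕ
    q = (toℕ x ℕ.+ a) ℕ./ N

  N∣s-[-sM] : ∀ s → ℤ.+ N ℤ.∣ ℤ.+ s ℤ.+ ℤ.+ (s ℕ.* M)
  N∣s-[-sM] s = ℤ.divides (ℤ.+ s) (≡.trans
    (cong ℤ.+_ (≡.trans (≡.sym (ℕ.*-suc s M)) (cong (s ℕ.*_) 1+M≡N))) (ℤ.pos-* s N))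

  ∣⇒⊞-M : ∀ x y s → ℤ.+ N ℤ.∣ (ℤ.+ toℕ x ℤ.- ℤ.+ toℕ y) ℤ.- ℤ.+ s → x ⊞ (s ℕ.* M) ≡ y
  ∣⇒⊞-M x y s d = ∣⇒⊞ x y (s ℕ.* M) (subst (ℤ.+ N ℤ.∣_)
    (solveℤ 3 (λ e s t → (e [-] s) [+] (s [+] t) [=] e [-] ([-] t)) refl
      (ℤ.+ toℕ x ℤ.- ℤ.+ toℕ y) (ℤ.+ s) (ℤ.+ (s ℕ.* M)))
    (ℤ.∣m∣n⇒∣m+n d (N∣s-[-sM] s)))

  ⊞-M⇒∣ : ∀ x y s → x ⊞ (s ℕ.* M) ≡ y → ℤ.+ N ℤ.∣ (ℤ.+ toℕ x ℤ.- ℤ.+ toℕ y) ℤ.- ℤ.+ s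
  ⊞-M⇒∣ x y s eq = subst (ℤ.+ N ℤ.∣_)
    (solveℤ 3 (λ e s t → (e [-] ([-] t)) [-] (s [+] t) [=] e [-] s) refl
      (ℤ.+ toℕ x ℤ.- ℤ.+ toℕ y) (ℤ.+ s) (ℤ.+ (s ℕ.* M)))
    (ℤ.∣m∣n⇒∣m-n (⊞⇒∣ x y (s ℕ.* M) eq) (N∣s-[-sM] s))

  no-multiple : ∀ {i} t → i ≡ ℤ.+ suc t → suc t ℕ.< N → ¬ (ℤ.+ N ℤ.∣ i)
  no-multiple t refl t<N N∣t = ℕ.<⇒≱ t<N (ℕ.∣⇒≤ (ℤ.∣⇒∣ᵤ N∣t))

-- Shift operators and Laplacians on the cycle

module CycleOperators (R : CommutativeRing 0ℓ 0ℓ) (scalars : ScalarMap R) (N : ℕ) .{{_ : NonZero N}} where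

  open Algebraic R scalars
  open Cyclic N
  open ℤ.+-*-Solver using () renaming (solve to solveℤ; _:+_ to _[+]_; _:-_ to _[-]_; :-_ to [-]_; _:=_ to _[=]_)

  τ : ℕ → (Fin N → K) → Fin N → K
  τ s f x = f (x ⊞ s) ⊕ f (x ⊞ (s ℕ.* M))

  Στ : ℕ → (Fin N → K) → Fin N → K
  Στ zero    f x = 0#
  Στ (suc k) f x = Στ k f x ⊕ τ (suc k) f x

  Στ-cong : ∀ k {f g : Fin N → K} → (∀ x → f x ≈ g x) → ∀ x → Στ k f x ≈ Στ k g x
  Στ-cong zero    eq x = ≈-refl
  Στ-cong (suc k) eq x = +-cong (Στ-cong k eq x) (+-cong (eq _) (eq _))

  Στ-linear : ∀ k a b (f g : Fin N → K) x →
    Στ k (λ x → a ⊗ f x ⊕ b ⊗ g x) x ≈ a ⊗ Στ k f x ⊕ b ⊗ Στ k g x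
  Στ-linear zero    a b f g x = sym (trans (+-cong (zeroʳ a) (zeroʳ b)) (+-identityʳ 0#))
  Στ-linear (suc k) a b f g x = trans (+-congʳ (Στ-linear k a b f g x))
    (solve 8 (λ a b p q r s t u →
      (a :* p :+ b :* q) :+ ((a :* r :+ b :* s) :+ (a :* t :+ b :* u)) :=
      a :* (p :+ (r :+ t)) :+ b :* (q :+ (s :+ u))) ≈-refl a b (Στ k f x) (Στ k g x)
      (f (x ⊞ suc k)) (g (x ⊞ suc k)) (f (x ⊞ (suc k ℕ.* M))) (g (x ⊞ (suc k ℕ.* M))))

  Στ-const : ∀ k c x → Στ k (λ _ → c) x ≈ ι (ℕ→ℚ (2 ℕ.* k)) ⊗ c
  Στ-const zero    c x = sym (trans (*-congʳ 0-homo) (zeroˡ c))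
  Στ-const (suc k) c x = begin
    Στ k (λ _ → c) x ⊕ (c ⊕ c)         ≈⟨ +-congʳ (Στ-const k c x) ⟩
    ι (ℕ→ℚ (2 ℕ.* k)) ⊗ c ⊕ (c ⊕ c)    ≈⟨ solve 2 (λ n c → n :* c :+ (c :+ c) := (n :+ num 2) :* c)
                                            ≈-refl (ι (ℕ→ℚ (2 ℕ.* k))) c ⟩
    (ι (ℕ→ℚ (2 ℕ.* k)) ⊕ ι (ℕ→ℚ 2)) ⊗ c  ≈⟨ *-congʳ (+-homo (ℕ→ℚ (2 ℕ.* k)) (ℕ→ℚ 2)) ⟨
    ι (ℕ→ℚ (2 ℕ.* k) ℚ.+ ℕ→ℚ 2) ⊗ c    ≈⟨ *-congʳ (reflexive (cong ι (≡.sym (ℕ→ℚ-+ (2 ℕ.* k) 2)))) ⟩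
    ι (ℕ→ℚ (2 ℕ.* k ℕ.+ 2)) ⊗ c        ≈⟨ *-congʳ (reflexive (cong (ι ∘ ℕ→ℚ)
                                            (≡.trans (ℕ.+-comm (2 ℕ.* k) 2) (≡.sym (ℕ.*-suc 2 k))))) ⟩
    ι (ℕ→ℚ (2 ℕ.* suc k)) ⊗ c ∎

  indicator-⊎₃ : {A B C D : Set} (a : Dec A) (b : Dec B) (c : Dec C) (d : Dec D) →
    (D → A ⊎ B ⊎ C) → (A → D) → (B → D) → (C → D) →
    (A → ¬ B) → (A → ¬ C) → (B → ¬ C) → ∀ z →
    indicator d z ≈ indicator a z ⊕ (indicator b z ⊕ indicator c z)
  indicator-⊎₃ (yes a) (yes b) c d f g h i j k l z = contradiction b (j a)
  indicator-⊎₃ (yes a) b (yes c) d f g h i j k l z = contradiction c (k a)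
  indicator-⊎₃ a (yes b) (yes c) d f g h i j k l z = contradiction c (l b)
  indicator-⊎₃ (yes a) b c (no ¬d) f g h i j k l z = contradiction (g a) ¬d
  indicator-⊎₃ a (yes b) c (no ¬d) f g h i j k l z = contradiction (h b) ¬d
  indicator-⊎₃ a b (yes c) (no ¬d) f g h i j k l z = contradiction (i c) ¬d
  indicator-⊎₃ (no ¬a) (no ¬b) (no ¬c) (yes d) f g h i j k l z with f d
  ... | inj₁ a        = contradiction a ¬a
  ... | inj₂ (inj₁ b) = contradiction b ¬b
  ... | inj₂ (inj₂ c) = contradiction c ¬c
  indicator-⊎₃ (yes a) (no b) (no c) (yes d) f g h i j k l z =
    sym (trans (+-congˡ (+-identityʳ 0#)) (+-identityʳ z))
  indicator-⊎₃ (no a) (yes b) (no c) (yes d) f g h i j k l z =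
    sym (trans (+-identityˡ _) (+-identityʳ z))
  indicator-⊎₃ (no a) (no b) (yes c) (yes d) f g h i j k l z =
    sym (trans (+-identityˡ _) (+-identityˡ z))
  indicator-⊎₃ (no a) (no b) (no c) (no d) f g h i j k l z =
    sym (trans (+-identityˡ _) (+-identityʳ 0#))

  module Neighbours (k : ℕ) (2k<N : 2 ℕ.* k ℕ.+ 1 ℕ.≤ N) where

    open Graph (cyclePower N k 2k<N) using (_~?_; ~-sym) public

    adjacencySum : (Fin N → K) → Fin N → K
    adjacencySum f x = sum λ y → indicator (x ~? y) (f y)

  open Neighbours

  -- The bound on `N` guarantees that no neighbour is counted twice. If x ± (k+1) met x ± s or its
  -- own mirror image, `N` would divide a sum of at most 2k + 2 or a positive difference of at most
  -- k + 1, both below `N`.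
  adjacencySum-Στ : ∀ k 2k<N f x → adjacencySum k 2k<N f x ≈ Στ k f x
  adjacencySum-Στ zero 2k<N f x = sum-zero {N} λ y → no-neighbour y (_~?_ zero 2k<N x y)
    where
    no-neighbour : ∀ y (d : Dec (CycleAdj N 0 x y)) → indicator d (f y) ≈ 0#
    no-neighbour y (yes (s , 1≤s , s≤0 , _)) = contradiction (ℕ.≤-trans 1≤s s≤0) λ ()
    no-neighbour y (no _) = ≈-refl
  adjacencySum-Στ (suc k) 2k<N f x = begin
    adjacencySum (suc k) 2k<N f x
      ≈⟨ sum-cong {N} split ⟩
    sum (λ y → indicator (_~?_ k 2k<N′ x y) (f y)
      ⊕ (indicator (x ⊞ suc k Fin.≟ y) (f y) ⊕ indicator (x ⊞ (suc k ℕ.* M) Fin.≟ y) (f y)))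
      ≈⟨ trans (sum-⊕ {N} _ _) (+-cong (adjacencySum-Στ k 2k<N′ f x)
           (trans (sum-⊕ {N} _ _) (+-cong (sum-indicator {N} _ f) (sum-indicator {N} _ f)))) ⟩
    Στ (suc k) f x ∎
    where
    2k+3≤N : suc (suc (suc (k ℕ.+ k))) ℕ.≤ N
    2k+3≤N = ℕ.≤-trans (ℕ.≤-reflexive (solveℕ 1 (λ k → conℕ 3 ⟨+⟩ (k ⟨+⟩ k) ⟨=⟩
      (conℕ 1 ⟨+⟩ k) ⟨+⟩ ((conℕ 1 ⟨+⟩ k) ⟨+⟩ conℕ 0) ⟨+⟩ conℕ 1) refl k)) 2k<N
      where open ℕ.+-*-Solver using () renaming (solve to solveℕ; _:+_ to _⟨+⟩_; _:=_ to _⟨=⟩_; con to conℕ)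
    2k<N′ : 2 ℕ.* k ℕ.+ 1 ℕ.≤ N
    2k<N′ = ℕ.≤-trans (ℕ.+-monoˡ-≤ 1 (ℕ.*-monoʳ-≤ 2 (ℕ.n≤1+n k))) 2k<N

    e : Fin N → ℤ.ℤ
    e y = ℤ.+ toℕ x ℤ.- ℤ.+ toℕ y

    sum-not-divisible : ∀ {i} s → s ℕ.≤ suc k → i ≡ ℤ.+ suc k ℤ.+ ℤ.+ s → ¬ (ℤ.+ N ℤ.∣ i)
    sum-not-divisible s s≤k eq = no-multiple (k ℕ.+ s) eq
      (ℕ.≤-trans (ℕ.s≤s (ℕ.s≤s (ℕ.≤-trans (ℕ.+-monoʳ-≤ k s≤k) (ℕ.≤-reflexive (ℕ.+-suc k k))))) 2k+3≤N)

    difference-not-divisible : ∀ {i} s → s ℕ.≤ k → i ≡ ℤ.+ suc k ℤ.- ℤ.+ s → ¬ (ℤ.+ N ℤ.∣ i)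
    difference-not-divisible s s≤k eq = no-multiple (k ℕ.∸ s)
      (≡.trans eq (≡.trans (cong (λ m → ℤ.+ suc m ℤ.- ℤ.+ s) (≡.sym (ℕ.m∸n+n≡m s≤k)))
        (solveℤ 2 (λ d s → (d [+] s) [-] s [=] d) refl (ℤ.+ suc (k ℕ.∸ s)) (ℤ.+ s))))
      (ℕ.≤-trans (ℕ.s≤s (ℕ.s≤s (ℕ.m∸n≤m k s)))
        (ℕ.≤-trans (ℕ.s≤s (ℕ.s≤s (ℕ.≤-trans (ℕ.m≤m+n k k) (ℕ.n≤1+n _)))) 2k+3≤N))

    split : ∀ y → indicator (_~?_ (suc k) 2k<N x y) (f y) ≈ indicator (_~?_ k 2k<N′ x y) (f y)
      ⊕ (indicator (x ⊞ suc k Fin.≟ y) (f y) ⊕ indicator (x ⊞ (suc k ℕ.* M) Fin.≟ y) (f y))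
    split y = indicator-⊎₃ (_~?_ k 2k<N′ x y) (x ⊞ suc k Fin.≟ y) (x ⊞ (suc k ℕ.* M) Fin.≟ y)
      (_~?_ (suc k) 2k<N x y) from to-near to-right to-left near-right near-left right-left (f y)
      where
      from : CycleAdj N (suc k) x y → CycleAdj N k x y ⊎ x ⊞ suc k ≡ y ⊎ x ⊞ (suc k ℕ.* M) ≡ y
      from (s , 1≤s , s≤1+k , d) with ℕ.m≤n⇒m<n∨m≡n s≤1+k
      ... | inj₁ s<1+k = inj₁ (s , 1≤s , ℕ.s≤s⁻¹ s<1+k , d)
      ... | inj₂ refl with d
      ... | inj₁ d⁺ = inj₂ (inj₂ (∣⇒⊞-M x y s (ℤ.∣ᵤ⇒∣ d⁺)))
      ... | inj₂ d⁻ = inj₂ (inj₁ (∣⇒⊞ x y s (ℤ.∣ᵤ⇒∣ d⁻)))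
      to-near : CycleAdj N k x y → CycleAdj N (suc k) x y
      to-near (s , 1≤s , s≤k , d) = s , 1≤s , ℕ.m≤n⇒m≤1+n s≤k , d
      to-right : x ⊞ suc k ≡ y → CycleAdj N (suc k) x y
      to-right eq = suc k , ℕ.s≤s ℕ.z≤n , ℕ.≤-refl , inj₂ (ℤ.∣⇒∣ᵤ (⊞⇒∣ x y (suc k) eq))
      to-left : x ⊞ (suc k ℕ.* M) ≡ y → CycleAdj N (suc k) x y
      to-left eq = suc k , ℕ.s≤s ℕ.z≤n , ℕ.≤-refl , inj₁ (ℤ.∣⇒∣ᵤ (⊞-M⇒∣ x y (suc k) eq))
      near-right : CycleAdj N k x y → x ⊞ suc k ≢ y
      near-right (s , _ , s≤k , inj₁ d) eq = sum-not-divisible s (ℕ.m≤n⇒m≤1+n s≤k)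
        (solveℤ 3 (λ e k s → (e [-] ([-] k)) [-] (e [-] s) [=] k [+] s) refl (e y) (ℤ.+ suc k) (ℤ.+ s))
        (ℤ.∣m∣n⇒∣m-n (⊞⇒∣ x y (suc k) eq) (ℤ.∣ᵤ⇒∣ d))
      near-right (s , _ , s≤k , inj₂ d) eq = difference-not-divisible s s≤k
        (solveℤ 3 (λ e k s → (e [-] ([-] k)) [-] (e [-] ([-] s)) [=] k [-] s) refl (e y) (ℤ.+ suc k) (ℤ.+ s))
        (ℤ.∣m∣n⇒∣m-n (⊞⇒∣ x y (suc k) eq) (ℤ.∣ᵤ⇒∣ d))
      near-left : CycleAdj N k x y → x ⊞ (suc k ℕ.* M) ≢ y
      near-left (s , _ , s≤k , inj₁ d) eq = difference-not-divisible s s≤k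
        (solveℤ 3 (λ e k s → (e [-] s) [-] (e [-] k) [=] k [-] s) refl (e y) (ℤ.+ suc k) (ℤ.+ s))
        (ℤ.∣m∣n⇒∣m-n {m = e y ℤ.- ℤ.+ s} (ℤ.∣ᵤ⇒∣ d) (⊞-M⇒∣ x y (suc k) eq))
      near-left (s , _ , s≤k , inj₂ d) eq = sum-not-divisible s (ℕ.m≤n⇒m≤1+n s≤k)
        (solveℤ 3 (λ e k s → (e [-] ([-] s)) [-] (e [-] k) [=] k [+] s) refl (e y) (ℤ.+ suc k) (ℤ.+ s))
        (ℤ.∣m∣n⇒∣m-n {m = e y ℤ.- (ℤ.- (ℤ.+ s))} (ℤ.∣ᵤ⇒∣ d) (⊞-M⇒∣ x y (suc k) eq))
      right-left : x ⊞ suc k ≡ y → x ⊞ (suc k ℕ.* M) ≢ y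
      right-left eq eq′ = sum-not-divisible (suc k) ℕ.≤-refl
        (solveℤ 2 (λ e k → (e [-] ([-] k)) [-] (e [-] k) [=] k [+] k) refl (e y) (ℤ.+ suc k))
        (ℤ.∣m∣n⇒∣m-n (⊞⇒∣ x y (suc k) eq) (⊞-M⇒∣ x y (suc k) eq′))

  indicator-swap : {A B : Set} (d : Dec A) (e : Dec B) → (A → B) → (B → A) → ∀ a b →
    a ⊗ indicator d b ≈ b ⊗ indicator e a
  indicator-swap (yes _) (yes _) f g a b = *-comm a b
  indicator-swap (yes d) (no ¬e) f g a b = contradiction (f d) ¬e
  indicator-swap (no ¬d) (yes e) f g a b = contradiction (g e) ¬d
  indicator-swap (no _)  (no _)  f g a b = trans (zeroʳ a) (sym (zeroʳ b))

  adjacencySum-symmetric : ∀ k 2k<N (f g : Fin N → K) →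
    sum (λ x → f x ⊗ adjacencySum k 2k<N g x) ≈ sum (λ x → adjacencySum k 2k<N f x ⊗ g x)
  adjacencySum-symmetric k 2k<N f g = begin
    sum (λ x → f x ⊗ adjacencySum k 2k<N g x)
      ≈⟨ sum-cong {N} (λ x → sum-⊗ {N} (f x) _) ⟨
    sum (λ x → sum λ y → f x ⊗ indicator (_~?_ k 2k<N x y) (g y))
      ≈⟨ ∑-comm {N} {N} _ ⟩
    sum (λ y → sum λ x → f x ⊗ indicator (_~?_ k 2k<N x y) (g y))
      ≈⟨ sum-cong {N} (λ y → trans (sum-cong {N} (swap y)) (trans (sum-⊗ {N} (g y) _) (*-comm (g y) _))) ⟩
    sum (λ y → adjacencySum k 2k<N f y ⊗ g y) ∎
    where
    swap : ∀ y x → f x ⊗ indicator (_~?_ k 2k<N x y) (g y) ≈ g y ⊗ indicator (_~?_ k 2k<N y x) (f x)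
    swap y x = indicator-swap (_~?_ k 2k<N x y) (_~?_ k 2k<N y x)
      (~-sym k 2k<N {x} {y}) (~-sym k 2k<N {y} {x}) (f x) (g y)

  -- Self-adjointness is read off the symmetric adjacency relation by exchanging the sums, which
  -- avoids reindexing along shifts.
  Στ-symmetric : ∀ k → 2 ℕ.* k ℕ.+ 1 ℕ.≤ N → (f g : Fin N → K) →
    sum (λ x → f x ⊗ Στ k g x) ≈ sum (λ x → Στ k f x ⊗ g x)
  Στ-symmetric k 2k<N f g = begin
    sum (λ x → f x ⊗ Στ k g x)
      ≈⟨ sum-cong {N} (λ x → *-congˡ (adjacencySum-Στ k 2k<N g x)) ⟨
    sum (λ x → f x ⊗ adjacencySum k 2k<N g x)
      ≈⟨ adjacencySum-symmetric k 2k<N f g ⟩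
    sum (λ x → adjacencySum k 2k<N f x ⊗ g x)
      ≈⟨ sum-cong {N} (λ x → *-congʳ (adjacencySum-Στ k 2k<N f x)) ⟩
    sum (λ x → Στ k f x ⊗ g x) ∎

  Στ-reflect : ∀ k v (f : Fin N → K) x → Στ k (f ∘ reflect v) x ≈ Στ k f (reflect v x)
  Στ-reflect zero    v f x = ≈-refl
  Στ-reflect (suc k) v f x = +-cong (Στ-reflect k v f x) (trans
    (+-cong (reflexive (cong f (reflect-⊞ v x (suc k))))
      (reflexive (cong f (≡.trans (reflect-⊞ v x (suc k ℕ.* M)) (⊞-M² (reflect v x) (suc k))))))
    (+-comm _ _))

  δ : Fin N → Fin N → K
  δ y x = indicator (y Fin.≟ x) 1#

  sum-δ : ∀ y (f : Fin N → K) → sum (λ x → f x ⊗ δ y x) ≈ f y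
  sum-δ y f = trans (sum-cong {N} λ x → trans
      (sym (indicator-⊗ (y Fin.≟ x) (f x) 1#)) (indicator-cong (y Fin.≟ x) λ _ → *-identityʳ (f x)))
    (sum-indicator y f)

  -- The operator Λ + ν. Keeping `ν` rational lets one equation make sense in every ring and pass
  -- along `ι`.
  Lap : ℕ → ℚ → (Fin N → K) → Fin N → K
  Lap k ν f x = ι (ℕ→ℚ (2 ℕ.* k) ℚ.+ ν) ⊗ f x ⊝ Στ k f x

  Lap-cong : ∀ k ν {f g : Fin N → K} → (∀ x → f x ≈ g x) → ∀ x → Lap k ν f x ≈ Lap k ν g x
  Lap-cong k ν eq x = +-cong (*-congˡ (eq x)) (-‿cong (Στ-cong k eq x))

  Lap-linear : ∀ k ν a b (f g : Fin N → K) x →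
    Lap k ν (λ x → a ⊗ f x ⊕ b ⊗ g x) x ≈ a ⊗ Lap k ν f x ⊕ b ⊗ Lap k ν g x
  Lap-linear k ν a b f g x = trans (+-congˡ (-‿cong (Στ-linear k a b f g x)))
    (solve 7 (λ d a b p q r s → d :* (a :* p :+ b :* q) :- (a :* r :+ b :* s) :=
      a :* (d :* p :- r) :+ b :* (d :* q :- s)) ≈-refl
      (ι (ℕ→ℚ (2 ℕ.* k) ℚ.+ ν)) a b (f x) (g x) (Στ k f x) (Στ k g x))

  Lap-zero : ∀ k ν x → Lap k ν (λ _ → 0#) x ≈ 0#
  Lap-zero k ν x = trans (Lap-cong k ν {λ _ → 0#} {λ _ → 0# ⊗ 0# ⊕ 0# ⊗ 0#} (λ _ → sym zeros) x)
    (trans (Lap-linear k ν 0# 0# (λ _ → 0#) (λ _ → 0#) x)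
      (trans (+-cong (zeroˡ _) (zeroˡ _)) (+-identityʳ 0#)))
    where
    zeros : 0# ⊗ 0# ⊕ 0# ⊗ 0# ≈ 0#
    zeros = trans (+-cong (zeroˡ 0#) (zeroˡ 0#)) (+-identityʳ 0#)

  Lap-sum : ∀ k ν {n} (a : Fin n → K) (f : Fin n → Fin N → K) x →
    Lap k ν (λ x → sum λ c → a c ⊗ f c x) x ≈ sum λ c → a c ⊗ Lap k ν (f c) x
  Lap-sum k ν {zero}  a f x = Lap-zero k ν x
  Lap-sum k ν {suc n} a f x = begin
    Lap k ν (λ x → a zero ⊗ f zero x ⊕ sum (λ c → a (suc c) ⊗ f (suc c) x)) x
      ≈⟨ Lap-cong k ν (λ x → +-congˡ (sym (*-identityˡ _))) x ⟩
    Lap k ν (λ x → a zero ⊗ f zero x ⊕ 1# ⊗ sum (λ c → a (suc c) ⊗ f (suc c) x)) x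
      ≈⟨ Lap-linear k ν (a zero) 1# (f zero) _ x ⟩
    a zero ⊗ Lap k ν (f zero) x ⊕ 1# ⊗ Lap k ν (λ x → sum (λ c → a (suc c) ⊗ f (suc c) x)) x
      ≈⟨ +-congˡ (trans (*-identityˡ _) (Lap-sum k ν (a ∘ suc) (f ∘ suc) x)) ⟩
    a zero ⊗ Lap k ν (f zero) x ⊕ sum (λ c → a (suc c) ⊗ Lap k ν (f (suc c)) x) ∎

  Lap-const : ∀ k ν c x → Lap k ν (λ _ → c) x ≈ ι ν ⊗ c
  Lap-const k ν c x = begin
    ι (ℕ→ℚ (2 ℕ.* k) ℚ.+ ν) ⊗ c ⊝ Στ k (λ _ → c) x
      ≈⟨ +-cong (*-congʳ (+-homo (ℕ→ℚ (2 ℕ.* k)) ν)) (-‿cong (Στ-const k c x)) ⟩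
    (ι (ℕ→ℚ (2 ℕ.* k)) ⊕ ι ν) ⊗ c ⊝ ι (ℕ→ℚ (2 ℕ.* k)) ⊗ c
      ≈⟨ solve 3 (λ d ν c → (d :+ ν) :* c :- d :* c := ν :* c) ≈-refl (ι (ℕ→ℚ (2 ℕ.* k))) (ι ν) c ⟩
    ι ν ⊗ c ∎

  Lap-reflect : ∀ k ν v (f : Fin N → K) x → Lap k ν (f ∘ reflect v) x ≈ Lap k ν f (reflect v x)
  Lap-reflect k ν v f x = +-congˡ (-‿cong (Στ-reflect k v f x))

  Lap-symmetric : ∀ k → 2 ℕ.* k ℕ.+ 1 ℕ.≤ N → ∀ ν (f g : Fin N → K) →
    sum (λ x → f x ⊗ Lap k ν g x) ≈ sum (λ x → Lap k ν f x ⊗ g x)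
  Lap-symmetric k 2k<N ν f g = begin
    sum (λ x → f x ⊗ Lap k ν g x)
      ≈⟨ sum-cong {N} (λ x → solve 4 (λ f d g s → f :* (d :* g :- s) := d :* (f :* g) :+ con (ℚ.- 1ℚ) :* (f :* s))
           ≈-refl (f x) d (g x) (Στ k g x)) ⟩
    sum (λ x → d ⊗ (f x ⊗ g x) ⊕ ι (ℚ.- 1ℚ) ⊗ (f x ⊗ Στ k g x))
      ≈⟨ sum-linear {N} d (ι (ℚ.- 1ℚ)) _ _ ⟩
    d ⊗ sum (λ x → f x ⊗ g x) ⊕ ι (ℚ.- 1ℚ) ⊗ sum (λ x → f x ⊗ Στ k g x)
      ≈⟨ +-congˡ (*-congˡ (Στ-symmetric k 2k<N f g)) ⟩
    d ⊗ sum (λ x → f x ⊗ g x) ⊕ ι (ℚ.- 1ℚ) ⊗ sum (λ x → Στ k f x ⊗ g x)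
      ≈⟨ sum-linear {N} d (ι (ℚ.- 1ℚ)) _ _ ⟨
    sum (λ x → d ⊗ (f x ⊗ g x) ⊕ ι (ℚ.- 1ℚ) ⊗ (Στ k f x ⊗ g x))
      ≈⟨ sum-cong {N} (λ x → solve 4 (λ f d g s → d :* (f :* g) :+ con (ℚ.- 1ℚ) :* (s :* g) := (d :* f :- s) :* g)
           ≈-refl (f x) d (g x) (Στ k f x)) ⟩
    sum (λ x → Lap k ν f x ⊗ g x) ∎
    where
    d : K
    d = ι (ℕ→ℚ (2 ℕ.* k) ℚ.+ ν)

  sum-const : ∀ n c → sum {n} (λ _ → c) ≈ ι (ℕ→ℚ n) ⊗ c
  sum-const zero    c = sym (trans (*-congʳ 0-homo) (zeroˡ c))
  sum-const (suc n) c = begin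
    c ⊕ sum {n} (λ _ → c)       ≈⟨ +-congˡ (sum-const n c) ⟩
    c ⊕ ι (ℕ→ℚ n) ⊗ c           ≈⟨ solve 2 (λ c n → c :+ n :* c := (n :+ con 1ℚ) :* c) ≈-refl c (ι (ℕ→ℚ n)) ⟩
    (ι (ℕ→ℚ n) ⊕ ι 1ℚ) ⊗ c      ≈⟨ *-congʳ (+-homo (ℕ→ℚ n) 1ℚ) ⟨
    ι (ℕ→ℚ n ℚ.+ 1ℚ) ⊗ c        ≈⟨ *-congʳ (reflexive (cong ι (ℕ→ℚ-suc n))) ⟨
    ι (ℕ→ℚ (suc n)) ⊗ c ∎

  -- The Dirichlet form

  module Quadratic (k : ℕ) (2k<N : 2 ℕ.* k ℕ.+ 1 ℕ.≤ N) where

    2k : K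
    2k = ι (ℕ→ℚ (2 ℕ.* k))

    energyTerm : (Fin N → K) → Fin N → Fin N → K
    energyTerm f x y = indicator (_~?_ k 2k<N x y) ((f x ⊝ f y) ⊗ (f x ⊝ f y))

    energy : (Fin N → K) → K
    energy f = sum λ x → sum (energyTerm f x)

    expand : {A : Set} (d : Dec A) (a b : K) → indicator d ((a ⊝ b) ⊗ (a ⊝ b)) ≈
      1# ⊗ indicator d (b ⊗ b) ⊕ a ⊗ (a ⊗ indicator d 1# ⊕ (⊖ ι (ℕ→ℚ 2)) ⊗ indicator d b)
    expand (yes _) a b = trans
      (solve 2 (λ a b → (a :- b) :* (a :- b) := b :* b :+ a :* (a :+ (:- num 2) :* b)) ≈-refl a b)
      (+-cong (sym (*-identityˡ _)) (*-congˡ (+-congʳ (sym (*-identityʳ a)))))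
    expand (no _) a b = sym (trans (+-cong (zeroʳ 1#) (trans (*-congˡ (trans
      (+-cong (zeroʳ a) (zeroʳ _)) (+-identityʳ 0#))) (zeroʳ a))) (+-identityʳ 0#))

    sum-energyTerm : ∀ f x → sum (energyTerm f x) ≈
      Στ k (λ y → f y ⊗ f y) x ⊕ f x ⊗ (f x ⊗ 2k ⊕ (⊖ ι (ℕ→ℚ 2)) ⊗ Στ k f x)
    sum-energyTerm f x = begin
      sum (energyTerm f x)
        ≈⟨ sum-cong {N} (λ y → expand (_~?_ k 2k<N x y) (f x) (f y)) ⟩
      sum (λ y → 1# ⊗ indicator (_~?_ k 2k<N x y) (f y ⊗ f y) ⊕
        f x ⊗ (f x ⊗ indicator (_~?_ k 2k<N x y) 1# ⊕ (⊖ ι (ℕ→ℚ 2)) ⊗ indicator (_~?_ k 2k<N x y) (f y)))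
        ≈⟨ trans (sum-linear {N} 1# (f x) _ _) (+-cong
             (trans (*-identityˡ _) (adjacencySum-Στ k 2k<N _ x))
             (*-congˡ (trans (sum-linear {N} (f x) (⊖ ι (ℕ→ℚ 2)) _ _)
               (+-cong
                 (*-congˡ (trans (adjacencySum-Στ k 2k<N (λ _ → 1#) x)
                   (trans (Στ-const k 1# x) (*-identityʳ 2k))))
                 (*-congˡ (adjacencySum-Στ k 2k<N f x)))))) ⟩
      Στ k (λ y → f y ⊗ f y) x ⊕ f x ⊗ (f x ⊗ 2k ⊕ (⊖ ι (ℕ→ℚ 2)) ⊗ Στ k f x) ∎

    sum-Στ : ∀ f → sum (Στ k f) ≈ 2k ⊗ sum f
    sum-Στ f = begin
      sum (Στ k f)
        ≈⟨ sum-cong {N} (λ x → *-identityˡ _) ⟨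
      sum (λ x → 1# ⊗ Στ k f x)
        ≈⟨ Στ-symmetric k 2k<N (λ _ → 1#) f ⟩
      sum (λ x → Στ k (λ _ → 1#) x ⊗ f x)
        ≈⟨ sum-cong {N} (λ x → *-congʳ (trans (Στ-const k 1# x) (*-identityʳ 2k))) ⟩
      sum (λ x → 2k ⊗ f x)
        ≈⟨ sum-⊗ {N} 2k f ⟩
      2k ⊗ sum f ∎

    sum-Lap : ∀ ν f → sum (Lap k ν f) ≈ ι ν ⊗ sum f
    sum-Lap ν f = begin
      sum (Lap k ν f)
        ≈⟨ sum-cong {N} (λ x → +-congˡ (solve 1 (λ s → :- s := (:- con 1ℚ) :* s) ≈-refl (Στ k f x))) ⟩
      sum (λ x → ι (ℕ→ℚ (2 ℕ.* k) ℚ.+ ν) ⊗ f x ⊕ (⊖ ι 1ℚ) ⊗ Στ k f x)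
        ≈⟨ sum-linear {N} (ι (ℕ→ℚ (2 ℕ.* k) ℚ.+ ν)) (⊖ ι 1ℚ) _ _ ⟩
      ι (ℕ→ℚ (2 ℕ.* k) ℚ.+ ν) ⊗ sum f ⊕ (⊖ ι 1ℚ) ⊗ sum (Στ k f)
        ≈⟨ +-cong (*-congʳ (+-homo (ℕ→ℚ (2 ℕ.* k)) ν)) (*-congˡ (sum-Στ f)) ⟩
      (2k ⊕ ι ν) ⊗ sum f ⊕ (⊖ ι 1ℚ) ⊗ (2k ⊗ sum f)
        ≈⟨ solve 3 (λ d ν s → (d :+ ν) :* s :+ (:- con 1ℚ) :* (d :* s) := ν :* s) ≈-refl 2k (ι ν) (sum f) ⟩
      ι ν ⊗ sum f ∎

    -- Expand the squares and use that the row sums are 2k. The factor 2 appears because `energy`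
    -- runs over ordered pairs and so meets each edge twice.
    energy-Lap : ∀ ν f → energy f ⊕ ι (ℕ→ℚ 2) ⊗ (ι ν ⊗ sum (λ x → f x ⊗ f x)) ≈
      ι (ℕ→ℚ 2) ⊗ sum (λ x → f x ⊗ Lap k ν f x)
    energy-Lap ν f = begin
      energy f ⊕ ι (ℕ→ℚ 2) ⊗ (ι ν ⊗ Σf²)
        ≈⟨ +-congʳ (trans (sum-cong {N} (sum-energyTerm f)) (trans (sum-⊕ {N} _ _)
             (+-cong (sum-Στ (λ x → f x ⊗ f x)) (trans
               (sum-cong {N} λ x → solve 3 (λ f d s → f :* (f :* d :+ (:- num 2) :* s) :=
                 d :* (f :* f) :+ (:- num 2) :* (f :* s)) ≈-refl (f x) 2k (Στ k f x))
               (sum-linear {N} 2k (⊖ ι (ℕ→ℚ 2)) _ _))))) ⟩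
      (2k ⊗ Σf² ⊕ (2k ⊗ Σf² ⊕ (⊖ ι (ℕ→ℚ 2)) ⊗ ΣfΣτ)) ⊕ ι (ℕ→ℚ 2) ⊗ (ι ν ⊗ Σf²)
        ≈⟨ solve 4 (λ d s t ν → (d :* s :+ (d :* s :+ (:- num 2) :* t)) :+ num 2 :* (ν :* s) :=
             num 2 :* ((d :+ ν) :* s :+ (:- con 1ℚ) :* t)) ≈-refl 2k Σf² ΣfΣτ (ι ν) ⟩
      ι (ℕ→ℚ 2) ⊗ ((2k ⊕ ι ν) ⊗ Σf² ⊕ (⊖ ι 1ℚ) ⊗ ΣfΣτ)
        ≈⟨ *-congˡ (sum-linear {N} (2k ⊕ ι ν) (⊖ ι 1ℚ) _ _) ⟨
      ι (ℕ→ℚ 2) ⊗ sum (λ x → (2k ⊕ ι ν) ⊗ (f x ⊗ f x) ⊕ (⊖ ι 1ℚ) ⊗ (f x ⊗ Στ k f x))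
        ≈⟨ *-congˡ (sum-cong {N} λ x → trans
             (solve 3 (λ d f s → d :* (f :* f) :+ (:- con 1ℚ) :* (f :* s) := f :* (d :* f :- s)) ≈-refl
               (2k ⊕ ι ν) (f x) (Στ k f x))
             (*-congˡ (+-congʳ (*-congʳ (sym (+-homo (ℕ→ℚ (2 ℕ.* k)) ν)))))) ⟩
      ι (ℕ→ℚ 2) ⊗ sum (λ x → f x ⊗ Lap k ν f x) ∎
      where
      Σf² ΣfΣτ : K
      Σf²  = sum λ x → f x ⊗ f x
      ΣfΣτ = sum λ x → f x ⊗ Στ k f x

    -- Pair the kernel equation of Λ + ν + cJ, with J the all-ones matrix, with `f` itself. Over ℚ
    -- and for ν, c ≥ 0 every summand is nonnegative. The parameters cover both ν > 0, c = 0 and the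
    -- singular ν = 0 repaired by c = 1.
    quadratic-form : ∀ ν c f → (∀ x → Lap k ν f x ⊕ ι c ⊗ sum f ≈ 0#) →
      energy f ⊕ ι (ℕ→ℚ 2) ⊗ (ι ν ⊗ sum (λ x → f x ⊗ f x) ⊕ ι c ⊗ (sum f ⊗ sum f)) ≈ 0#
    quadratic-form ν c f kernel = begin
      energy f ⊕ ι (ℕ→ℚ 2) ⊗ (ι ν ⊗ sum (λ x → f x ⊗ f x) ⊕ ι c ⊗ (sum f ⊗ sum f))
        ≈⟨ solve 5 (λ e t p c s → e :+ t :* (p :+ c :* (s :* s)) := (e :+ t :* p) :+ t :* ((c :* s) :* s))
             ≈-refl (energy f) (ι (ℕ→ℚ 2)) (ι ν ⊗ sum (λ x → f x ⊗ f x)) (ι c) (sum f) ⟩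
      (energy f ⊕ ι (ℕ→ℚ 2) ⊗ (ι ν ⊗ sum (λ x → f x ⊗ f x))) ⊕ ι (ℕ→ℚ 2) ⊗ ((ι c ⊗ sum f) ⊗ sum f)
        ≈⟨ +-cong (energy-Lap ν f) (*-congˡ (sym (sum-⊗ {N} (ι c ⊗ sum f) f))) ⟩
      ι (ℕ→ℚ 2) ⊗ sum (λ x → f x ⊗ Lap k ν f x) ⊕ ι (ℕ→ℚ 2) ⊗ sum (λ x → (ι c ⊗ sum f) ⊗ f x)
        ≈⟨ distribˡ (ι (ℕ→ℚ 2)) _ _ ⟨
      ι (ℕ→ℚ 2) ⊗ (sum (λ x → f x ⊗ Lap k ν f x) ⊕ sum (λ x → (ι c ⊗ sum f) ⊗ f x))
        ≈⟨ *-congˡ (trans (sym (sum-⊕ {N} _ _)) (sum-zero {N} λ x → trans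
             (solve 3 (λ f l c → f :* l :+ c :* f := f :* (l :+ c)) ≈-refl (f x) (Lap k ν f x) (ι c ⊗ sum f))
             (trans (*-congˡ (kernel x)) (zeroʳ (f x))))) ⟩
      ι (ℕ→ℚ 2) ⊗ 0#
        ≈⟨ zeroʳ _ ⟩
      0# ∎

    matrix : ℚ → ℚ → Fin N → Fin N → K
    matrix ν c x y =
      (indicator (x Fin.≟ y) (ι (ℕ→ℚ (2 ℕ.* k) ℚ.+ ν)) ⊝ indicator (_~?_ k 2k<N x y) 1#) ⊕ ι c

    matrix-Lap : ∀ ν c f x → sum (λ y → matrix ν c x y ⊗ f y) ≈ Lap k ν f x ⊕ ι c ⊗ sum f
    matrix-Lap ν c f x = begin
      sum (λ y → matrix ν c x y ⊗ f y)
        ≈⟨ sum-cong {N} (λ y → trans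
             (solve 4 (λ a b c z → ((a :- b) :+ c) :* z := (z :* a :+ (:- con 1ℚ) :* (z :* b)) :+ c :* z) ≈-refl
               (indicator (x Fin.≟ y) d) (indicator (_~?_ k 2k<N x y) 1#) (ι c) (f y))
             (+-congʳ (+-cong (sym (indicator-⊗ (x Fin.≟ y) (f y) d))
               (*-congˡ (trans (sym (indicator-⊗ (_~?_ k 2k<N x y) (f y) 1#))
                 (indicator-cong (_~?_ k 2k<N x y) λ _ → *-identityʳ (f y))))))) ⟩
      sum (λ y → (indicator (x Fin.≟ y) (f y ⊗ d) ⊕ (⊖ ι 1ℚ) ⊗ indicator (_~?_ k 2k<N x y) (f y)) ⊕ ι c ⊗ f y)
        ≈⟨ trans (sum-⊕ {N} _ _) (+-cong
             (trans (sum-⊕ {N} _ _) (+-cong (sum-indicator x λ y → f y ⊗ d)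
               (trans (sum-⊗ {N} (⊖ ι 1ℚ) _) (*-congˡ (adjacencySum-Στ k 2k<N f x)))))
             (sum-⊗ {N} (ι c) f)) ⟩
      (f x ⊗ d ⊕ (⊖ ι 1ℚ) ⊗ Στ k f x) ⊕ ι c ⊗ sum f
        ≈⟨ +-congʳ (solve 3 (λ f d s → f :* d :+ (:- con 1ℚ) :* s := d :* f :- s) ≈-refl (f x) d (Στ k f x)) ⟩
      Lap k ν f x ⊕ ι c ⊗ sum f ∎
      where
      d : K
      d = ι (ℕ→ℚ (2 ℕ.* k) ℚ.+ ν)

-- Positivity and the rational Green functions

module GreenFunctions (N k : ℕ) .{{_ : NonZero N}} (1≤k : 1 ℕ.≤ k) (2k<N : 2 ℕ.* k ℕ.+ 1 ℕ.≤ N) where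

  open ℚ-Algebra
  open Cyclic N
  open CycleOperators ℚ-ring ℚ-scalars N
  open Neighbours k 2k<N

  open Quadratic k 2k<N

  0≤energyTerm : ∀ f x y → 0ℚ ℚ.≤ energyTerm f x y
  0≤energyTerm f x y = 0≤indicator (x ~? y) (0≤square (f x ⊝ f y))
    where
    0≤indicator : {A : Set} (d : Dec A) {q : ℚ} → 0ℚ ℚ.≤ q → 0ℚ ℚ.≤ indicator d q
    0≤indicator (yes _) 0≤q = 0≤q
    0≤indicator (no _)  _   = ℚ.≤-refl

  nonneg-sum≡0 : ∀ {p q} → 0ℚ ℚ.≤ p → 0ℚ ℚ.≤ q → p ⊕ q ≡ 0ℚ → p ≡ 0ℚ × q ≡ 0ℚ
  nonneg-sum≡0 {p} {q} 0≤p 0≤q eq =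
    ℚ.≤-antisym (0≤⇒≤ q (trans (cong (_⊝ p) (sym eq)) (solve 2 (λ p q → (p :+ q) :- p := q) refl p q)) 0≤q) 0≤p ,
    ℚ.≤-antisym (0≤⇒≤ p (trans (cong (_⊝ q) (sym eq)) (solve 2 (λ p q → (p :+ q) :- q := p) refl p q)) 0≤p) 0≤q

  module Definite (ν c : ℚ) (0≤ν : 0ℚ ℚ.≤ ν) (0≤c : 0ℚ ℚ.≤ c) (f : Fin N → ℚ)
    (kernel : ∀ x → Lap k ν f x ⊕ c ⊗ sum f ≡ 0ℚ) where

    Σf² : ℚ
    Σf² = sum λ x → f x ⊗ f x

    0≤νΣf² : 0ℚ ℚ.≤ ν ⊗ Σf²
    0≤νΣf² = 0≤-* 0≤ν (0≤sum {N} λ x → 0≤square (f x))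

    0≤c[Σf]² : 0ℚ ℚ.≤ c ⊗ (sum f ⊗ sum f)
    0≤c[Σf]² = 0≤-* 0≤c (0≤square (sum f))

    0≤energy : 0ℚ ℚ.≤ energy f
    0≤energy = 0≤sum {N} λ x → 0≤sum {N} (0≤energyTerm f x)

    vanishing : energy f ≡ 0ℚ × ℕ→ℚ 2 ⊗ (ν ⊗ Σf² ⊕ c ⊗ (sum f ⊗ sum f)) ≡ 0ℚ
    vanishing = nonneg-sum≡0 0≤energy (0≤-* (0≤ℕ→ℚ 2) (0≤-+ 0≤νΣf² 0≤c[Σf]²)) (quadratic-form ν c f kernel)

    rest≡0 : ν ⊗ Σf² ≡ 0ℚ × c ⊗ (sum f ⊗ sum f) ≡ 0ℚ
    rest≡0 = nonneg-sum≡0 0≤νΣf² 0≤c[Σf]² (p*q≡0⇒q≡0 {ℕ→ℚ 2} (λ ()) (proj₂ vanishing))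

    massive : ν ≢ 0ℚ → ∀ x → f x ≡ 0ℚ
    massive ν≢0 x = square≡0⇒≡0 (f x)
      (sum≡0⇒≡0 {N} (λ x → 0≤square (f x)) (p*q≡0⇒q≡0 {ν} ν≢0 (proj₁ rest≡0)) x)

    neighbours-equal : ∀ {x y} → CycleAdj N k x y → f x ≡ f y
    neighbours-equal {x} {y} x~y = trans
      (solve 2 (λ a b → a := (a :- b) :+ b) refl (f x) (f y))
      (trans (cong (_⊕ f y) (square≡0⇒≡0 (f x ⊝ f y) (trans
        (≡.sym (cong (if_then (f x ⊝ f y) ⊗ (f x ⊝ f y) else 0ℚ) (dec-true (x ~? y) x~y)))
        (sum≡0⇒≡0 {N} (0≤energyTerm f x)
          (sum≡0⇒≡0 {N} (λ x → 0≤sum {N} (0≤energyTerm f x)) (proj₁ vanishing) x) y)))) (+-identityˡ (f y)))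

    -- Zero energy makes `f` agree on neighbours, and as 1 ≤ k the unit steps from 0 already reach
    -- every vertex.
    constant : ∀ x → f x ≡ f 0ᶠ
    constant x = ≡.trans (cong f (≡.sym (≡.trans
        (cong (λ n → (n ℕ.+ toℕ x) mod N) toℕ-0ᶠ) (mod-toℕ x)))) (walk (toℕ x))
      where
      walk : ∀ n → f (0ᶠ ⊞ n) ≡ f 0ᶠ
      walk zero    = cong f (⊞-0 0ᶠ)
      walk (suc n) = ≡.trans (cong f (≡.trans (cong (0ᶠ ⊞_) (ℕ.+-comm 1 n)) (≡.sym (⊞-⊞ 0ᶠ n 1))))
        (≡.trans (≡.sym (neighbours-equal (1 , ℕ.≤-refl , 1≤k , inj₂
          (ℤ.∣⇒∣ᵤ (⊞⇒∣ (0ᶠ ⊞ n) (0ᶠ ⊞ n ⊞ 1) 1 refl))))) (walk n))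

    -- The term with `c` forces `sum f` to vanish, and for constant `f` this sum is `N` times its
    -- value.
    massless : c ≢ 0ℚ → ∀ x → f x ≡ 0ℚ
    massless c≢0 x = ≡.trans (constant x) (p*q≡0⇒q≡0 (ℕ→ℚ≢0 N) (trans (sym (sum-const N (f 0ᶠ)))
      (trans (sum-cong {N} λ x → sym (constant x)) (square≡0⇒≡0 (sum f) (p*q≡0⇒q≡0 {c} c≢0 (proj₂ rest≡0))))))

  solve-Lap : ∀ ν c → 0ℚ ℚ.≤ ν → 0ℚ ℚ.≤ c → ν ≢ 0ℚ ⊎ c ≢ 0ℚ → ∀ b →
    ∃ λ f → ∀ x → Lap k ν f x ⊕ c ⊗ sum f ≡ b x
  solve-Lap ν c 0≤ν 0≤c nonzero b =
    let (f , f-solves) = LinearSystems.solvable N (matrix ν c) injective b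
    in f , λ x → trans (sym (matrix-Lap ν c f x)) (f-solves x)
    where
    injective : ∀ f → (∀ x → sum (λ y → matrix ν c x y ⊗ f y) ≡ 0ℚ) → ∀ x → f x ≡ 0ℚ
    injective f kernel = [ massive , massless ]′ nonzero
      where open Definite ν c 0≤ν 0≤c f (λ x → trans (sym (matrix-Lap ν c f x)) (kernel x))

  green : ∀ ν → 0ℚ ℚ.< ν → ∀ y → ∃ λ Γ → ∀ x → Lap k ν Γ x ≡ δ y x
  green ν 0<ν y =
    let (Γ , Γ-solves) = solve-Lap ν 0ℚ (ℚ.<⇒≤ 0<ν) ℚ.≤-refl (inj₁ λ ν≡0 → ℚ.<-irrefl (≡.sym ν≡0) 0<ν) (δ y)
    in Γ , λ x → trans (sym (trans (cong (Lap k ν Γ x ⊕_) (zeroˡ (sum Γ))) (+-identityʳ _))) (Γ-solves x)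

  -- Solved with Λ + J instead of the singular Λ, where J sums over all vertices.
  green₀ : ∃ λ Γ → ∀ x → ℕ→ℚ N ⊗ Lap k 0ℚ Γ x ≡ ℕ→ℚ N ⊗ δ 0ᶠ x ⊝ 1ℚ
  green₀ = Γ , λ x → trans
      (solve 3 (λ n l s → n :* l := n :* (l :+ con 1ℚ :* s) :- n :* s) refl (ℕ→ℚ N) (Lap k 0ℚ Γ x) (sum Γ))
      (cong₂ (λ p q → ℕ→ℚ N ⊗ p ⊝ q) (Γ-solves x) total)
    where
    solution : ∃ λ f → ∀ x → Lap k 0ℚ f x ⊕ 1ℚ ⊗ sum f ≡ δ 0ᶠ x
    solution = solve-Lap 0ℚ 1ℚ ℚ.≤-refl (0≤ℕ→ℚ 1) (inj₂ λ ()) (δ 0ᶠ)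
    Γ : Fin N → ℚ
    Γ = proj₁ solution
    Γ-solves : ∀ x → Lap k 0ℚ Γ x ⊕ 1ℚ ⊗ sum Γ ≡ δ 0ᶠ x
    Γ-solves = proj₂ solution
    -- Summing the equation over all vertices annihilates the Laplacian. This identifies the
    -- constant to be subtracted from δ as 1/N, whose denominator is cleared in `green₀`.
    total : ℕ→ℚ N ⊗ sum Γ ≡ 1ℚ
    total = begin
      ℕ→ℚ N ⊗ sum Γ
        ≈⟨ solve 2 (λ n s → n :* s := con 0ℚ :* s :+ n :* (con 1ℚ :* s)) refl (ℕ→ℚ N) (sum Γ) ⟩
      0ℚ ⊗ sum Γ ⊕ ℕ→ℚ N ⊗ (1ℚ ⊗ sum Γ)
        ≈⟨ cong₂ _⊕_ (sum-Lap 0ℚ Γ) (sum-const N (1ℚ ⊗ sum Γ)) ⟨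
      sum (Lap k 0ℚ Γ) ⊕ sum {N} (λ _ → 1ℚ ⊗ sum Γ)
        ≈⟨ sum-⊕ {N} _ _ ⟨
      sum (λ x → Lap k 0ℚ Γ x ⊕ 1ℚ ⊗ sum Γ)
        ≈⟨ sum-cong {N} (λ x → trans (Γ-solves x) (sym (*-identityˡ (δ 0ᶠ x)))) ⟩
      sum (λ x → 1ℚ ⊗ δ 0ᶠ x)
        ≈⟨ sum-δ 0ᶠ (λ _ → 1ℚ) ⟩
      1ℚ ∎

-- Transfer of the Green functions to other rings

module CycleTransfer (R : CommutativeRing 0ℓ 0ℓ) (scalars : ScalarMap R)
  (N k : ℕ) .{{_ : NonZero N}} (1≤k : 1 ℕ.≤ k) (2k<N : 2 ℕ.* k ℕ.+ 1 ℕ.≤ N) where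

  open Algebraic R scalars
  open Cyclic N
  open CycleOperators R scalars N
  open GreenFunctions N k 1≤k 2k<N using (green)
  private
    module Q = CycleOperators ℚ-ring ℚ-scalars N

  ι-Στ : ∀ k (f : Fin N → ℚ) x → ι (Q.Στ k f x) ≈ Στ k (ι ∘ f) x
  ι-Στ zero    f x = 0-homo
  ι-Στ (suc k) f x = trans (+-homo _ _) (+-cong (ι-Στ k f x) (+-homo _ _))

  ι-Lap : ∀ ν (f : Fin N → ℚ) x → ι (Q.Lap k ν f x) ≈ Lap k ν (ι ∘ f) x
  ι-Lap ν f x = trans (+-homo _ _) (+-cong (*-homo _ _) (trans (-‿homo _) (-‿cong (ι-Στ k f x))))

  IsGreen : ℚ → Fin N → (Fin N → ℚ) → Set
  IsGreen ν y Γ = ∀ x → Q.Lap k ν Γ x ≡ Q.δ y x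

  Lap-green : ∀ {ν y Γ} → IsGreen ν y Γ → ∀ x → Lap k ν (ι ∘ Γ) x ≈ δ y x
  Lap-green {ν} {y} {Γ} isGreen x = trans (sym (ι-Lap ν Γ x))
    (trans (reflexive (cong ι (isGreen x))) (ι-indicator (y Fin.≟ x)))

  green-pairing : ∀ {ν y Γ} → IsGreen ν y Γ → ∀ f → sum (λ x → ι (Γ x) ⊗ Lap k ν f x) ≈ f y
  green-pairing {ν} {y} {Γ} isGreen f = begin
    sum (λ x → ι (Γ x) ⊗ Lap k ν f x)  ≈⟨ Lap-symmetric k 2k<N ν (ι ∘ Γ) f ⟩
    sum (λ x → Lap k ν (ι ∘ Γ) x ⊗ f x) ≈⟨ sum-cong {N} (λ x → trans (*-congʳ (Lap-green {ν} {y} {Γ} isGreen x)) (*-comm _ _)) ⟩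
    sum (λ x → f x ⊗ δ y x)            ≈⟨ sum-δ y f ⟩
    f y ∎

  -- No positivity is available in `R`. Instead, self-adjointness and the rational Green function
  -- centred at `y` recover the value at `y` from the image of `f`; this is why `green` accepts any
  -- centre.
  Lap-injective : ∀ ν → 0ℚ ℚ.< ν → ∀ f → (∀ x → Lap k ν f x ≈ 0#) → ∀ y → f y ≈ 0#
  Lap-injective ν 0<ν f kernel y =
    let (Γ , isGreen) = green ν 0<ν y
    in trans (sym (green-pairing {ν} {y} {Γ} isGreen f))
         (sum-zero {N} λ x → trans (*-congˡ (kernel x)) (zeroʳ _))

  module _ (ν : ℚ) (0<ν : 0ℚ ℚ.< ν) (Γ : Fin N → ℚ) (isGreen : IsGreen ν 0ᶠ Γ)
    (F : Fin N → K) (b c : K) (F-Lap : ∀ x → Lap k ν F x ≈ c ⊝ b ⊗ δ 0ᶠ x) (F0≈0 : F 0ᶠ ≈ 0#) where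

    c/ν : K
    c/ν = ι (recip ν) ⊗ c

    ν⊗c/ν : ι ν ⊗ c/ν ≈ c
    ν⊗c/ν = begin
      ι ν ⊗ (ι (recip ν) ⊗ c)    ≈⟨ *-assoc _ _ _ ⟨
      (ι ν ⊗ ι (recip ν)) ⊗ c    ≈⟨ *-congʳ (*-homo ν (recip ν)) ⟨
      ι (ν ℚ.* recip ν) ⊗ c      ≈⟨ *-congʳ (reflexive (cong ι (recip-inverse λ ν≡0 → ℚ.<-irrefl (≡.sym ν≡0) 0<ν))) ⟩
      ι 1ℚ ⊗ c                   ≈⟨ *-congʳ 1-homo ⟩
      1# ⊗ c                     ≈⟨ *-identityˡ c ⟩
      c ∎

    -- Λ + ν multiplies constants by ν, so both sides have the same image under it.
    green-affine : ∀ x → F x ≈ c/ν ⊝ b ⊗ ι (Γ x)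
    green-affine x = begin
      F x
        ≈⟨ solve 4 (λ F b Γ c → F := (con 1ℚ :* F :+ con 1ℚ :* (b :* Γ :+ (:- con 1ℚ) :* c)) :+ (c :- b :* Γ))
             ≈-refl (F x) b (ι (Γ x)) c/ν ⟩
      u x ⊕ (c/ν ⊝ b ⊗ ι (Γ x))
        ≈⟨ +-congʳ (Lap-injective ν 0<ν u u-kernel x) ⟩
      0# ⊕ (c/ν ⊝ b ⊗ ι (Γ x))
        ≈⟨ +-identityˡ _ ⟩
      c/ν ⊝ b ⊗ ι (Γ x) ∎
      where
      u : Fin N → K
      u x = ι 1ℚ ⊗ F x ⊕ ι 1ℚ ⊗ (b ⊗ ι (Γ x) ⊕ (⊖ ι 1ℚ) ⊗ c/ν)
      u-kernel : ∀ x → Lap k ν u x ≈ 0#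
      u-kernel x = begin
        Lap k ν u x
          ≈⟨ trans (Lap-linear k ν (ι 1ℚ) (ι 1ℚ) F _ x) (+-cong (*-congˡ (F-Lap x))
               (*-congˡ (trans (Lap-linear k ν b (⊖ ι 1ℚ) (ι ∘ Γ) (λ _ → c/ν) x)
                 (+-cong (*-congˡ (Lap-green {ν} {0ᶠ} {Γ} isGreen x))
                   (*-congˡ (trans (Lap-const k ν c/ν x) ν⊗c/ν)))))) ⟩
        ι 1ℚ ⊗ (c ⊝ b ⊗ δ 0ᶠ x) ⊕ ι 1ℚ ⊗ (b ⊗ δ 0ᶠ x ⊕ (⊖ ι 1ℚ) ⊗ c)
          ≈⟨ solve 3 (λ c b d → con 1ℚ :* (c :- b :* d) :+ con 1ℚ :* (b :* d :+ (:- con 1ℚ) :* c) := con 0ℚ)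
               ≈-refl c b (δ 0ᶠ x) ⟩
        ι 0ℚ
          ≈⟨ 0-homo ⟩
        0# ∎

    -- Evaluation at 0, where `F` vanishes. Its use is divisibility: for k = 1 it exhibits the
    -- constant `C` as a multiple of `v N`.
    c≈bνΓ : c ≈ b ⊗ ι (ν ℚ.* Γ 0ᶠ)
    c≈bνΓ = begin
      c
        ≈⟨ ν⊗c/ν ⟨
      ι ν ⊗ c/ν
        ≈⟨ solve 4 (λ ν c b g → ν :* c := ν :* (c :- b :* g) :+ b :* (ν :* g)) ≈-refl (ι ν) c/ν b (ι (Γ 0ᶠ)) ⟩
      ι ν ⊗ (c/ν ⊝ b ⊗ ι (Γ 0ᶠ)) ⊕ b ⊗ (ι ν ⊗ ι (Γ 0ᶠ))
        ≈⟨ +-cong (trans (*-congˡ (trans (sym (green-affine 0ᶠ)) F0≈0)) (zeroʳ (ι ν)))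
             (*-congˡ (sym (*-homo ν (Γ 0ᶠ)))) ⟩
      0# ⊕ b ⊗ ι (ν ℚ.* Γ 0ᶠ)
        ≈⟨ +-identityˡ _ ⟩
      b ⊗ ι (ν ℚ.* Γ 0ᶠ) ∎

    green-difference : ∀ x → F x ≈ b ⊗ ι (Γ 0ᶠ ℚ.- Γ x)
    green-difference x = begin
      F x
        ≈⟨ green-affine x ⟩
      c/ν ⊝ b ⊗ ι (Γ x)
        ≈⟨ solve 4 (λ c b g g₀ → c :- b :* g := (c :- b :* g₀) :+ b :* (g₀ :- g)) ≈-refl c/ν b (ι (Γ x)) (ι (Γ 0ᶠ)) ⟩
      (c/ν ⊝ b ⊗ ι (Γ 0ᶠ)) ⊕ b ⊗ (ι (Γ 0ᶠ) ⊝ ι (Γ x))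
        ≈⟨ +-cong (trans (sym (green-affine 0ᶠ)) F0≈0)
             (*-congˡ (sym (trans (+-homo _ _) (+-congˡ (-‿homo (Γ x)))))) ⟩
      0# ⊕ b ⊗ ι (Γ 0ᶠ ℚ.- Γ x)
        ≈⟨ +-identityˡ _ ⟩
      b ⊗ ι (Γ 0ᶠ ℚ.- Γ x) ∎

  module _ (ν : ℚ) (Γ : Fin N → ℚ) (isGreen : IsGreen ν 0ᶠ Γ) where

    -- Write c as the value at 0 of `a w + c · 1` and express that value as a pairing with Γ. Since
    -- `2 a E = ν` and Λ + ν sends 1 to ν, the terms with `E` cancel and everything left contains
    -- `b`. For a root φ one takes a = 2 - φ and b = γ V_N.
    constant-divisible : ∀ (a b c : K) (w E Q : Fin N → K) →
      (∀ x → Lap k ν w x ≈ ι (ℕ→ℚ 2) ⊗ (b ⊗ Q x ⊝ c ⊗ E x)) →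
      (∀ x → ι (ℕ→ℚ 2) ⊗ (a ⊗ E x) ≈ ι ν) → w 0ᶠ ≈ 0# →
      c ≈ b ⊗ (a ⊗ (ι (ℕ→ℚ 2) ⊗ sum (λ x → ι (Γ x) ⊗ Q x)))
    constant-divisible a b c w E Q w-Lap E-eq w0≈0 = begin
      c
        ≈⟨ trans (+-cong (trans (*-congˡ w0≈0) (zeroʳ a)) (*-identityʳ c)) (+-identityˡ c) ⟨
      a ⊗ w 0ᶠ ⊕ c ⊗ 1#
        ≈⟨ +-cong (*-congˡ (green-pairing {ν} {0ᶠ} {Γ} isGreen w))
             (*-congˡ (green-pairing {ν} {0ᶠ} {Γ} isGreen (λ _ → 1#))) ⟨
      a ⊗ sum (λ x → ι (Γ x) ⊗ Lap k ν w x) ⊕ c ⊗ sum (λ x → ι (Γ x) ⊗ Lap k ν (λ _ → 1#) x)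
        ≈⟨ sum-linear {N} a c _ _ ⟨
      sum (λ x → a ⊗ (ι (Γ x) ⊗ Lap k ν w x) ⊕ c ⊗ (ι (Γ x) ⊗ Lap k ν (λ _ → 1#) x))
        ≈⟨ sum-cong {N} (λ x → +-cong (*-congˡ (*-congˡ (w-Lap x)))
             (*-congˡ (*-congˡ (trans (Lap-const k ν 1# x) (*-identityʳ (ι ν)))))) ⟩
      sum (λ x → a ⊗ (ι (Γ x) ⊗ (ι (ℕ→ℚ 2) ⊗ (b ⊗ Q x ⊝ c ⊗ E x))) ⊕ c ⊗ (ι (Γ x) ⊗ ι ν))
        ≈⟨ sum-cong {N} (λ x → trans (+-congˡ (*-congˡ (*-congˡ (sym (E-eq x)))))
             (solve 7 (λ a b c g q e t → a :* (g :* (t :* (b :* q :- c :* e))) :+ c :* (g :* (t :* (a :* e))) :=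
               (b :* (a :* t)) :* (g :* q)) ≈-refl a b c (ι (Γ x)) (Q x) (E x) (ι (ℕ→ℚ 2)))) ⟩
      sum (λ x → (b ⊗ (a ⊗ ι (ℕ→ℚ 2))) ⊗ (ι (Γ x) ⊗ Q x))
        ≈⟨ sum-⊗ {N} (b ⊗ (a ⊗ ι (ℕ→ℚ 2))) _ ⟩
      (b ⊗ (a ⊗ ι (ℕ→ℚ 2))) ⊗ sum (λ x → ι (Γ x) ⊗ Q x)
        ≈⟨ solve 4 (λ b a t s → (b :* (a :* t)) :* s := b :* (a :* (t :* s))) ≈-refl b a (ι (ℕ→ℚ 2)) _ ⟩
      b ⊗ (a ⊗ (ι (ℕ→ℚ 2) ⊗ sum (λ x → ι (Γ x) ⊗ Q x))) ∎

  -- The multiples of δ add up by partial fractions, and only a constant remains of the rest. The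
  -- result has the shape `c ⊝ b ⊗ δ` with b = -2 expected by `green-difference`.
  Lap-superposition : ∀ ν {n} (a u κ : Fin n → K) (w Q : Fin n → Fin N → K) →
    (∀ c x → a c ⊗ Lap k ν (w c) x ≈ ι (ℕ→ℚ 2) ⊗ (u c ⊗ Q c x) ⊝ κ c) →
    (∀ x → sum (λ c → u c ⊗ Q c x) ≈ δ 0ᶠ x) →
    ∀ x → Lap k ν (λ x → sum λ c → a c ⊗ w c x) x ≈ (⊖ sum κ) ⊝ (⊖ ι (ℕ→ℚ 2)) ⊗ δ 0ᶠ x
  Lap-superposition ν {n} a u κ w Q w-Lap uQ≈δ x = begin
    Lap k ν (λ x → sum λ c → a c ⊗ w c x) x
      ≈⟨ Lap-sum k ν a w x ⟩
    sum (λ c → a c ⊗ Lap k ν (w c) x)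
      ≈⟨ sum-cong {n} (λ c → trans (w-Lap c x) (+-congˡ (solve 1 (λ κ → :- κ := (:- con 1ℚ) :* κ) ≈-refl (κ c)))) ⟩
    sum (λ c → ι (ℕ→ℚ 2) ⊗ (u c ⊗ Q c x) ⊕ (⊖ ι 1ℚ) ⊗ κ c)
      ≈⟨ sum-linear {n} (ι (ℕ→ℚ 2)) (⊖ ι 1ℚ) _ κ ⟩
    ι (ℕ→ℚ 2) ⊗ sum (λ c → u c ⊗ Q c x) ⊕ (⊖ ι 1ℚ) ⊗ sum κ
      ≈⟨ +-congʳ (*-congˡ (uQ≈δ x)) ⟩
    ι (ℕ→ℚ 2) ⊗ δ 0ᶠ x ⊕ (⊖ ι 1ℚ) ⊗ sum κ
      ≈⟨ solve 3 (λ t d s → t :* d :+ (:- con 1ℚ) :* s := (:- s) :- (:- t) :* d) ≈-refl (ι (ℕ→ℚ 2)) (δ 0ᶠ x) (sum κ) ⟩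
    (⊖ sum κ) ⊝ (⊖ ι (ℕ→ℚ 2)) ⊗ δ 0ᶠ x ∎

-- Chebyshev sequences of the second kind on the cycle

module SecondKind (R : CommutativeRing 0ℓ 0ℓ) (scalars : ScalarMap R) where

  open Algebraic R scalars

  module Sequence (γ : K) (v : ℕ → K) (v-0 : v 0 ≈ 0#) (v-1 : v 1 ≈ 1#)
    (v-step : ∀ n → v (suc (suc n)) ≈ γ ⊗ v (suc n) ⊝ v n) where

    -- The quadratic form a² - γab + b² is invariant under (a, b) ↦ (γa - b, a), and at the start of
    -- the sequence it is 1.
    v-cassini : ∀ n → (v (suc n) ⊗ v (suc n) ⊝ γ ⊗ (v (suc n) ⊗ v n)) ⊕ v n ⊗ v n ≈ 1#
    v-cassini zero = begin
      (v 1 ⊗ v 1 ⊝ γ ⊗ (v 1 ⊗ v 0)) ⊕ v 0 ⊗ v 0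
        ≈⟨ +-cong (+-cong (*-cong v-1 v-1) (-‿cong (*-congˡ (*-congˡ v-0)))) (*-congʳ v-0) ⟩
      (1# ⊗ 1# ⊝ γ ⊗ (v 1 ⊗ 0#)) ⊕ 0# ⊗ v 0
        ≈⟨ +-cong (+-cong (*-identityˡ 1#) (-‿cong (trans (*-congˡ (zeroʳ (v 1))) (zeroʳ γ)))) (zeroˡ (v 0)) ⟩
      (1# ⊝ 0#) ⊕ 0#
        ≈⟨ solve 2 (λ o z → (o :- z) :+ z := o) ≈-refl 1# 0# ⟩
      1# ∎
    v-cassini (suc n) = begin
      (v (2 ℕ.+ n) ⊗ v (2 ℕ.+ n) ⊝ γ ⊗ (v (2 ℕ.+ n) ⊗ v (suc n))) ⊕ v (suc n) ⊗ v (suc n)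
        ≈⟨ +-congʳ (+-cong (*-cong (v-step n) (v-step n)) (-‿cong (*-congˡ (*-congʳ (v-step n))))) ⟩
      ((γ ⊗ v (suc n) ⊝ v n) ⊗ (γ ⊗ v (suc n) ⊝ v n) ⊝ γ ⊗ ((γ ⊗ v (suc n) ⊝ v n) ⊗ v (suc n))) ⊕ v (suc n) ⊗ v (suc n)
        ≈⟨ solve 3 (λ γ a b → ((γ :* a :- b) :* (γ :* a :- b) :- γ :* ((γ :* a :- b) :* a)) :+ a :* a :=
             (a :* a :- γ :* (a :* b)) :+ b :* b) ≈-refl γ (v (suc n)) (v n) ⟩
      (v (suc n) ⊗ v (suc n) ⊝ γ ⊗ (v (suc n) ⊗ v n)) ⊕ v n ⊗ v n
        ≈⟨ v-cassini n ⟩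
      1# ∎

    v-+ : ∀ p q → v (p ℕ.+ suc q) ≈ v (suc p) ⊗ v (suc q) ⊝ v p ⊗ v q
    v-+ zero q = sym (begin
      v 1 ⊗ v (suc q) ⊝ v 0 ⊗ v q  ≈⟨ +-cong (*-congʳ v-1) (-‿cong (trans (*-congʳ v-0) (zeroˡ (v q)))) ⟩
      1# ⊗ v (suc q) ⊝ 0#          ≈⟨ +-cong (*-identityˡ _) (trans (sym (+-identityˡ _)) (-‿inverseʳ 0#)) ⟩
      v (suc q) ⊕ 0#               ≈⟨ +-identityʳ _ ⟩
      v (suc q) ∎)
    v-+ (suc p) q = begin
      v (suc p ℕ.+ suc q)
        ≈⟨ reflexive (cong v (≡.sym (ℕ.+-suc p (suc q)))) ⟩
      v (p ℕ.+ suc (suc q))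
        ≈⟨ v-+ p (suc q) ⟩
      v (suc p) ⊗ v (2 ℕ.+ q) ⊝ v p ⊗ v (suc q)
        ≈⟨ +-congʳ (*-congˡ (v-step q)) ⟩
      v (suc p) ⊗ (γ ⊗ v (suc q) ⊝ v q) ⊝ v p ⊗ v (suc q)
        ≈⟨ solve 5 (λ γ a b c d → a :* (γ :* c :- d) :- b :* c := (γ :* a :- b) :* c :- a :* d)
             ≈-refl γ (v (suc p)) (v p) (v (suc q)) (v q) ⟩
      (γ ⊗ v (suc p) ⊝ v p) ⊗ v (suc q) ⊝ v (suc p) ⊗ v q
        ≈⟨ +-congʳ (*-congʳ (v-step p)) ⟨
      v (2 ℕ.+ p) ⊗ v (suc q) ⊝ v (suc p) ⊗ v q ∎

    module OnCycle (N : ℕ) .{{_ : NonZero N}} where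

      open Cyclic N
      open CycleOperators R scalars N using (τ; δ)

      w̃ : ℕ → K
      w̃ n = v n ⊗ v (N ℕ.∸ n)

      w : Fin N → K
      w = w̃ ∘ toℕ

      -- Equal to v_(N+1) - v_(N-1), that is 2 T_N(γ/2), the companion of the first kind to `v N`.
      -- Accordingly `C²` is a Pell equation.
      C : K
      C = γ ⊗ v N ⊝ ι (ℕ→ℚ 2) ⊗ v M

      C² : C ⊗ C ≈ ((γ ⊗ γ ⊝ ι (ℕ→ℚ 4)) ⊗ v N) ⊗ v N ⊕ ι (ℕ→ℚ 4)
      C² = begin
        C ⊗ C
          ≈⟨ solve 3 (λ γ a b → (γ :* a :- num 2 :* b) :* (γ :* a :- num 2 :* b) :=
               ((γ :* γ :- num 4) :* a) :* a :+ num 4 :* ((a :* a :- γ :* (a :* b)) :+ b :* b))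
               ≈-refl γ (v N) (v M) ⟩
        ((γ ⊗ γ ⊝ ι (ℕ→ℚ 4)) ⊗ v N) ⊗ v N ⊕ ι (ℕ→ℚ 4) ⊗ ((v N ⊗ v N ⊝ γ ⊗ (v N ⊗ v M)) ⊕ v M ⊗ v M)
          ≈⟨ +-congˡ (trans (*-congˡ (subst (λ n → (v n ⊗ v n ⊝ γ ⊗ (v n ⊗ v M)) ⊕ v M ⊗ v M ≈ 1#) 1+M≡N (v-cassini M)))
               (*-identityʳ _)) ⟩
        ((γ ⊗ γ ⊝ ι (ℕ→ℚ 4)) ⊗ v N) ⊗ v N ⊕ ι (ℕ→ℚ 4) ∎

      w̃-0 : w̃ 0 ≈ 0#
      w̃-0 = trans (*-congʳ v-0) (zeroˡ _)

      w̃-N : w̃ N ≈ 0#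
      w̃-N = trans (*-congˡ (trans (reflexive (cong v (ℕ.n∸n≡0 N))) v-0)) (zeroʳ _)

      w-0 : w 0ᶠ ≈ 0#
      w-0 = trans (reflexive (cong w̃ toℕ-0ᶠ)) w̃-0

      -- Wrapping around the cycle is harmless because the product vanishes at both ends, 0 and `N`.
      w̃-% : ∀ {n} → n ℕ.≤ N → w̃ (n ℕ.% N) ≈ w̃ n
      w̃-% {n} n≤N with ℕ.m≤n⇒m<n∨m≡n n≤N
      ... | inj₁ n<N  = reflexive (cong w̃ (ℕ.m<n⇒m%n≡m n<N))
      ... | inj₂ refl = trans (reflexive (cong w̃ (ℕ.n%n≡0 N))) (trans w̃-0 (sym w̃-N))

      w-right : ∀ x → w (x ⊞ 1) ≈ w̃ (suc (toℕ x))
      w-right x = trans (reflexive (cong w̃ (≡.trans (toℕ-⊞ x 1) (cong (ℕ._% N) (ℕ.+-comm (toℕ x) 1)))))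
        (w̃-% (Fin.toℕ<n x))

      w-left : ∀ x n → toℕ x ≡ suc n → w (x ⊞ (1 ℕ.* M)) ≈ w̃ n
      w-left x n eq = trans (reflexive (cong w̃ (≡.trans (toℕ-⊞ x (1 ℕ.* M)) (≡.trans
          (cong (ℕ._% N) (≡.trans (cong₂ ℕ._+_ eq (ℕ.*-identityˡ M)) (≡.trans (≡.sym (ℕ.+-suc n M)) (cong (n ℕ.+_) 1+M≡N))))
          (ℕ.[m+n]%n≡m%n n N)))))
        (w̃-% (ℕ.≤-trans (ℕ.n≤1+n n) (ℕ.≤-trans (ℕ.≤-reflexive (≡.sym eq)) (ℕ.<⇒≤ (Fin.toℕ<n x)))))

      -- The factor γ² - 2 is the root φ. Away from 0 the defect is independent of x by the addition
      -- formula. At 0 both neighbours have the value v_(N-1), which produces the point source.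
      τ-w : ∀ x → τ 1 w x ⊝ (γ ⊗ γ ⊝ ι (ℕ→ℚ 2)) ⊗ w x ≈ (v N ⊗ γ) ⊗ δ 0ᶠ x ⊝ C
      τ-w x with 0ᶠ Fin.≟ x
      ... | yes refl = begin
        (w (0ᶠ ⊞ 1) ⊕ w (0ᶠ ⊞ (1 ℕ.* M))) ⊝ (γ ⊗ γ ⊝ ι (ℕ→ℚ 2)) ⊗ w 0ᶠ
          ≈⟨ +-cong (+-cong at-1 at-M) (-‿cong (*-congˡ w-0)) ⟩
        (v M ⊕ v M) ⊝ (γ ⊗ γ ⊝ ι (ℕ→ℚ 2)) ⊗ 0#
          ≈⟨ +-congˡ (-‿cong (zeroʳ _)) ⟩
        (v M ⊕ v M) ⊝ 0#
          ≈⟨ +-congˡ (-‿cong 0-homo) ⟨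
        (v M ⊕ v M) ⊝ ι 0ℚ
          ≈⟨ solve 3 (λ a b γ → (b :+ b) :- con 0ℚ := a :* γ :* con 1ℚ :- (γ :* a :- num 2 :* b)) ≈-refl (v N) (v M) γ ⟩
        (v N ⊗ γ) ⊗ ι 1ℚ ⊝ C
          ≈⟨ +-congʳ (*-congˡ 1-homo) ⟩
        (v N ⊗ γ) ⊗ 1# ⊝ C ∎
        where
        at-1 : w (0ᶠ ⊞ 1) ≈ v M
        at-1 = trans (w-right 0ᶠ) (trans (reflexive (cong (w̃ ∘ suc) toℕ-0ᶠ))
          (trans (*-congʳ v-1) (*-identityˡ _)))
        at-M : w (0ᶠ ⊞ (1 ℕ.* M)) ≈ v M
        at-M = begin
          w (0ᶠ ⊞ (1 ℕ.* M))
            ≈⟨ reflexive (cong w̃ (≡.trans (toℕ-⊞ 0ᶠ (1 ℕ.* M))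
                 (cong (ℕ._% N) (cong₂ ℕ._+_ toℕ-0ᶠ (ℕ.*-identityˡ M))))) ⟩
          w̃ (M ℕ.% N)
            ≈⟨ w̃-% (ℕ.m∸n≤m N 1) ⟩
          v M ⊗ v (N ℕ.∸ M)
            ≈⟨ *-congˡ (trans (reflexive (cong v (ℕ.m∸[m∸n]≡n (ℕ.>-nonZero⁻¹ N)))) v-1) ⟩
          v M ⊗ 1#
            ≈⟨ *-identityʳ _ ⟩
          v M ∎
      ... | no 0≢x = interior (toℕ x) refl
        where
        interior : ∀ n → toℕ x ≡ n → τ 1 w x ⊝ (γ ⊗ γ ⊝ ι (ℕ→ℚ 2)) ⊗ w x ≈ (v N ⊗ γ) ⊗ 0# ⊝ C
        interior zero    eq = contradiction (Fin.toℕ-injective (≡.trans toℕ-0ᶠ (≡.sym eq))) 0≢x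
        interior (suc j) eq = begin
          τ 1 w x ⊝ (γ ⊗ γ ⊝ ι (ℕ→ℚ 2)) ⊗ w x
            ≈⟨ +-cong (+-cong (trans (w-right x) (reflexive (cong (w̃ ∘ suc) eq))) (w-left x j eq))
                 (-‿cong (*-congˡ (reflexive (cong w̃ eq)))) ⟩
          (w̃ (2 ℕ.+ j) ⊕ w̃ j) ⊝ (γ ⊗ γ ⊝ ι (ℕ→ℚ 2)) ⊗ w̃ (suc j)
            ≈⟨ +-cong (+-cong (*-cong (v-step j) (reflexive (cong v N∸[2+j]))) (*-congˡ
                 (trans (reflexive (cong v N∸j)) (v-step m)))) (-‿cong (*-congˡ (*-congˡ (reflexive (cong v N∸[1+j]))))) ⟩
          ((γ ⊗ b ⊝ a) ⊗ c ⊕ a ⊗ (γ ⊗ d ⊝ c)) ⊝ (γ ⊗ γ ⊝ ι (ℕ→ℚ 2)) ⊗ (b ⊗ d)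
            ≈⟨ solve 5 (λ γ a b c d → ((γ :* b :- a) :* c :+ a :* (γ :* d :- c)) :- (γ :* γ :- num 2) :* (b :* d) :=
                 con 0ℚ :- (γ :* ((γ :* b :- a) :* d :- b :* c) :- num 2 :* (b :* d :- a :* c))) ≈-refl γ a b c d ⟩
          ι 0ℚ ⊝ (γ ⊗ ((γ ⊗ b ⊝ a) ⊗ d ⊝ b ⊗ c) ⊝ ι (ℕ→ℚ 2) ⊗ (b ⊗ d ⊝ a ⊗ c))
            -- As `N = (j + 1) + (m + 1)` and `M = j + (m + 1)`, the addition formula recognises the
            -- two brackets as `v N` and `v M`.
            ≈⟨ +-cong (trans 0-homo (sym (zeroʳ _))) (-‿cong (+-cong (*-congˡ (trans
                 (+-congʳ (*-congʳ (sym (v-step j)))) (trans (sym (v-+ (suc j) m)) (reflexive (cong v (≡.sym N≡))))))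
                 (-‿cong (*-congˡ (trans (sym (v-+ j m)) (reflexive (cong v (≡.sym M≡)))))))) ⟩
          (v N ⊗ γ) ⊗ 0# ⊝ C ∎
          where
          m : ℕ
          m = N ℕ.∸ suc (suc j)
          N≡ : N ≡ suc j ℕ.+ suc m
          N≡ = ≡.trans (≡.sym (ℕ.m+[n∸m]≡n (subst (λ n → suc n ℕ.≤ N) eq (Fin.toℕ<n x)))) (≡.sym (ℕ.+-suc (suc j) m))
          M≡ : M ≡ j ℕ.+ suc m
          M≡ = cong ℕ.pred (≡.trans 1+M≡N N≡)
          N∸[2+j] : N ℕ.∸ (2 ℕ.+ j) ≡ m
          N∸[2+j] = refl
          N∸[1+j] : N ℕ.∸ suc j ≡ suc m
          N∸[1+j] = ≡.trans (cong (ℕ._∸ suc j) N≡) (ℕ.m+n∸m≡n (suc j) (suc m))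
          N∸j : N ℕ.∸ j ≡ suc (suc m)
          N∸j = ≡.trans (cong (ℕ._∸ j) (≡.trans N≡ (≡.sym (ℕ.+-suc j (suc m))))) (ℕ.m+n∸m≡n j (suc (suc m)))
          a b c d : K
          a = v j
          b = v (suc j)
          c = v m
          d = v (suc m)

      -- C² = 4 modulo v N, and C = 0 modulo v N.
      unit-from-C : ∀ Z → C ≈ v N ⊗ Z → ∃ λ u → v N ⊗ u ≈ 1#
      unit-from-C Z eq = ι (recip (ℕ→ℚ 4)) ⊗ (v N ⊗ (Z ⊗ Z) ⊝ (γ ⊗ γ ⊝ ι (ℕ→ℚ 4)) ⊗ v N) , (begin
        v N ⊗ (ι (recip (ℕ→ℚ 4)) ⊗ (v N ⊗ (Z ⊗ Z) ⊝ (γ ⊗ γ ⊝ ι (ℕ→ℚ 4)) ⊗ v N))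
          ≈⟨ solve 4 (λ a r z e → a :* (r :* (a :* (z :* z) :- e :* a)) := r :* ((a :* z) :* (a :* z) :- (e :* a) :* a))
               ≈-refl (v N) (ι (recip (ℕ→ℚ 4))) Z (γ ⊗ γ ⊝ ι (ℕ→ℚ 4)) ⟩
        ι (recip (ℕ→ℚ 4)) ⊗ ((v N ⊗ Z) ⊗ (v N ⊗ Z) ⊝ ((γ ⊗ γ ⊝ ι (ℕ→ℚ 4)) ⊗ v N) ⊗ v N)
          ≈⟨ *-congˡ (+-congʳ (trans (*-cong (sym eq) (sym eq)) C²)) ⟩
        ι (recip (ℕ→ℚ 4)) ⊗ ((((γ ⊗ γ ⊝ ι (ℕ→ℚ 4)) ⊗ v N) ⊗ v N ⊕ ι (ℕ→ℚ 4)) ⊝ ((γ ⊗ γ ⊝ ι (ℕ→ℚ 4)) ⊗ v N) ⊗ v N)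
          ≈⟨ solve 1 (λ e → con (recip (ℕ→ℚ 4)) :* ((e :+ num 4) :- e) := con 1ℚ) ≈-refl
               (((γ ⊗ γ ⊝ ι (ℕ→ℚ 4)) ⊗ v N) ⊗ v N) ⟩
        ι 1ℚ
          ≈⟨ 1-homo ⟩
        1# ∎)

-- Neighbour sums in Cartesian products

module _ where

  open ℚ-Algebra

  sum-↑ : ∀ m n (f : Fin (m ℕ.+ n) → ℚ) → sum f ≡ sum (λ i → f (i Fin.↑ˡ n)) ⊕ sum (λ j → f (m Fin.↑ʳ j))
  sum-↑ zero    n f = ≡.sym (ℚ.+-identityˡ (sum f))
  sum-↑ (suc m) n f = trans (cong (f zero ⊕_) (sum-↑ m n (f ∘ suc))) (≡.sym (ℚ.+-assoc (f zero) _ _))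

  sum-combine : ∀ m n (f : Fin (m ℕ.* n) → ℚ) → sum f ≡ sum {m} λ i → sum {n} λ j → f (Fin.combine i j)
  sum-combine zero    n f = refl
  sum-combine (suc m) n f = trans (sum-↑ n (m ℕ.* n) f)
    (cong (sum (λ j → f (j Fin.↑ˡ (m ℕ.* n))) ⊕_) (sum-combine m n λ i → f (n Fin.↑ʳ i)))

  sum-remQuot : ∀ m n (f : Fin m × Fin n → ℚ) → sum (f ∘ Fin.remQuot {m} n) ≡ sum {m} λ i → sum {n} λ j → f (i , j)
  sum-remQuot m n f = trans (sum-combine m n (f ∘ Fin.remQuot {m} n))
    (sum-cong {m} λ i → sum-cong {n} λ j → cong f (Fin.remQuot-combine i j))

  indicator-⇔ : {A B : Set} (a : Dec A) (b : Dec B) → (A → B) → (B → A) → ∀ z → indicator a z ≡ indicator b z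
  indicator-⇔ (yes _) (yes _) f g z = refl
  indicator-⇔ (yes a) (no ¬b) f g z = contradiction (f a) ¬b
  indicator-⇔ (no ¬a) (yes b) f g z = contradiction (g b) ¬a
  indicator-⇔ (no _)  (no _)  f g z = refl

  -- Applied with `a` an equality and `d` an adjacency in the second factor: irreflexivity makes the
  -- two kinds of product edges exclusive, so the disjunction becomes a sum.
  indicator-exclusive : {A B C D : Set} (a : Dec A) (b : Dec B) (c : Dec C) (d : Dec D) → (A → ¬ D) → ∀ z →
    indicator ((a ×-dec b) ⊎-dec (c ×-dec d)) z ≡ indicator a (indicator b z) ⊕ indicator c (indicator d z)
  indicator-exclusive (yes a) b       c       (yes d) e z = contradiction d (e a)
  indicator-exclusive (yes _) (yes _) (yes _) (no _)  e z = ≡.sym (ℚ.+-identityʳ z)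
  indicator-exclusive (yes _) (yes _) (no _)  (no _)  e z = ≡.sym (ℚ.+-identityʳ z)
  indicator-exclusive (yes _) (no _)  (yes _) (no _)  e z = refl
  indicator-exclusive (yes _) (no _)  (no _)  (no _)  e z = refl
  indicator-exclusive (no _)  b       (yes _) (yes _) e z = ≡.sym (ℚ.+-identityˡ z)
  indicator-exclusive (no _)  b       (yes _) (no _)  e z = refl
  indicator-exclusive (no _)  b       (no _)  d       e z = refl

  ∑-indicator : ∀ G (u : Vertex G) f → Graph.∑ᵛ G (λ w → indicator (Graph._≟ᵛ_ G u w) (f w)) ≡ f u
  ∑-indicator G u f = trans
    (sum-cong {order} λ i → indicator-⇔ (u ≟ᵛ F.Inverse.from finite i) (F.Inverse.to finite u Fin.≟ i)
      (λ { refl → F.Inverse.strictlyInverseˡ finite i })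
      (λ { refl → ≡.sym (F.Inverse.strictlyInverseʳ finite u) })
      (f (F.Inverse.from finite i)))
    (trans (sum-indicator (F.Inverse.to finite u) (f ∘ F.Inverse.from finite))
      (cong f (F.Inverse.strictlyInverseʳ finite u)))
    where open Graph G

  neighbourSum-□ : ∀ G H f x a → HittingTimes.neighbourSum (G □ H) f (x , a) ≡
    HittingTimes.neighbourSum G (λ y → f (y , a)) x ⊕ HittingTimes.neighbourSum H (λ b → f (x , b)) a
  neighbourSum-□ G H f x a = begin
    HittingTimes.neighbourSum (G □ H) f (x , a)
      ≈⟨ sum-remQuot G.order H.order (λ (i , j) → indicator
           (Graph._~?_ (G □ H) (x , a) (F.Inverse.from G.finite i , F.Inverse.from H.finite j))
           (f (F.Inverse.from G.finite i , F.Inverse.from H.finite j))) ⟩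
    G.∑ᵛ (λ y → H.∑ᵛ λ b → indicator (Graph._~?_ (G □ H) (x , a) (y , b)) (f (y , b)))
      ≈⟨ sum-cong {G.order} (λ i → let y = F.Inverse.from G.finite i in trans
           (trans (sum-cong {H.order} λ j → let b = F.Inverse.from H.finite j in
              indicator-exclusive (a H.≟ᵛ b) (x G.~? y) (x G.≟ᵛ y) (a H.~? b) H.~-irrefl (f (y , b)))
            (sum-⊕ {H.order} _ _))
           (cong₂ _⊕_ (∑-indicator H a λ b → indicator (x G.~? y) (f (y , b)))
             (sum-indicator-const (x G.≟ᵛ y) λ j → let b = F.Inverse.from H.finite j in indicator (a H.~? b) (f (y , b))))) ⟩
    G.∑ᵛ (λ y → indicator (x G.~? y) (f (y , a)) ⊕ indicator (x G.≟ᵛ y) (H.∑ᵛ λ b → indicator (a H.~? b) (f (y , b))))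
      ≈⟨ trans (sum-⊕ {G.order} _ _)
           (cong (HittingTimes.neighbourSum G (λ y → f (y , a)) x ⊕_)
             (∑-indicator G x λ y → H.∑ᵛ λ b → indicator (a H.~? b) (f (y , b)))) ⟩
    HittingTimes.neighbourSum G (λ y → f (y , a)) x ⊕ HittingTimes.neighbourSum H (λ b → f (x , b)) a ∎
    where
    module G = Graph G
    module H = Graph H
    sum-indicator-const : {A : Set} (d : Dec A) (g : Fin H.order → ℚ) →
      sum (λ j → indicator d (g j)) ≡ indicator d (sum g)
    sum-indicator-const (yes _) g = refl
    sum-indicator-const (no _)  g = sum-zero {H.order} λ _ → refl

  neighbourSum-linear : ∀ Y a b (f g : Vertex Y → ℚ) u →
    HittingTimes.neighbourSum Y (λ w → a ⊗ f w ⊕ b ⊗ g w) u ≡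
    a ⊗ HittingTimes.neighbourSum Y f u ⊕ b ⊗ HittingTimes.neighbourSum Y g u
  neighbourSum-linear Y a b f g u = trans
    (sum-cong {order} λ i → let w = F.Inverse.from finite i in indicator-linear (u ~? w) (f w) (g w))
    (sum-linear {order} a b _ _)
    where
    open Graph Y
    indicator-linear : {A : Set} (d : Dec A) (p q : ℚ) →
      indicator d (a ⊗ p ⊕ b ⊗ q) ≡ a ⊗ indicator d p ⊕ b ⊗ indicator d q
    indicator-linear (yes _) p q = refl
    indicator-linear (no _)  p q = solve 2 (λ a b → con 0ℚ := a :* con 0ℚ :+ b :* con 0ℚ) refl a b

-- Spectral projections of the Petersen graph

module Petersen where

  open Graph petersen hiding (Vertex)
  open HittingTimes petersen

  -- The graph is distance-regular of diameter 2, so its spectral projections depend only on whether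
  -- the distance is 0, 1 or 2.
  byDistance : (p q r : ℚ) → Vertex petersen → Vertex petersen → ℚ
  byDistance p q r a b = if does (a ≟ᵛ b) then p else if does (a ~? b) then q else r

  -- 30 times the projections onto the eigenspaces of the eigenvalues 1 and -2;
  -- the projection onto the constants is 3/30 everywhere.
  E₂ E₅ : Vertex petersen → Vertex petersen → ℚ
  E₂ = byDistance (ℕ→ℚ 15) (ℕ→ℚ 5) (ℚ.- ℕ→ℚ 5)
  E₅ = byDistance (ℕ→ℚ 12) (ℚ.- ℕ→ℚ 8) (ℕ→ℚ 2)

  vertex : Fin 10 → Vertex petersen
  vertex = F.Inverse.from finite

  all-vertices : (P : Vertex petersen → Set) → (∀ i → P (vertex i)) → ∀ a → P a
  all-vertices P all a = subst P (F.Inverse.strictlyInverseʳ finite a) (all (F.Inverse.to finite a))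

  -- In a 3-regular graph the adjacency eigenvalues 1 and -2 belong to the Laplacian eigenvalues 2
  -- and 5. The last component is the resolution of the identity, scaled by 30.
  Eigen : Vertex petersen → Vertex petersen → Set
  Eigen a b = neighbourSum (E₂ a) b ≡ E₂ a b × neighbourSum (E₅ a) b ≡ (ℚ.- ℕ→ℚ 2) ℚ.* E₅ a b ×
    (ℕ→ℚ 3 ℚ.+ (E₂ a b ℚ.+ E₅ a b) ≡ (if does (a ≟ᵛ b) then ℕ→ℚ 30 else 0ℚ))

  eigen? : ∀ a b → Dec (Eigen a b)
  eigen? a b = (_ ℚ.≟ _) ×-dec (_ ℚ.≟ _) ×-dec (_ ℚ.≟ _)

  -- Decided by evaluating the rational equations on all 100 pairs of vertices.
  eigen : ∀ a b → Eigen a b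
  eigen = all-vertices _ λ i → all-vertices _ λ j →
    from-yes (Fin.all? λ i → Fin.all? λ j → eigen? (vertex i) (vertex j)) i j

  regular : ∀ a → neighbourSum (λ _ → 1ℚ) a ≡ ℕ→ℚ 3
  regular = all-vertices _ (from-yes (Fin.all? λ i → neighbourSum (λ _ → 1ℚ) (vertex i) ℚ.≟ ℕ→ℚ 3))

  -- The diagonal values 15 and 12 are 30 · 5/10 and 30 · 4/10, multiplicity over order. They are
  -- the origin of the weights 5 and 4 in the formula.
  E₂-diagonal : ∀ a → E₂ a a ≡ ℕ→ℚ 15
  E₂-diagonal a = cong (if_then ℕ→ℚ 15 else (if does (a ~? a) then ℕ→ℚ 5 else (ℚ.- ℕ→ℚ 5))) (dec-true (a ≟ᵛ a) refl)

  E₅-diagonal : ∀ a → E₅ a a ≡ ℕ→ℚ 12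
  E₅-diagonal a = cong (if_then ℕ→ℚ 12 else (if does (a ~? a) then (ℚ.- ℕ→ℚ 8) else ℕ→ℚ 2)) (dec-true (a ≟ᵛ a) refl)

-- Hitting times on the cycle power and on the product

module WalkHittingTimes (N k : ℕ) .{{_ : NonZero N}} (1≤k : 1 ℕ.≤ k) (2k<N : 2 ℕ.* k ℕ.+ 1 ℕ.≤ N)
  (Γ₀ : Fin N → ℚ) (v : Fin N) where

  open ℚ-Algebra
  open Cyclic N
  open CycleOperators ℚ-ring ℚ-scalars N

  -- `t` is chosen so that 3t is the degree 2k + 3 of the product, 3 being the weight of the
  -- constant mode of the Petersen graph. The factor `N` in `c` matches the cleared denominator in
  -- `IsGreen₀`.
  2k 2k+3 t c : ℚ
  2k   = ℕ→ℚ (2 ℕ.* k)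
  2k+3 = ℕ→ℚ (2 ℕ.* k ℕ.+ 3)
  t    = 2k+3 ⊗ recip (ℕ→ℚ 3)
  c    = ℕ→ℚ N ⊗ t

  IsGreen₀ : Set
  IsGreen₀ = ∀ x → ℕ→ℚ N ⊗ Lap k 0ℚ Γ₀ x ≡ ℕ→ℚ N ⊗ δ 0ᶠ x ⊝ 1ℚ

  2k≢0 : 2k ≢ 0ℚ
  2k≢0 = ℕ→ℚ≢0 (2 ℕ.* k) {{ℕ.m*n≢0 2 k {{_}} {{ℕ.>-nonZero 1≤k}}}}

  r : Fin N → Fin N
  r = reflect v

  r≡0⇒≡v : ∀ x → 0ᶠ ≡ r x → x ≡ v
  r≡0⇒≡v x eq = ≡.trans (≡.sym (reflect-reflect v x)) (≡.trans (cong (reflect v) (≡.sym eq)) (reflect-0 v))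

  δ-away : ∀ {y} → 0ᶠ ≢ y → δ 0ᶠ y ≡ 0ℚ
  δ-away {y} 0≢y = cong (if_then 1ℚ else 0ℚ) (dec-false (0ᶠ Fin.≟ y) 0≢y)

  Lap-mass : ∀ ν f x → Lap k ν f x ≡ Lap k 0ℚ f x ⊕ ν ⊗ f x
  Lap-mass ν f x = solve 4 (λ d ν f s → (d :+ ν) :* f :- s := ((d :+ con 0ℚ) :* f :- s) :+ ν :* f)
    refl 2k ν (f x) (Στ k f x)

  cycle-degree : ∀ x → Graph.degree (cyclePower N k 2k<N) x ≡ 2k
  cycle-degree x = trans (adjacencySum-Στ k 2k<N (λ _ → 1ℚ) x)
    (trans (Στ-const k 1ℚ x) (ℚ.*-identityʳ 2k))

  -- 2kN (Γ₀(0) - Γ₀(v - x)), spelled as a combination with explicit coefficients so that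
  -- `Lap-linear` applies to it directly.
  cycleTime : Fin N → ℚ
  cycleTime x = (2k ⊗ ℕ→ℚ N) ⊗ Γ₀ 0ᶠ ⊕ (⊖ (2k ⊗ ℕ→ℚ N)) ⊗ Γ₀ (r x)

  cycle-hittingTime : IsGreen₀ → ∀ u → IsHittingTime (cyclePower N k 2k<N) u v (fromℚ (cycleTime u))
  cycle-hittingTime isGreen₀ = HittingTimes.hittingTime-regular (cyclePower N k 2k<N) 2k 2k≢0 cycle-degree v cycleTime
    (trans (cong (λ y → (2k ⊗ ℕ→ℚ N) ⊗ Γ₀ 0ᶠ ⊕ (⊖ (2k ⊗ ℕ→ℚ N)) ⊗ Γ₀ y) (reflect-self v))
      (solve 2 (λ m g → m :* g :+ (:- m) :* g := con 0ℚ) refl (2k ⊗ ℕ→ℚ N) (Γ₀ 0ᶠ)))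
    λ x x≢v → begin
      2k ⊗ cycleTime x ⊝ HittingTimes.neighbourSum (cyclePower N k 2k<N) cycleTime x
        ≈⟨ cong (λ s → 2k ⊗ cycleTime x ⊝ s) (adjacencySum-Στ k 2k<N cycleTime x) ⟩
      2k ⊗ cycleTime x ⊝ Στ k cycleTime x
        ≈⟨ cong (λ d → d ⊗ cycleTime x ⊝ Στ k cycleTime x) (ℚ.+-identityʳ 2k) ⟨
      Lap k 0ℚ cycleTime x
        ≈⟨ Lap-linear k 0ℚ (2k ⊗ ℕ→ℚ N) (⊖ (2k ⊗ ℕ→ℚ N)) (λ _ → Γ₀ 0ᶠ) (Γ₀ ∘ r) x ⟩
      (2k ⊗ ℕ→ℚ N) ⊗ Lap k 0ℚ (λ _ → Γ₀ 0ᶠ) x ⊕ (⊖ (2k ⊗ ℕ→ℚ N)) ⊗ Lap k 0ℚ (Γ₀ ∘ r) x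
        ≈⟨ cong₂ (λ p q → (2k ⊗ ℕ→ℚ N) ⊗ p ⊕ (⊖ (2k ⊗ ℕ→ℚ N)) ⊗ q)
             (Lap-const k 0ℚ (Γ₀ 0ᶠ) x) (Lap-reflect k 0ℚ v Γ₀ x) ⟩
      (2k ⊗ ℕ→ℚ N) ⊗ (0ℚ ⊗ Γ₀ 0ᶠ) ⊕ (⊖ (2k ⊗ ℕ→ℚ N)) ⊗ Lap k 0ℚ Γ₀ (r x)
        ≈⟨ solve 4 (λ d n g l → (d :* n) :* (con 0ℚ :* g) :+ (:- (d :* n)) :* l := (:- d) :* (n :* l))
             refl 2k (ℕ→ℚ N) (Γ₀ 0ᶠ) (Lap k 0ℚ Γ₀ (r x)) ⟩
      (⊖ 2k) ⊗ (ℕ→ℚ N ⊗ Lap k 0ℚ Γ₀ (r x))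
        ≈⟨ cong ((⊖ 2k) ⊗_) (isGreen₀ (r x)) ⟩
      (⊖ 2k) ⊗ (ℕ→ℚ N ⊗ δ 0ᶠ (r x) ⊝ 1ℚ)
        ≈⟨ cong (λ e → (⊖ 2k) ⊗ (ℕ→ℚ N ⊗ e ⊝ 1ℚ)) (δ-away λ eq → x≢v (r≡0⇒≡v x eq)) ⟩
      (⊖ 2k) ⊗ (ℕ→ℚ N ⊗ 0ℚ ⊝ 1ℚ)
        ≈⟨ solve 2 (λ d n → (:- d) :* (n :* con 0ℚ :- con 1ℚ) := d) refl 2k (ℕ→ℚ N) ⟩
      2k ∎

  module Product (Γ₂ Γ₅ : Fin N → ℚ) (a : Vertex petersen) where

    open Petersen using (E₂; E₅; E₂-diagonal; E₅-diagonal)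

    Y : Graph
    Y = cyclePower N k 2k<N □ petersen

    A : ℚ
    A = c ⊗ (ℕ→ℚ 3 ⊗ Γ₀ 0ᶠ ⊕ (ℕ→ℚ 15 ⊗ Γ₂ 0ᶠ ⊕ ℕ→ℚ 12 ⊗ Γ₅ 0ᶠ))

    -- The bracket is 30 times the Green function of the product modulo constants, decomposed along
    -- the eigenspaces of the Petersen factor; `A` normalises the value at the target to 0. The
    -- factors `1ℚ` supply the shape of `Lap-linear`.
    productTime : Vertex Y → ℚ
    productTime (x , b) = 1ℚ ⊗ A ⊕ (⊖ c) ⊗ (ℕ→ℚ 3 ⊗ Γ₀ (r x) ⊕ 1ℚ ⊗ (E₂ a b ⊗ Γ₂ (r x) ⊕ E₅ a b ⊗ Γ₅ (r x)))

    degree : ∀ u → Graph.degree Y u ≡ 2k+3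
    degree (x , b) = trans (neighbourSum-□ (cyclePower N k 2k<N) petersen (λ _ → 1ℚ) x b)
      (trans (cong₂ _⊕_ (cycle-degree x) (Petersen.regular b)) (sym (ℕ→ℚ-+ (2 ℕ.* k) 3)))

    along-cycle : ∀ x b → 2k ⊗ productTime (x , b) ⊝
      HittingTimes.neighbourSum (cyclePower N k 2k<N) (λ y → productTime (y , b)) x ≡
      (⊖ c) ⊗ (ℕ→ℚ 3 ⊗ Lap k 0ℚ Γ₀ (r x) ⊕ (E₂ a b ⊗ Lap k 0ℚ Γ₂ (r x) ⊕ E₅ a b ⊗ Lap k 0ℚ Γ₅ (r x)))
    along-cycle x b = begin
      2k ⊗ productTime (x , b) ⊝ HittingTimes.neighbourSum (cyclePower N k 2k<N) f x
        ≈⟨ cong (λ s → 2k ⊗ productTime (x , b) ⊝ s) (adjacencySum-Στ k 2k<N f x) ⟩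
      2k ⊗ f x ⊝ Στ k f x
        ≈⟨ cong (λ d → d ⊗ f x ⊝ Στ k f x) (ℚ.+-identityʳ 2k) ⟨
      Lap k 0ℚ f x
        ≈⟨ Lap-linear k 0ℚ 1ℚ (⊖ c) (λ _ → A) _ x ⟩
      1ℚ ⊗ Lap k 0ℚ (λ _ → A) x ⊕ (⊖ c) ⊗ Lap k 0ℚ (λ x →
        ℕ→ℚ 3 ⊗ Γ₀ (r x) ⊕ 1ℚ ⊗ (E₂ a b ⊗ Γ₂ (r x) ⊕ E₅ a b ⊗ Γ₅ (r x))) x
        ≈⟨ cong₂ (λ p q → 1ℚ ⊗ p ⊕ (⊖ c) ⊗ q) (Lap-const k 0ℚ A x)
             (trans (Lap-linear k 0ℚ (ℕ→ℚ 3) 1ℚ (Γ₀ ∘ r) _ x)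
               (cong₂ (λ p q → ℕ→ℚ 3 ⊗ p ⊕ 1ℚ ⊗ q) (Lap-reflect k 0ℚ v Γ₀ x)
                 (trans (Lap-linear k 0ℚ (E₂ a b) (E₅ a b) (Γ₂ ∘ r) (Γ₅ ∘ r) x)
                   (cong₂ (λ p q → E₂ a b ⊗ p ⊕ E₅ a b ⊗ q) (Lap-reflect k 0ℚ v Γ₂ x) (Lap-reflect k 0ℚ v Γ₅ x))))) ⟩
      1ℚ ⊗ (0ℚ ⊗ A) ⊕ (⊖ c) ⊗ (ℕ→ℚ 3 ⊗ Lap k 0ℚ Γ₀ (r x) ⊕
        1ℚ ⊗ (E₂ a b ⊗ Lap k 0ℚ Γ₂ (r x) ⊕ E₅ a b ⊗ Lap k 0ℚ Γ₅ (r x)))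
        ≈⟨ solve 4 (λ A c p q → con 1ℚ :* (con 0ℚ :* A) :+ (:- c) :* (p :+ con 1ℚ :* q) := (:- c) :* (p :+ q))
             refl A c (ℕ→ℚ 3 ⊗ Lap k 0ℚ Γ₀ (r x)) (E₂ a b ⊗ Lap k 0ℚ Γ₂ (r x) ⊕ E₅ a b ⊗ Lap k 0ℚ Γ₅ (r x)) ⟩
      (⊖ c) ⊗ (ℕ→ℚ 3 ⊗ Lap k 0ℚ Γ₀ (r x) ⊕ (E₂ a b ⊗ Lap k 0ℚ Γ₂ (r x) ⊕ E₅ a b ⊗ Lap k 0ℚ Γ₅ (r x))) ∎
      where
      f : Fin N → ℚ
      f y = productTime (y , b)

    along-petersen : ∀ x b → ℕ→ℚ 3 ⊗ productTime (x , b) ⊝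
      HittingTimes.neighbourSum petersen (λ b → productTime (x , b)) b ≡
      (⊖ c) ⊗ (ℕ→ℚ 2 ⊗ (E₂ a b ⊗ Γ₂ (r x)) ⊕ ℕ→ℚ 5 ⊗ (E₅ a b ⊗ Γ₅ (r x)))
    along-petersen x b = begin
      ℕ→ℚ 3 ⊗ productTime (x , b) ⊝ nP (λ b → productTime (x , b)) b
        ≈⟨ cong (λ s → ℕ→ℚ 3 ⊗ productTime (x , b) ⊝ s) (HittingTimes.∑-cong petersen λ w →
             cong (indicator (Graph._~?_ petersen b w)) (regroup (E₂ a w) (E₅ a w))) ⟩
      ℕ→ℚ 3 ⊗ productTime (x , b) ⊝ nP (λ b → A₀ ⊗ 1ℚ ⊕ 1ℚ ⊗ (A₂ ⊗ E₂ a b ⊕ A₅ ⊗ E₅ a b)) b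
        ≈⟨ cong (λ s → ℕ→ℚ 3 ⊗ productTime (x , b) ⊝ s) (trans
             (neighbourSum-linear petersen A₀ 1ℚ (λ _ → 1ℚ) (λ b → A₂ ⊗ E₂ a b ⊕ A₅ ⊗ E₅ a b) b)
             (cong₂ (λ p q → A₀ ⊗ p ⊕ 1ℚ ⊗ q) (Petersen.regular b)
               (trans (neighbourSum-linear petersen A₂ A₅ (E₂ a) (E₅ a) b)
                 (cong₂ (λ p q → A₂ ⊗ p ⊕ A₅ ⊗ q) (proj₁ (Petersen.eigen a b)) (proj₁ (proj₂ (Petersen.eigen a b))))))) ⟩
      ℕ→ℚ 3 ⊗ productTime (x , b) ⊝ (A₀ ⊗ ℕ→ℚ 3 ⊕ 1ℚ ⊗ (A₂ ⊗ E₂ a b ⊕ A₅ ⊗ ((⊖ ℕ→ℚ 2) ⊗ E₅ a b)))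
        ≈⟨ solve 7 (λ A c g₀ g₂ g₅ e₂ e₅ →
             num 3 :* (con 1ℚ :* A :+ (:- c) :* (num 3 :* g₀ :+ con 1ℚ :* (e₂ :* g₂ :+ e₅ :* g₅))) :-
             ((A :+ (:- c) :* (num 3 :* g₀)) :* num 3 :+
               con 1ℚ :* (((:- c) :* g₂) :* e₂ :+ ((:- c) :* g₅) :* ((:- num 2) :* e₅))) :=
             (:- c) :* (num 2 :* (e₂ :* g₂) :+ num 5 :* (e₅ :* g₅)))
             refl A c (Γ₀ (r x)) (Γ₂ (r x)) (Γ₅ (r x)) (E₂ a b) (E₅ a b) ⟩
      (⊖ c) ⊗ (ℕ→ℚ 2 ⊗ (E₂ a b ⊗ Γ₂ (r x)) ⊕ ℕ→ℚ 5 ⊗ (E₅ a b ⊗ Γ₅ (r x))) ∎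
      where
      nP : (Vertex petersen → ℚ) → Vertex petersen → ℚ
      nP = HittingTimes.neighbourSum petersen
      A₀ A₂ A₅ : ℚ
      A₀ = A ⊕ (⊖ c) ⊗ (ℕ→ℚ 3 ⊗ Γ₀ (r x))
      A₂ = (⊖ c) ⊗ Γ₂ (r x)
      A₅ = (⊖ c) ⊗ Γ₅ (r x)
      regroup : ∀ e₂ e₅ → 1ℚ ⊗ A ⊕ (⊖ c) ⊗ (ℕ→ℚ 3 ⊗ Γ₀ (r x) ⊕ 1ℚ ⊗ (e₂ ⊗ Γ₂ (r x) ⊕ e₅ ⊗ Γ₅ (r x))) ≡
        A₀ ⊗ 1ℚ ⊕ 1ℚ ⊗ (A₂ ⊗ e₂ ⊕ A₅ ⊗ e₅)
      regroup e₂ e₅ = solve 7 (λ A c g₀ g₂ g₅ e₂ e₅ →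
        con 1ℚ :* A :+ (:- c) :* (num 3 :* g₀ :+ con 1ℚ :* (e₂ :* g₂ :+ e₅ :* g₅)) :=
        (A :+ (:- c) :* (num 3 :* g₀)) :* con 1ℚ :+ con 1ℚ :* (((:- c) :* g₂) :* e₂ :+ ((:- c) :* g₅) :* e₅))
        refl A c (Γ₀ (r x)) (Γ₂ (r x)) (Γ₅ (r x)) e₂ e₅

    productTime-target : productTime (v , a) ≡ 0ℚ
    productTime-target = begin
      productTime (v , a)
        ≈⟨ cong (λ y → 1ℚ ⊗ A ⊕ (⊖ c) ⊗ (ℕ→ℚ 3 ⊗ Γ₀ y ⊕ 1ℚ ⊗ (E₂ a a ⊗ Γ₂ y ⊕ E₅ a a ⊗ Γ₅ y))) (reflect-self v) ⟩
      1ℚ ⊗ A ⊕ (⊖ c) ⊗ (ℕ→ℚ 3 ⊗ Γ₀ 0ᶠ ⊕ 1ℚ ⊗ (E₂ a a ⊗ Γ₂ 0ᶠ ⊕ E₅ a a ⊗ Γ₅ 0ᶠ))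
        ≈⟨ cong₂ (λ p q → 1ℚ ⊗ A ⊕ (⊖ c) ⊗ (ℕ→ℚ 3 ⊗ Γ₀ 0ᶠ ⊕ 1ℚ ⊗ (p ⊗ Γ₂ 0ᶠ ⊕ q ⊗ Γ₅ 0ᶠ))) (E₂-diagonal a) (E₅-diagonal a) ⟩
      1ℚ ⊗ A ⊕ (⊖ c) ⊗ (ℕ→ℚ 3 ⊗ Γ₀ 0ᶠ ⊕ 1ℚ ⊗ (ℕ→ℚ 15 ⊗ Γ₂ 0ᶠ ⊕ ℕ→ℚ 12 ⊗ Γ₅ 0ᶠ))
        ≈⟨ solve 4 (λ c p q s → con 1ℚ :* (c :* (p :+ (q :+ s))) :+ (:- c) :* (p :+ con 1ℚ :* (q :+ s)) := con 0ℚ)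
             refl c (ℕ→ℚ 3 ⊗ Γ₀ 0ᶠ) (ℕ→ℚ 15 ⊗ Γ₂ 0ᶠ) (ℕ→ℚ 12 ⊗ Γ₅ 0ᶠ) ⟩
      0ℚ ∎

    startTime : ℚ
    startTime = c ⊗ (ℕ→ℚ 3 ⊗ (Γ₀ 0ᶠ ⊝ Γ₀ v) ⊕ (ℕ→ℚ 15 ⊗ (Γ₂ 0ᶠ ⊝ Γ₂ v) ⊕ ℕ→ℚ 12 ⊗ (Γ₅ 0ᶠ ⊝ Γ₅ v)))

    productTime-start : productTime (0ᶠ , a) ≡ startTime
    productTime-start = begin
      productTime (0ᶠ , a)
        ≈⟨ cong (λ y → 1ℚ ⊗ A ⊕ (⊖ c) ⊗ (ℕ→ℚ 3 ⊗ Γ₀ y ⊕ 1ℚ ⊗ (E₂ a a ⊗ Γ₂ y ⊕ E₅ a a ⊗ Γ₅ y))) (reflect-0 v) ⟩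
      1ℚ ⊗ A ⊕ (⊖ c) ⊗ (ℕ→ℚ 3 ⊗ Γ₀ v ⊕ 1ℚ ⊗ (E₂ a a ⊗ Γ₂ v ⊕ E₅ a a ⊗ Γ₅ v))
        ≈⟨ cong₂ (λ p q → 1ℚ ⊗ A ⊕ (⊖ c) ⊗ (ℕ→ℚ 3 ⊗ Γ₀ v ⊕ 1ℚ ⊗ (p ⊗ Γ₂ v ⊕ q ⊗ Γ₅ v))) (E₂-diagonal a) (E₅-diagonal a) ⟩
      1ℚ ⊗ A ⊕ (⊖ c) ⊗ (ℕ→ℚ 3 ⊗ Γ₀ v ⊕ 1ℚ ⊗ (ℕ→ℚ 15 ⊗ Γ₂ v ⊕ ℕ→ℚ 12 ⊗ Γ₅ v))
        ≈⟨ solve 7 (λ c p q s p′ q′ s′ →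
             con 1ℚ :* (c :* (num 3 :* p :+ (num 15 :* q :+ num 12 :* s))) :+
             (:- c) :* (num 3 :* p′ :+ con 1ℚ :* (num 15 :* q′ :+ num 12 :* s′)) :=
             c :* (num 3 :* (p :- p′) :+ (num 15 :* (q :- q′) :+ num 12 :* (s :- s′))))
             refl c (Γ₀ 0ᶠ) (Γ₂ 0ᶠ) (Γ₅ 0ᶠ) (Γ₀ v) (Γ₂ v) (Γ₅ v) ⟩
      startTime ∎

    module _ (isGreen₀ : IsGreen₀) (isGreen₂ : ∀ x → Lap k (ℕ→ℚ 2) Γ₂ x ≡ δ 0ᶠ x)
      (isGreen₅ : ∀ x → Lap k (ℕ→ℚ 5) Γ₅ x ≡ δ 0ᶠ x) where

      -- On each mode the Petersen Laplacian acts as its eigenvalue, which supplies the masses 2 and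
      -- 5 missing from Λ Γ₂ and Λ Γ₅. All three modes then carry the same point source on the
      -- cycle, so their weights can be added.
      productTime-Laplacian : ∀ x b → 2k+3 ⊗ productTime (x , b) ⊝ HittingTimes.neighbourSum Y productTime (x , b) ≡
        t ⊗ (ℕ→ℚ 3 ⊝ ℕ→ℚ N ⊗ ((ℕ→ℚ 3 ⊕ (E₂ a b ⊕ E₅ a b)) ⊗ δ 0ᶠ (r x)))
      productTime-Laplacian x b = begin
        2k+3 ⊗ g ⊝ HittingTimes.neighbourSum Y productTime (x , b)
          ≈⟨ cong₂ (λ d s → d ⊗ g ⊝ s) (ℕ→ℚ-+ (2 ℕ.* k) 3)
               (neighbourSum-□ (cyclePower N k 2k<N) petersen productTime x b) ⟩
        (2k ⊕ ℕ→ℚ 3) ⊗ g ⊝ (s₁ ⊕ s₂)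
          ≈⟨ solve 5 (λ d e g p q → (d :+ e) :* g :- (p :+ q) := (d :* g :- p) :+ (e :* g :- q)) refl 2k (ℕ→ℚ 3) g s₁ s₂ ⟩
        (2k ⊗ g ⊝ s₁) ⊕ (ℕ→ℚ 3 ⊗ g ⊝ s₂)
          ≈⟨ cong₂ _⊕_ (along-cycle x b) (along-petersen x b) ⟩
        (⊖ c) ⊗ (ℕ→ℚ 3 ⊗ Lap k 0ℚ Γ₀ (r x) ⊕ (E₂ a b ⊗ Lap k 0ℚ Γ₂ (r x) ⊕ E₅ a b ⊗ Lap k 0ℚ Γ₅ (r x))) ⊕
        (⊖ c) ⊗ (ℕ→ℚ 2 ⊗ (E₂ a b ⊗ Γ₂ (r x)) ⊕ ℕ→ℚ 5 ⊗ (E₅ a b ⊗ Γ₅ (r x)))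
          ≈⟨ solve 9 (λ n t l₀ l₂ l₅ e₂ e₅ g₂ g₅ →
               (:- (n :* t)) :* (num 3 :* l₀ :+ (e₂ :* l₂ :+ e₅ :* l₅)) :+
               (:- (n :* t)) :* (num 2 :* (e₂ :* g₂) :+ num 5 :* (e₅ :* g₅)) :=
               (:- t) :* (num 3 :* (n :* l₀) :+
                 n :* (e₂ :* (l₂ :+ num 2 :* g₂) :+ e₅ :* (l₅ :+ num 5 :* g₅))))
               refl (ℕ→ℚ N) t (Lap k 0ℚ Γ₀ (r x)) (Lap k 0ℚ Γ₂ (r x)) (Lap k 0ℚ Γ₅ (r x)) (E₂ a b) (E₅ a b)
               (Γ₂ (r x)) (Γ₅ (r x)) ⟩
        (⊖ t) ⊗ (ℕ→ℚ 3 ⊗ (ℕ→ℚ N ⊗ Lap k 0ℚ Γ₀ (r x)) ⊕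
          ℕ→ℚ N ⊗ (E₂ a b ⊗ (Lap k 0ℚ Γ₂ (r x) ⊕ ℕ→ℚ 2 ⊗ Γ₂ (r x)) ⊕ E₅ a b ⊗ (Lap k 0ℚ Γ₅ (r x) ⊕ ℕ→ℚ 5 ⊗ Γ₅ (r x))))
          ≈⟨ cong₂ (λ p q → (⊖ t) ⊗ (ℕ→ℚ 3 ⊗ p ⊕ ℕ→ℚ N ⊗ q)) (isGreen₀ (r x))
               (cong₂ (λ p q → E₂ a b ⊗ p ⊕ E₅ a b ⊗ q)
                 (trans (sym (Lap-mass (ℕ→ℚ 2) Γ₂ (r x))) (isGreen₂ (r x)))
                 (trans (sym (Lap-mass (ℕ→ℚ 5) Γ₅ (r x))) (isGreen₅ (r x)))) ⟩
        (⊖ t) ⊗ (ℕ→ℚ 3 ⊗ (ℕ→ℚ N ⊗ δ 0ᶠ (r x) ⊝ 1ℚ) ⊕ ℕ→ℚ N ⊗ (E₂ a b ⊗ δ 0ᶠ (r x) ⊕ E₅ a b ⊗ δ 0ᶠ (r x)))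
          ≈⟨ solve 5 (λ n t d e₂ e₅ →
               (:- t) :* (num 3 :* (n :* d :- con 1ℚ) :+ n :* (e₂ :* d :+ e₅ :* d)) :=
               t :* (num 3 :- n :* ((num 3 :+ (e₂ :+ e₅)) :* d)))
               refl (ℕ→ℚ N) t (δ 0ᶠ (r x)) (E₂ a b) (E₅ a b) ⟩
        t ⊗ (ℕ→ℚ 3 ⊝ ℕ→ℚ N ⊗ ((ℕ→ℚ 3 ⊕ (E₂ a b ⊕ E₅ a b)) ⊗ δ 0ᶠ (r x))) ∎
        where
        g s₁ s₂ : ℚ
        g  = productTime (x , b)
        s₁ = HittingTimes.neighbourSum (cyclePower N k 2k<N) (λ y → productTime (y , b)) x
        s₂ = HittingTimes.neighbourSum petersen (λ b → productTime (x , b)) b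

      -- If b = a, the cycle coordinate differs from `v` and δ vanishes; otherwise the first factor
      -- is an off-diagonal entry of the scaled identity.
      off-target : ∀ x b → (x , b) ≢ (v , a) → (ℕ→ℚ 3 ⊕ (E₂ a b ⊕ E₅ a b)) ⊗ δ 0ᶠ (r x) ≡ 0ℚ
      off-target x b ne with Graph._≟ᵛ_ petersen a b
      ... | yes a≡b = trans (cong ((ℕ→ℚ 3 ⊕ (E₂ a b ⊕ E₅ a b)) ⊗_)
          (δ-away λ eq → ne (cong₂ _,_ (r≡0⇒≡v x eq) (≡.sym a≡b))))
        (zeroʳ (ℕ→ℚ 3 ⊕ (E₂ a b ⊕ E₅ a b)))
      ... | no a≢b = trans (cong (_⊗ δ 0ᶠ (r x)) (trans (proj₂ (proj₂ (Petersen.eigen a b)))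
          (cong (if_then ℕ→ℚ 30 else 0ℚ) (dec-false (Graph._≟ᵛ_ petersen a b) a≢b))))
        (zeroˡ (δ 0ᶠ (r x)))

      product-hittingTime : IsHittingTime Y (0ᶠ , a) (v , a) (fromℚ startTime)
      product-hittingTime = subst (λ q → IsHittingTime Y (0ᶠ , a) (v , a) (fromℚ q)) productTime-start
        (HittingTimes.hittingTime-regular Y 2k+3 2k+3≢0 degree (v , a) productTime productTime-target
          (λ (x , b) ne → begin
            2k+3 ⊗ productTime (x , b) ⊝ HittingTimes.neighbourSum Y productTime (x , b)
              ≈⟨ productTime-Laplacian x b ⟩
            t ⊗ (ℕ→ℚ 3 ⊝ ℕ→ℚ N ⊗ ((ℕ→ℚ 3 ⊕ (E₂ a b ⊕ E₅ a b)) ⊗ δ 0ᶠ (r x)))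
              ≈⟨ cong (λ q → t ⊗ (ℕ→ℚ 3 ⊝ ℕ→ℚ N ⊗ q)) (off-target x b ne) ⟩
            t ⊗ (ℕ→ℚ 3 ⊝ ℕ→ℚ N ⊗ 0ℚ)
              ≈⟨ solve 2 (λ d n → (d :* con (recip (ℕ→ℚ 3))) :* (num 3 :- n :* con 0ℚ) := d) refl 2k+3 (ℕ→ℚ N) ⟩
            2k+3 ∎)
          (0ᶠ , a))
        where
        2k+3≢0 : 2k+3 ≢ 0ℚ
        2k+3≢0 = ℕ→ℚ≢0 (2 ℕ.* k ℕ.+ 3) {{ℕ.>-nonZero (ℕ.≤-trans (ℕ.s≤s ℕ.z≤n) (ℕ.m≤n+m 3 (2 ℕ.* k)))}}

-- Embeddings of ℚ, and apartness from zero

module ℝᶠ = CommutativeRing ℝ-commutativeRing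
module ℂᶠ = CommutativeRing ℂ-commutativeRing

pointwise : ∀ {x y} → (∀ n → seq x n ≡ seq y n) → x ≃ʳ y
pointwise {x} {y} eq .null ε 0<ε = 0 , λ n _ →
  subst (λ q → ℚ.∣ q ∣ ℚ.< ε) (≡.sym (≡.trans (cong (ℚ._- seq y n) (eq n)) (ℚ.+-inverseʳ (seq y n)))) 0<ε

ℝ-scalars : ScalarMap ℝ-commutativeRing
ℝ-scalars = record
  { ⟦_⟧    = fromℚ
  ; +-homo = λ p q → pointwise λ _ → refl
  ; *-homo = λ p q → pointwise λ _ → refl
  ; -‿homo = λ p → pointwise λ _ → refl
  ; 0-homo = ℝᶠ.refl
  ; 1-homo = ℝᶠ.refl
  }

ℂ-scalars : ScalarMap ℂ-commutativeRing
ℂ-scalars = record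
  { ⟦_⟧    = ofℚ
  ; +-homo = λ p q → pointwise (λ _ → refl) , pointwise (λ _ → refl)
  ; *-homo = λ p q → pointwise (λ _ → ≡.sym (ℚ.+-identityʳ (p ℚ.* q))) ,
      pointwise (λ _ → ≡.sym (≡.trans (cong₂ ℚ._+_ (ℚ.*-zeroʳ p) (ℚ.*-zeroˡ q)) (ℚ.+-identityʳ 0ℚ)))
  ; -‿homo = λ p → pointwise (λ _ → refl) , pointwise (λ _ → refl)
  ; 0-homo = ℂᶠ.refl
  ; 1-homo = ℂᶠ.refl
  }

module Apartness where

  open ℚ-Algebra using (solve; _:+_; _:*_; _:-_; _:=_; con)

  ∣p-0∣ : ∀ p → ℚ.∣ p ℚ.- 0ℚ ∣ ≡ ℚ.∣ p ∣
  ∣p-0∣ p = cong ℚ.∣_∣ (ℚ.+-identityʳ p)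

  large⇒#0 : ∀ x δ → 0ℚ ℚ.< δ → ∀ M → (∀ n → M ℕ.≤ n → δ ℚ.≤ ℚ.∣ seq x n ∣) → x #ʳ 0ʳ
  large⇒#0 x δ 0<δ M large = δ , 0<δ , M , λ n M≤n →
    subst (δ ℚ.≤_) (≡.sym (∣p-0∣ (seq x n))) (large n M≤n)

  #0⇒large : ∀ x → x #ʳ 0ʳ → ∃ λ δ → 0ℚ ℚ.< δ × ∃ λ M → ∀ n → M ℕ.≤ n → δ ℚ.≤ ℚ.∣ seq x n ∣
  #0⇒large x (δ , 0<δ , M , large) = δ , 0<δ , M , λ n M≤n → subst (δ ℚ.≤_) (∣p-0∣ (seq x n)) (large n M≤n)

  half half-half : ℚ → ℚ
  half δ      = ½ ℚ.* δ
  half-half δ = half (half δ)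

  0<half : ∀ {δ} → 0ℚ ℚ.< δ → 0ℚ ℚ.< half δ
  0<half {δ} 0<δ = subst (ℚ._< half δ) (ℚ.*-zeroʳ ½) (ℚ.*-monoʳ-<-pos ½ 0<δ)

  triangle : ∀ p q {δ} → δ ℚ.≤ ℚ.∣ p ∣ → ℚ.∣ p ℚ.- q ∣ ℚ.≤ half δ → half δ ℚ.≤ ℚ.∣ q ∣
  triangle p q {δ} δ≤p p-q≤ = 0≤⇒≤ _
    (solve 4 (λ d p q e → q :- con ½ :* d := (((e :+ q) :- p) :+ (p :- d)) :+ (con ½ :* d :- e))
      refl δ ℚ.∣ p ∣ ℚ.∣ q ∣ ℚ.∣ p ℚ.- q ∣)
    (0≤-+ (0≤-+ (≤⇒0≤ (ℚ.≤-trans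
        (ℚ.≤-reflexive (cong ℚ.∣_∣ (solve 2 (λ p q → p := (p :- q) :+ q) refl p q)))
        (ℚ.∣p+q∣≤∣p∣+∣q∣ (p ℚ.- q) q)))
      (≤⇒0≤ δ≤p)) (≤⇒0≤ p-q≤))

  #0-resp-≃ : ∀ {x y} → x ≃ʳ y → x #ʳ 0ʳ → y #ʳ 0ʳ
  #0-resp-≃ {x} {y} x≃y x#0 with #0⇒large x x#0
  ... | δ , 0<δ , M , large with null x≃y (half δ) (0<half 0<δ)
  ... | M′ , close = large⇒#0 y (half δ) (0<half 0<δ) (M ℕ.⊔ M′) λ n L≤n →
    triangle (seq x n) (seq y n) (large n (ℕ.m⊔n≤o⇒m≤o M M′ L≤n)) (ℚ.<⇒≤ (close n (ℕ.m⊔n≤o⇒n≤o M M′ L≤n)))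

  0<recip : ∀ {q} → 0ℚ ℚ.< q → 0ℚ ℚ.< recip q
  0<recip {q} 0<q with q ℚ.≟ 0ℚ
  ... | yes q≡0 = contradiction (≡.sym q≡0) (ℚ.<⇒≢ 0<q)
  ... | no  _   = ℚ.positive⁻¹ _ {{ℚ.1/pos⇒pos q {{ℚ.positive 0<q}}}}

  bounded : ∀ x → ∃ λ B → 0ℚ ℚ.< B × ∃ λ M → ∀ n → M ℕ.≤ n → ℚ.∣ seq x n ∣ ℚ.≤ B
  bounded x with cauchy x 1ℚ (ℚ.positive⁻¹ 1ℚ)
  ... | M , close = ℚ.∣ seq x M ∣ ℚ.+ 1ℚ , ℚ.+-mono-≤-< (ℚ.0≤∣p∣ (seq x M)) (ℚ.positive⁻¹ 1ℚ) , M , λ n M≤n →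
    ℚ.≤-trans (ℚ.≤-reflexive (cong ℚ.∣_∣ (solve 2 (λ a b → b := a :+ (b :- a)) refl (seq x M) (seq x n))))
      (ℚ.≤-trans (ℚ.∣p+q∣≤∣p∣+∣q∣ (seq x M) (seq x n ℚ.- seq x M))
        (ℚ.+-monoʳ-≤ ℚ.∣ seq x M ∣ (ℚ.<⇒≤ (close n M M≤n ℕ.≤-refl))))

  Large BoundedBy : ℚ → (ℕ → ℚ) → Set
  Large     δ a = ∃ λ M → ∀ n → M ℕ.≤ n → δ ℚ.≤ ℚ.∣ a n ∣
  BoundedBy B a = ∃ λ M → ∀ n → M ℕ.≤ n → ℚ.∣ a n ∣ ℚ.≤ B

  ≤-*⇒recip-≤ : ∀ δ a b B → 0ℚ ℚ.< B → 0ℚ ℚ.≤ a → δ ℚ.≤ a ℚ.* b → b ℚ.≤ B → δ ℚ.* recip B ℚ.≤ a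
  ≤-*⇒recip-≤ δ a b B 0<B 0≤a δ≤ab b≤B =
    ℚ.≤-trans (ℚ.*-monoʳ-≤-nonNeg (recip B) {{ℚ.nonNegative (0≤recip {B} (ℚ.<⇒≤ 0<B))}}
        (ℚ.≤-trans δ≤ab (ℚ.*-monoˡ-≤-nonNeg a {{ℚ.nonNegative 0≤a}} b≤B)))
      (ℚ.≤-reflexive (≡.trans (ℚ.*-assoc a B (recip B)) (≡.trans
        (cong (a ℚ.*_) (recip-inverse {B} λ B≡0 → ℚ.<-irrefl (≡.sym B≡0) 0<B)) (ℚ.*-identityʳ a))))

  -- If eventually |xy| ≥ δ and |y| ≤ B, then |x| ≥ δ/B; Cauchy sequences are bounded.
  #0-factorˡ : ∀ x y → (x *ʳ y) #ʳ 0ʳ → x #ʳ 0ʳ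
  #0-factorˡ x y xy#0 = combine (#0⇒large (x *ʳ y) xy#0) (bounded y)
    where
    combine : (∃ λ δ → 0ℚ ℚ.< δ × Large δ (λ n → seq x n ℚ.* seq y n)) → (∃ λ B → 0ℚ ℚ.< B × BoundedBy B (seq y)) →
      x #ʳ 0ʳ
    combine (δ , 0<δ , M , large) (B , 0<B , M′ , ≤B) =
      large⇒#0 x (δ ℚ.* recip B) (subst (ℚ._< δ ℚ.* recip B) (ℚ.*-zeroʳ δ)
        (ℚ.*-monoʳ-<-pos δ {{ℚ.positive 0<δ}} (0<recip {B} 0<B))) (M ℕ.⊔ M′) λ n L≤n →
        ≤-*⇒recip-≤ δ ℚ.∣ seq x n ∣ ℚ.∣ seq y n ∣ B 0<B (ℚ.0≤∣p∣ (seq x n))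
          (ℚ.≤-trans (large n (ℕ.m⊔n≤o⇒m≤o M M′ L≤n)) (ℚ.≤-reflexive (ℚ.∣p*q∣≡∣p∣*∣q∣ (seq x n) (seq y n))))
          (≤B n (ℕ.m⊔n≤o⇒n≤o M M′ L≤n))

  #0-neg : ∀ x → (-ʳ x) #ʳ 0ʳ → x #ʳ 0ʳ
  #0-neg x -x#0 with #0⇒large (-ʳ x) -x#0
  ... | δ , 0<δ , M , large = large⇒#0 x δ 0<δ M λ n M≤n → subst (δ ℚ.≤_) (ℚ.∣-p∣≡∣p∣ (seq x n)) (large n M≤n)

  large-once⇒#0 : ∀ x {δ} → 0ℚ ℚ.< δ → ∀ M → (∀ m n → M ℕ.≤ m → M ℕ.≤ n → ℚ.∣ seq x m ℚ.- seq x n ∣ ℚ.< half δ) →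
    ∀ L → M ℕ.≤ L → δ ℚ.≤ ℚ.∣ seq x L ∣ → x #ʳ 0ʳ
  large-once⇒#0 x {δ} 0<δ M close L M≤L large = large⇒#0 x (half δ) (0<half 0<δ) M λ n M≤n →
    triangle (seq x L) (seq x n) large (ℚ.<⇒≤ (close L n M≤L M≤n))

  CloseBy : ℚ → (ℕ → ℚ) → Set
  CloseBy ε a = ∃ λ M → ∀ m n → M ℕ.≤ m → M ℕ.≤ n → ℚ.∣ a m ℚ.- a n ∣ ℚ.< ε

  -- The choice is made constructively by one comparison of rationals at a late index `L`: one of
  -- the terms has size at least δ/2 there, and as each varies by less than δ/4 from then on, it
  -- stays above δ/4.
  #0-+ : ∀ x y → (x +ʳ y) #ʳ 0ʳ → x #ʳ 0ʳ ⊎ y #ʳ 0ʳ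
  #0-+ x y x+y#0 = let (δ , 0<δ , large) = #0⇒large (x +ʳ y) x+y#0 in
    combine δ 0<δ large (cauchy x (half-half δ) (0<half (0<half 0<δ))) (cauchy y (half-half δ) (0<half (0<half 0<δ)))
    where
    combine : ∀ δ → 0ℚ ℚ.< δ → Large δ (λ n → seq x n ℚ.+ seq y n) →
      CloseBy (half-half δ) (seq x) → CloseBy (half-half δ) (seq y) → x #ʳ 0ʳ ⊎ y #ʳ 0ʳ
    combine δ 0<δ (M , large) (M₁ , close₁) (M₂ , close₂) = decide (ℚ.≤-total (half δ) ℚ.∣ seq x L ∣)
      where
      L : ℕ
      L = M ℕ.⊔ (M₁ ℕ.⊔ M₂)
      M₁≤L : M₁ ℕ.≤ L
      M₁≤L = ℕ.≤-trans (ℕ.m≤m⊔n M₁ M₂) (ℕ.m≤n⊔m M (M₁ ℕ.⊔ M₂))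
      M₂≤L : M₂ ℕ.≤ L
      M₂≤L = ℕ.≤-trans (ℕ.m≤n⊔m M₁ M₂) (ℕ.m≤n⊔m M (M₁ ℕ.⊔ M₂))
      decide : half δ ℚ.≤ ℚ.∣ seq x L ∣ ⊎ ℚ.∣ seq x L ∣ ℚ.≤ half δ → x #ʳ 0ʳ ⊎ y #ʳ 0ʳ
      decide (inj₁ x-large) = inj₁ (large-once⇒#0 x (0<half 0<δ) M₁ close₁ L M₁≤L x-large)
      decide (inj₂ x-small) = inj₂ (large-once⇒#0 y (0<half 0<δ) M₂ close₂ L M₂≤L (0≤⇒≤ _
        (solve 3 (λ d a b → b :- con ½ :* d := ((a :+ b) :- d) :+ (con ½ :* d :- a)) refl δ ℚ.∣ seq x L ∣ ℚ.∣ seq y L ∣)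
        (0≤-+ (≤⇒0≤ (ℚ.≤-trans (large L (ℕ.m≤m⊔n M (M₁ ℕ.⊔ M₂))) (ℚ.∣p+q∣≤∣p∣+∣q∣ (seq x L) (seq y L))))
          (≤⇒0≤ x-small))))

  1#0 : 1ʳ #ʳ 0ʳ
  1#0 = large⇒#0 1ʳ 1ℚ (ℚ.positive⁻¹ 1ℚ) 0 λ _ _ → ℚ.≤-refl

  unit⇒#ʳ0 : ∀ x y → (x *ʳ y) ≃ʳ 1ʳ → x #ʳ 0ʳ
  unit⇒#ʳ0 x y xy≃1 = #0-factorˡ x y (#0-resp-≃ (ℝᶠ.sym xy≃1) 1#0)

  -- The real part of `z * w` is a difference of two products, one of which must be apart from 0,
  -- and with it a coordinate of `z`. This turns algebraic inverses into the apartness that division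
  -- requires.
  unit⇒#0 : ∀ z w → (z * w) ≃ 1ᶜ → z # 0ᶜ
  unit⇒#0 z w zw≃1 = [ (λ re#0 → inj₁ (#0-factorˡ (re z) (re w) re#0))
    , (λ im#0 → inj₂ (#0-factorˡ (im z) (im w) (#0-neg (im z *ʳ im w) im#0))) ]′
    (#0-+ (re z *ʳ re w) (-ʳ (im z *ʳ im w)) (#0-resp-≃ (ℝᶠ.sym (re≃ zw≃1)) 1#0))

  #⇒-#ʳ0 : ∀ x y → x #ʳ y → (x -ʳ y) #ʳ 0ʳ
  #⇒-#ʳ0 x y (δ , 0<δ , M , large) = large⇒#0 (x -ʳ y) δ 0<δ M large

  #⇒-#0 : ∀ z w → z # w → (z - w) # 0ᶜ
  #⇒-#0 z w (inj₁ re#) = inj₁ (#⇒-#ʳ0 (re z) (re w) re#)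
  #⇒-#0 z w (inj₂ im#) = inj₂ (#⇒-#ʳ0 (im z) (im w) im#)

-- Polynomials acting through linear operators

module ℂ-Algebra = Algebraic ℂ-commutativeRing ℂ-scalars

-- Horner's scheme for (p - p(z)) / (x - z). The list keeps the length of `p` and so ends in a zero
-- coefficient.
quotient : Poly → ℂ → Poly
quotient []      z = []
quotient (a ∷ p) z = eval p z ∷ quotient p z

-- The lists T n ∘ₚ X/2 have trailing zeros, so their length does not bound the degree.
Deg< : ℕ → Poly → Set
Deg< n       []      = ⊤
Deg< zero    (a ∷ p) = a ≃ 0ᶜ × Deg< zero p
Deg< (suc n) (a ∷ p) = Deg< n p

module PolynomialAction {I : Set} where

  open ℂ-Algebra using (≈-refl; sym; trans; +-cong; +-congˡ; +-congʳ; *-cong; *-congˡ; *-congʳ; -‿cong;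
    +-identityˡ; +-identityʳ; *-identityˡ; zeroˡ; zeroʳ; solve; _:+_; _:*_; _:-_; :-_; _:=_; con; num)

  Operator : Set
  Operator = (I → ℂ) → I → ℂ

  record Linear (S : Operator) : Set where
    field
      S-cong   : ∀ {f g} → (∀ i → f i ≃ g i) → ∀ i → S f i ≃ S g i
      S-linear : ∀ a b f g i → S (λ i → a * f i + b * g i) i ≃ (a * S f i + b * S g i)

    S-zero : ∀ {f} → (∀ i → f i ≃ 0ᶜ) → ∀ i → S f i ≃ 0ᶜ
    S-zero {f} f≃0 i = trans
      (S-cong {f} {λ i → 0ᶜ * f i + 0ᶜ * f i} (λ i → trans (f≃0 i)
        (sym (trans (+-cong (zeroˡ (f i)) (zeroˡ (f i))) (+-identityˡ 0ᶜ)))) i)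
      (trans (S-linear 0ᶜ 0ᶜ f f i) (trans (+-cong (zeroˡ (S f i)) (zeroˡ (S f i))) (+-identityˡ 0ᶜ)))

    S-+ : ∀ f g i → S (λ i → f i + g i) i ≃ (S f i + S g i)
    S-+ f g i = trans
      (S-cong {λ i → f i + g i} {λ i → 1ᶜ * f i + 1ᶜ * g i}
        (λ i → +-cong (sym (*-identityˡ (f i))) (sym (*-identityˡ (g i)))) i)
      (trans (S-linear 1ᶜ 1ᶜ f g i) (+-cong (*-identityˡ (S f i)) (*-identityˡ (S g i))))

    S-* : ∀ a f i → S (λ i → a * f i) i ≃ (a * S f i)
    S-* a f i = trans
      (S-cong {λ i → a * f i} {λ i → a * f i + 0ᶜ * f i}
        (λ i → sym (trans (+-congˡ (zeroˡ (f i))) (+-identityʳ (a * f i)))) i)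
      (trans (S-linear a 0ᶜ f f i) (trans (+-congˡ (zeroˡ (S f i))) (+-identityʳ (a * S f i))))

  -- p(S) f in Horner form. Multiplication by a number on functions of a single point gives back
  -- `eval`, so identities proved for `act` hold for values as well.
  act : Operator → Poly → Operator
  act S []      f i = 0ᶜ
  act S (a ∷ p) f i = a * f i + S (act S p f) i

  module _ {S : Operator} (S-Linear : Linear S) where

    open Linear S-Linear

    act-cong : ∀ p {f g} → (∀ i → f i ≃ g i) → ∀ i → act S p f i ≃ act S p g i
    act-cong []      eq i = ≈-refl
    act-cong (a ∷ p) eq i = +-cong (*-congˡ (eq i)) (S-cong (act-cong p eq) i)

    act-linear : ∀ p a b f g i → act S p (λ i → a * f i + b * g i) i ≃ (a * act S p f i + b * act S p g i)
    act-linear [] a b f g i = sym (trans (+-cong (zeroʳ a) (zeroʳ b)) (+-identityˡ 0ᶜ))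
    act-linear (c ∷ p) a b f g i = trans
      (+-congˡ (trans (S-cong (act-linear p a b f g) i) (S-linear a b (act S p f) (act S p g) i)))
      (solve 7 (λ a b c f g s t → c :* (a :* f :+ b :* g) :+ (a :* s :+ b :* t) :=
        a :* (c :* f :+ s) :+ b :* (c :* g :+ t)) ≈-refl a b c (f i) (g i) (S (act S p f) i) (S (act S p g) i))

    act-Linear : ∀ p → Linear (act S p)
    act-Linear p = record { S-cong = act-cong p ; S-linear = act-linear p }

    act-+ : ∀ p q f i → act S (p +ₚ q) f i ≃ (act S p f i + act S q f i)
    act-+ []      q       f i = sym (+-identityˡ (act S q f i))
    act-+ (a ∷ p) []      f i = sym (+-identityʳ (act S (a ∷ p) f i))
    act-+ (a ∷ p) (b ∷ q) f i = trans
      (+-congˡ (trans (S-cong (act-+ p q f) i) (S-+ (act S p f) (act S q f) i)))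
      (solve 5 (λ a b f s t → (a :+ b) :* f :+ (s :+ t) := (a :* f :+ s) :+ (b :* f :+ t)) ≈-refl
        a b (f i) (S (act S p f) i) (S (act S q f) i))

    act-· : ∀ c p f i → act S (c ·ₚ p) f i ≃ (c * act S p f i)
    act-· c []      f i = sym (zeroʳ c)
    act-· c (a ∷ p) f i = trans
      (+-congˡ (trans (S-cong (act-· c p f) i) (S-* c (act S p f) i)))
      (solve 4 (λ c a f s → (c :* a) :* f :+ c :* s := c :* (a :* f :+ s)) ≈-refl c a (f i) (S (act S p f) i))

    act-neg : ∀ p f i → act S (-ₚ p) f i ≃ (- act S p f i)
    act-neg []      f i = sym (trans (sym (+-identityˡ (- 0ᶜ))) (ℂ-Algebra.-‿inverseʳ 0ᶜ))
    act-neg (a ∷ p) f i = trans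
      (+-congˡ (trans (S-cong {g = λ i → (- 1ᶜ) * act S p f i} (λ i → trans (act-neg p f i) (negate (act S p f i))) i)
        (trans (S-* (- 1ᶜ) (act S p f) i) (sym (negate (S (act S p f) i))))))
      (solve 3 (λ a f s → (:- a) :* f :+ (:- s) := :- (a :* f :+ s)) ≈-refl a (f i) (S (act S p f) i))
      where
      negate : ∀ z → (- z) ≃ ((- 1ᶜ) * z)
      negate z = solve 1 (λ z → :- z := (:- con 1ℚ) :* z) ≈-refl z

    act-shift : ∀ p f i → act S (0ᶜ ∷ p) f i ≃ S (act S p f) i
    act-shift p f i = trans (+-congʳ (zeroˡ (f i))) (+-identityˡ (S (act S p f) i))

    act-* : ∀ p q f i → act S (p *ₚ q) f i ≃ act S p (act S q f) i
    act-* []      q f i = ≈-refl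
    act-* (a ∷ p) q f i = trans (act-+ (a ·ₚ q) (0ᶜ ∷ p *ₚ q) f i)
      (+-cong (act-· a q f i) (trans (act-shift (p *ₚ q) f i) (S-cong (act-* p q f) i)))

    act-const : ∀ a f i → act S (a ∷ []) f i ≃ (a * f i)
    act-const a f i = trans (+-congˡ (S-zero (λ _ → ≈-refl) i)) (+-identityʳ (a * f i))

    act-∘ : ∀ p q f i → act S (p ∘ₚ q) f i ≃ act (act S q) p f i
    act-∘ []      q f i = ≈-refl
    act-∘ (a ∷ p) q f i = trans (act-+ (a ∷ []) (q *ₚ (p ∘ₚ q)) f i)
      (+-cong (act-const a f i) (trans (act-* q (p ∘ₚ q) f i) (act-cong q (act-∘ p q f) i)))

    act-X/2 : ∀ f i → act S X/2 f i ≃ (ofℚ ½ * S f i)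
    act-X/2 f i = trans (act-shift (ofℚ ½ ∷ []) f i)
      (trans (S-cong (act-const (ofℚ ½) f) i) (S-* (ofℚ ½) f i))

  -- 2 T_s(S/2) f satisfies the recursion of the sequence S^s f + S^{-s} f.
  module Chebyshev {S : Operator} (S-Linear : Linear S) (f : I → ℂ) (t : ℕ → I → ℂ)
    (t-0 : ∀ i → t 0 i ≃ (ofℕ 2 * f i)) (t-1 : ∀ i → t 1 i ≃ S f i)
    (t-step : ∀ n i → S (t (suc n)) i ≃ (t (suc (suc n)) i + t n i)) where

    open ℂ-Algebra using (begin_; step-≈-⟩; step-≈-⟨; _∎)

    S/2 : Operator
    S/2 = act S X/2

    S/2-Linear : Linear S/2
    S/2-Linear = act-Linear S-Linear X/2

    open Linear S/2-Linear using () renaming (S-cong to S/2-cong; S-* to S/2-*)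

    act-T : ∀ n i → act S/2 (T n) f i ≃ (ofℚ ½ * t n i)
    act-T zero i = begin
      act S/2 (1ᶜ ∷ []) f i       ≈⟨ act-const S/2-Linear 1ᶜ f i ⟩
      1ᶜ * f i                    ≈⟨ solve 1 (λ f → con 1ℚ :* f := con ½ :* (num 2 :* f)) ≈-refl (f i) ⟩
      ofℚ ½ * (ofℕ 2 * f i) ≈⟨ *-congˡ (t-0 i) ⟨
      ofℚ ½ * t 0 i ∎
    act-T (suc zero) i = begin
      act S/2 (0ᶜ ∷ 1ᶜ ∷ []) f i  ≈⟨ act-shift S/2-Linear (1ᶜ ∷ []) f i ⟩
      S/2 (act S/2 (1ᶜ ∷ []) f) i ≈⟨ S/2-cong (λ i → trans (act-const S/2-Linear 1ᶜ f i) (*-identityˡ (f i))) i ⟩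
      S/2 f i                     ≈⟨ act-X/2 S-Linear f i ⟩
      ofℚ ½ * S f i               ≈⟨ *-congˡ (t-1 i) ⟨
      ofℚ ½ * t 1 i ∎
    act-T (suc (suc n)) i = begin
      act S/2 (2X *ₚ T (suc n) +ₚ (-ₚ T n)) f i
        ≈⟨ act-+ S/2-Linear (2X *ₚ T (suc n)) (-ₚ T n) f i ⟩
      act S/2 (2X *ₚ T (suc n)) f i + act S/2 (-ₚ T n) f i
        ≈⟨ +-cong (act-* S/2-Linear 2X (T (suc n)) f i)
             (trans (act-neg S/2-Linear (T n) f i) (-‿cong (act-T n i))) ⟩
      act S/2 2X (act S/2 (T (suc n)) f) i - ofℚ ½ * t n i
        ≈⟨ +-congʳ (act-cong S/2-Linear 2X (act-T (suc n)) i) ⟩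
      act S/2 2X (λ i → ofℚ ½ * t (suc n) i) i - ofℚ ½ * t n i
        ≈⟨ +-congʳ (trans (act-shift S/2-Linear (ofℕ 2 ∷ []) _ i)
             (trans (S/2-cong (act-const S/2-Linear (ofℕ 2) _) i)
               (trans (S/2-* (ofℕ 2) _ i) (*-congˡ (trans (S/2-* (ofℚ ½) (t (suc n)) i)
                 (*-congˡ (trans (act-X/2 S-Linear (t (suc n)) i) (*-congˡ (t-step n i))))))))) ⟩
      ofℕ 2 * (ofℚ ½ * (ofℚ ½ * (t (suc (suc n)) i + t n i))) - ofℚ ½ * t n i
        ≈⟨ solve 2 (λ a b → num 2 :* (con ½ :* (con ½ :* (a :+ b))) :- con ½ :* b := con ½ :* a)
             ≈-refl (t (suc (suc n)) i) (t n i) ⟩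
      ofℚ ½ * t (suc (suc n)) i ∎
      where
      2X : Poly
      2X = 0ᶜ ∷ ofℕ 2 ∷ []

    Σt : ℕ → I → ℂ
    Σt zero    i = 0ᶜ
    Σt (suc k) i = Σt k i + t (suc k) i

    act-ΣT : ∀ k i → act S (ΣT k) f i ≃ (ofℚ ½ * Σt k i)
    act-ΣT zero    i = sym (zeroʳ (ofℚ ½))
    act-ΣT (suc k) i = begin
      act S (ΣT k +ₚ T (suc k) ∘ₚ X/2) f i
        ≈⟨ act-+ S-Linear (ΣT k) (T (suc k) ∘ₚ X/2) f i ⟩
      act S (ΣT k) f i + act S (T (suc k) ∘ₚ X/2) f i
        ≈⟨ +-cong (act-ΣT k i) (trans (act-∘ S-Linear (T (suc k)) X/2 f i) (act-T (suc k) i)) ⟩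
      ofℚ ½ * Σt k i + ofℚ ½ * t (suc k) i
        ≈⟨ ℂ-Algebra.distribˡ (ofℚ ½) (Σt k i) (t (suc k) i) ⟨
      ofℚ ½ * Σt (suc k) i ∎

    act-D : ∀ k ν i → act S (D k ν) f i ≃ ((ofℕ k + ofℝ ν * ofℚ ½) * f i - ofℚ ½ * Σt k i)
    act-D k ν i = begin
      act S (D k ν) f i
        ≈⟨ act-+ S-Linear ((ofℕ k + ofℝ ν * ofℚ ½) ∷ []) (-ₚ ΣT k) f i ⟩
      act S ((ofℕ k + ofℝ ν * ofℚ ½) ∷ []) f i + act S (-ₚ ΣT k) f i
        ≈⟨ +-cong (act-const S-Linear (ofℕ k + ofℝ ν * ofℚ ½) f i)
             (trans (act-neg S-Linear (ΣT k) f i) (-‿cong (act-ΣT k i))) ⟩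
      (ofℕ k + ofℝ ν * ofℚ ½) * f i - ofℚ ½ * Σt k i ∎

  -- The remainder theorem for operators, p(S) = q(S)(S - z) + p(z). At a root it reduces Λ + ν to
  -- an equation for S - φ.
  act-quotient : ∀ {S} → Linear S → ∀ p z f i →
    act S p f i ≃ (act S (quotient p z) (λ i → S f i - z * f i) i + eval p z * f i)
  act-quotient S-Linear [] z f i = sym (trans (+-congˡ (zeroˡ (f i))) (+-identityˡ 0ᶜ))
  act-quotient {S} S-Linear (a ∷ p) z f i = trans
    (+-congˡ (trans (S-cong (act-quotient S-Linear p z f) i)
      (trans (S-+ (act S (quotient p z) g) (λ i → eval p z * f i) i) (+-congˡ (S-* (eval p z) f i)))))
    (solve 6 (λ a f q e s z → a :* f :+ (q :+ e :* s) := (e :* (s :- z :* f) :+ q) :+ (a :+ z :* e) :* f)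
      ≈-refl a (f i) (S (act S (quotient p z) g) i) (eval p z) (S f i) z)
    where
    open Linear S-Linear
    g : I → ℂ
    g i = S f i - z * f i

  act-Deg<0 : ∀ {S} → Linear S → ∀ p → Deg< 0 p → ∀ f i → act S p f i ≃ 0ᶜ
  act-Deg<0 S-Linear []      _         f i = ≈-refl
  act-Deg<0 S-Linear (a ∷ p) (a≃0 , d) f i = trans
    (+-cong (trans (*-congʳ a≃0) (zeroˡ (f i))) (Linear.S-zero S-Linear (act-Deg<0 S-Linear p d f) i))
    (+-identityˡ 0ᶜ)

-- Degrees, roots and Lagrange interpolation

module Polynomials where

  open ℂ-Algebra
  open PolynomialAction

  scale : ℂ → (⊤ → ℂ) → ⊤ → ℂ
  scale z g i = z * g i

  scale-Linear : ∀ z → Linear (scale z)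
  scale-Linear z = record
    { S-cong   = λ eq i → *-congˡ (eq i)
    ; S-linear = λ a b f g i → solve 5 (λ z a b f g → z :* (a :* f :+ b :* g) := a :* (z :* f) :+ b :* (z :* g))
        ≈-refl z a b (f i) (g i)
    }

  one : ⊤ → ℂ
  one _ = 1ᶜ

  eval-act : ∀ p z → eval p z ≃ act (scale z) p one tt
  eval-act []      z = ≈-refl
  eval-act (a ∷ p) z = +-cong (sym (*-identityʳ a)) (*-congˡ (eval-act p z))

  eval-+ : ∀ p q z → eval (p +ₚ q) z ≃ (eval p z + eval q z)
  eval-+ p q z = trans (eval-act (p +ₚ q) z) (trans (act-+ (scale-Linear z) p q one tt)
    (sym (+-cong (eval-act p z) (eval-act q z))))

  eval-quotient : ∀ p z x → eval p x ≃ ((x - z) * eval (quotient p z) x + eval p z)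
  eval-quotient p z x = begin
    eval p x
      ≈⟨ eval-act p x ⟩
    act (scale x) p one tt
      ≈⟨ act-quotient (scale-Linear x) p z one tt ⟩
    act (scale x) q (λ _ → x * 1ᶜ - z * 1ᶜ) tt + eval p z * 1ᶜ
      ≈⟨ +-cong (act-cong (scale-Linear x) q
           (λ _ → solve 3 (λ x z o → x :* o :- z :* o := (x :- z) :* o) ≈-refl x z 1ᶜ) tt) (*-identityʳ (eval p z)) ⟩
    act (scale x) q (λ i → (x - z) * one i) tt + eval p z
      ≈⟨ +-congʳ (Linear.S-* (act-Linear (scale-Linear x) q) (x - z) one tt) ⟩
    (x - z) * act (scale x) q one tt + eval p z
      ≈⟨ +-congʳ (*-congˡ (eval-act q x)) ⟨
    (x - z) * eval q x + eval p z ∎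
    where
    q : Poly
    q = quotient p z

  -- At `z` itself, Horner's quotient obeys the product-rule recursion (a + xp)′ = p + xp′.
  eval-deriv : ∀ p z → eval (quotient p z) z ≃ eval (deriv p) z
  eval-deriv []      z = ≈-refl
  eval-deriv (a ∷ p) z = sym (trans (eval-+ p (0ᶜ ∷ deriv p) z)
    (+-congˡ (trans (+-identityˡ (z * eval (deriv p) z)) (*-congˡ (sym (eval-deriv p z))))))

  Deg<-+ : ∀ n p q → Deg< n p → Deg< n q → Deg< n (p +ₚ q)
  Deg<-+ n       []      q       dp        dq        = dq
  Deg<-+ n       (a ∷ p) []      dp        dq        = dp
  Deg<-+ zero    (a ∷ p) (b ∷ q) (a≃0 , dp) (b≃0 , dq) =
    trans (+-cong a≃0 b≃0) (+-identityˡ 0ᶜ) , Deg<-+ zero p q dp dq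
  Deg<-+ (suc n) (a ∷ p) (b ∷ q) dp        dq        = Deg<-+ n p q dp dq

  Deg<-· : ∀ n a p → Deg< n p → Deg< n (a ·ₚ p)
  Deg<-· n       a []      _          = tt
  Deg<-· zero    a (b ∷ p) (b≃0 , d)  = trans (*-congˡ b≃0) (zeroʳ a) , Deg<-· zero a p d
  Deg<-· (suc n) a (b ∷ p) d          = Deg<-· n a p d

  Deg<-neg : ∀ n p → Deg< n p → Deg< n (-ₚ p)
  Deg<-neg n       []      _         = tt
  Deg<-neg zero    (b ∷ p) (b≃0 , d) =
    trans (-‿cong b≃0) (trans (sym (+-identityˡ (- 0ᶜ))) (-‿inverseʳ 0ᶜ)) , Deg<-neg zero p d
  Deg<-neg (suc n) (b ∷ p) d         = Deg<-neg n p d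

  Deg<-suc : ∀ n p → Deg< n p → Deg< (suc n) p
  Deg<-suc n       []      _       = tt
  Deg<-suc zero    (a ∷ p) (_ , d) = d
  Deg<-suc (suc n) (a ∷ p) d       = Deg<-suc n p d

  Deg<-0∷[] : ∀ n → Deg< n (0ᶜ ∷ [])
  Deg<-0∷[] zero    = ≈-refl , tt
  Deg<-0∷[] (suc n) = tt

  Deg<0-* : ∀ p q → Deg< 0 q → Deg< 0 (p *ₚ q)
  Deg<0-* []      q d = tt
  Deg<0-* (a ∷ p) q d = Deg<-+ 0 (a ·ₚ q) (0ᶜ ∷ p *ₚ q) (Deg<-· 0 a q d) (≈-refl , Deg<0-* p q d)

  Deg<-*X : ∀ n b q → Deg< n q → Deg< (suc n) ((0ᶜ ∷ b ∷ []) *ₚ q)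
  Deg<-*X n b q d = Deg<-+ (suc n) (0ᶜ ·ₚ q) (0ᶜ ∷ (b ·ₚ q +ₚ (0ᶜ ∷ [])))
    (Deg<-suc n (0ᶜ ·ₚ q) (Deg<-· n 0ᶜ q d)) (Deg<-+ n (b ·ₚ q) (0ᶜ ∷ []) (Deg<-· n b q d) (Deg<-0∷[] n))

  Deg<-∘X/2 : ∀ n p → Deg< n p → Deg< n (p ∘ₚ X/2)
  Deg<-∘X/2 n       []      _         = tt
  Deg<-∘X/2 zero    (a ∷ p) (a≃0 , d) =
    Deg<-+ 0 (a ∷ []) (X/2 *ₚ (p ∘ₚ X/2)) (a≃0 , tt) (Deg<0-* X/2 (p ∘ₚ X/2) (Deg<-∘X/2 0 p d))
  Deg<-∘X/2 (suc n) (a ∷ p) d         =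
    Deg<-+ (suc n) (a ∷ []) (X/2 *ₚ (p ∘ₚ X/2)) tt (Deg<-*X n (ofℚ ½) (p ∘ₚ X/2) (Deg<-∘X/2 n p d))

  Deg<-T : ∀ n → Deg< (suc n) (T n)
  Deg<-T zero          = tt
  Deg<-T (suc zero)    = tt
  Deg<-T (suc (suc n)) = Deg<-+ (suc (suc (suc n))) ((0ᶜ ∷ ofℕ 2 ∷ []) *ₚ T (suc n)) (-ₚ T n)
    (Deg<-*X (suc (suc n)) (ofℕ 2) (T (suc n)) (Deg<-T (suc n)))
    (Deg<-neg (suc (suc (suc n))) (T n) (Deg<-suc (suc (suc n)) (T n) (Deg<-suc (suc n) (T n) (Deg<-T n))))

  Deg<-ΣT : ∀ k → Deg< (suc k) (ΣT k)
  Deg<-ΣT zero    = tt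
  Deg<-ΣT (suc k) = Deg<-+ (suc (suc k)) (ΣT k) (T (suc k) ∘ₚ X/2) (Deg<-suc (suc k) (ΣT k) (Deg<-ΣT k))
    (Deg<-∘X/2 (suc (suc k)) (T (suc k)) (Deg<-T (suc k)))

  Deg<-D : ∀ k ν → Deg< (suc k) (D k ν)
  Deg<-D k ν = Deg<-+ (suc k) ((ofℕ k + ofℝ ν * ofℚ ½) ∷ []) (-ₚ ΣT k) tt (Deg<-neg (suc k) (ΣT k) (Deg<-ΣT k))

  eval-Deg<0 : ∀ p z → Deg< 0 p → eval p z ≃ 0ᶜ
  eval-Deg<0 p z d = trans (eval-act p z) (act-Deg<0 (scale-Linear z) p d one tt)

  Deg<-quotient : ∀ n p z → Deg< (suc n) p → Deg< n (quotient p z)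
  Deg<-quotient n       []      z _ = tt
  Deg<-quotient (suc n) (a ∷ p) z d = Deg<-quotient n p z d
  Deg<-quotient zero    (a ∷ p) z d = eval-Deg<0 p z d , Deg<0-quotient p d
    where
    Deg<0-quotient : ∀ p → Deg< 0 p → Deg< 0 (quotient p z)
    Deg<0-quotient []      _       = tt
    Deg<0-quotient (a ∷ p) (_ , d) = eval-Deg<0 p z d , Deg<0-quotient p d

  cancel : ∀ u x → u # 0ᶜ → (u * x) ≃ 0ᶜ → x ≃ 0ᶜ
  cancel u x u#0 ux≃0 = begin
    x                    ≈⟨ *-identityˡ x ⟨
    1ᶜ * x               ≈⟨ *-congʳ (inv-inverse u u#0) ⟨
    (u * inv u u#0) * x  ≈⟨ solve 3 (λ u v x → (u :* v) :* x := v :* (u :* x)) ≈-refl u (inv u u#0) x ⟩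
    inv u u#0 * (u * x)  ≈⟨ *-congˡ ux≃0 ⟩
    inv u u#0 * 0ᶜ       ≈⟨ zeroʳ (inv u u#0) ⟩
    0ᶜ ∎

  Distinct : ∀ {n} → (Fin n → ℂ) → Set
  Distinct z = ∀ c d → ¬ (c ≡ d) → z c # z d

  eval-quotient-root : ∀ p x z → Root p x → Root p z → x # z → eval (quotient p z) x ≃ 0ᶜ
  eval-quotient-root p x z px≃0 pz≃0 x#z = cancel (x - z) (eval (quotient p z) x) (Apartness.#⇒-#0 x z x#z) (begin
    (x - z) * eval (quotient p z) x               ≈⟨ +-identityʳ _ ⟨
    (x - z) * eval (quotient p z) x + 0ᶜ          ≈⟨ +-congˡ pz≃0 ⟨
    (x - z) * eval (quotient p z) x + eval p z    ≈⟨ eval-quotient p z x ⟨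
    eval p x                                      ≈⟨ px≃0 ⟩
    0ᶜ ∎)

  -- Split off S - z for one root and continue with the quotient: apartness lets the remaining roots
  -- pass to it, and its degree drops. Only the action is shown to vanish, so no coefficients need
  -- to be compared.
  act-zero : ∀ {I S} → Linear {I} S → ∀ n p → Deg< n p → (z : Fin n → ℂ) → Distinct z → (∀ c → Root p (z c)) →
    ∀ f i → act S p f i ≃ 0ᶜ
  act-zero S-Linear zero p d z distinct roots f i = act-Deg<0 S-Linear p d f i
  act-zero {S = S} S-Linear (suc n) p d z distinct roots f i = trans (act-quotient S-Linear p (z zero) f i)
    (trans (+-cong
      (act-zero S-Linear n (quotient p (z zero)) (Deg<-quotient n p (z zero) d) (z ∘ suc)
        (λ c d c≢d → distinct (suc c) (suc d) (c≢d ∘ Fin.suc-injective))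
        (λ c → eval-quotient-root p (z (suc c)) (z zero) (roots (suc c)) (roots zero) (distinct (suc c) zero λ ()))
        (λ i → S f i - z zero * f i) i)
      (trans (*-congʳ (roots zero)) (zeroˡ (f i))))
    (+-identityˡ 0ᶜ))

  sumₚ : ∀ {n} → (Fin n → Poly) → Poly
  sumₚ {zero}  p = []
  sumₚ {suc n} p = p zero +ₚ sumₚ (p ∘ suc)

  act-sumₚ : ∀ {I S} → Linear {I} S → ∀ {n} (p : Fin n → Poly) f i → act S (sumₚ p) f i ≃ sum (λ c → act S (p c) f i)
  act-sumₚ S-Linear {zero}  p f i = ≈-refl
  act-sumₚ S-Linear {suc n} p f i = trans (act-+ S-Linear (p zero) (sumₚ (p ∘ suc)) f i)
    (+-congˡ (act-sumₚ S-Linear (p ∘ suc) f i))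

  Deg<-sumₚ : ∀ m {n} (p : Fin n → Poly) → (∀ c → Deg< m (p c)) → Deg< m (sumₚ p)
  Deg<-sumₚ m {zero}  p d = tt
  Deg<-sumₚ m {suc n} p d = Deg<-+ m (p zero) (sumₚ (p ∘ suc)) (d zero) (Deg<-sumₚ m (p ∘ suc) (d ∘ suc))

  module Lagrange (n : ℕ) (p : Poly) (p-deg : Deg< (suc (suc n)) p) (z u : Fin (suc n) → ℂ) (distinct : Distinct z)
    (roots : ∀ c → Root p (z c)) (u-deriv : ∀ c → (u c * eval (deriv p) (z c)) ≃ 1ᶜ) where

    -- Σ u_c p / (x - z_c) - 1, of degree at most n. It vanishes at the n + 1 nodes, since at z_d
    -- only the term c = d survives and there u_d p′(z_d) = 1.
    interpolant : Poly
    interpolant = sumₚ (λ c → u c ·ₚ quotient p (z c)) +ₚ ((- 1ᶜ) ∷ [])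

    act-interpolant : ∀ {I S} → Linear {I} S → ∀ f i →
      act S interpolant f i ≃ (sum (λ c → u c * act S (quotient p (z c)) f i) - f i)
    act-interpolant {I} {S} S-Linear f i = begin
      act S interpolant f i
        ≈⟨ act-+ S-Linear (sumₚ (λ c → u c ·ₚ quotient p (z c))) ((- 1ᶜ) ∷ []) f i ⟩
      act S (sumₚ (λ c → u c ·ₚ quotient p (z c))) f i + act S ((- 1ᶜ) ∷ []) f i
        ≈⟨ +-cong (trans (act-sumₚ S-Linear (λ c → u c ·ₚ quotient p (z c)) f i)
             (sum-cong {suc n} {λ c → act S (u c ·ₚ quotient p (z c)) f i} {λ c → u c * act S (quotient p (z c)) f i}
               λ c → act-· S-Linear (u c) (quotient p (z c)) f i))
             (trans (act-const S-Linear (- 1ᶜ) f i) (solve 1 (λ f → (:- con 1ℚ) :* f := :- f) ≈-refl (f i))) ⟩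
      sum (λ c → u c * act S (quotient p (z c)) f i) - f i ∎

    term : ∀ c d → (u c * eval (quotient p (z c)) (z d)) ≃ indicator (d Fin.≟ c) 1ᶜ
    term c d = by-cases (d Fin.≟ c)
      where
      by-cases : (dec : Dec (d ≡ c)) → (u c * eval (quotient p (z c)) (z d)) ≃ indicator dec 1ᶜ
      by-cases (yes refl) = trans (*-congˡ (eval-deriv p (z c))) (u-deriv c)
      by-cases (no d≢c)   = trans
        (*-congˡ (eval-quotient-root p (z d) (z c) (roots d) (roots c) (distinct d c d≢c))) (zeroʳ (u c))

    interpolant-roots : ∀ d → Root interpolant (z d)
    interpolant-roots d = begin
      eval interpolant (z d)
        ≈⟨ eval-act interpolant (z d) ⟩
      act (scale (z d)) interpolant one tt
        ≈⟨ act-interpolant (scale-Linear (z d)) one tt ⟩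
      sum (λ c → u c * act (scale (z d)) (quotient p (z c)) one tt) - 1ᶜ
        ≈⟨ +-congʳ (sum-cong {suc n} {λ c → u c * act (scale (z d)) (quotient p (z c)) one tt}
             {λ c → indicator (d Fin.≟ c) 1ᶜ}
             λ c → trans (*-congˡ (sym (eval-act (quotient p (z c)) (z d)))) (term c d)) ⟩
      sum (λ c → indicator (d Fin.≟ c) 1ᶜ) - 1ᶜ
        ≈⟨ +-congʳ (sum-indicator d (λ _ → 1ᶜ)) ⟩
      1ᶜ - 1ᶜ
        ≈⟨ -‿inverseʳ 1ᶜ ⟩
      0ᶜ ∎

    partition : ∀ {I S} → Linear {I} S → ∀ f i → sum (λ c → u c * act S (quotient p (z c)) f i) ≃ f i
    partition {I} {S} S-Linear f i = begin
      Σ                             ≈⟨ solve 2 (λ s f → s := (s :- f) :+ f) ≈-refl Σ (f i) ⟩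
      (Σ - f i) + f i               ≈⟨ +-congʳ (act-interpolant S-Linear f i) ⟨
      act S interpolant f i + f i   ≈⟨ +-congʳ (act-zero S-Linear (suc n) interpolant
                                         (Deg<-+ (suc n) (sumₚ (λ c → u c ·ₚ quotient p (z c))) ((- 1ᶜ) ∷ [])
                                           (Deg<-sumₚ (suc n) (λ c → u c ·ₚ quotient p (z c)) λ c →
                                             Deg<-· (suc n) (u c) (quotient p (z c)) (Deg<-quotient (suc n) p (z c) p-deg))
                                           tt)
                                         z distinct interpolant-roots f i) ⟩
      0ᶜ + f i                      ≈⟨ +-identityˡ (f i) ⟩
      f i ∎
      where
      Σ : ℂ
      Σ = sum (λ c → u c * act S (quotient p (z c)) f i)

  -- At least one node is required: the empty sum does not reproduce `f`.
  lagrange : ∀ {I S} → Linear {I} S → ∀ n → 1 ℕ.≤ n → ∀ p → Deg< (suc n) p → (z u : Fin n → ℂ) → Distinct z →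
    (∀ c → Root p (z c)) → (∀ c → (u c * eval (deriv p) (z c)) ≃ 1ᶜ) →
    ∀ f i → sum (λ c → u c * act S (quotient p (z c)) f i) ≃ f i
  lagrange S-Linear (suc n) _ p d z u distinct roots u-deriv = Lagrange.partition n p d z u distinct roots u-deriv S-Linear

-- Invertibility of γ

module RootFacts (k n : ℕ) .{{_ : NonZero n}} (r : RootData k (fromℕ n)) where

  open ℂ-Algebra
  open PolynomialAction
  open Polynomials
  open RootData r

  Dν : Poly
  Dν = D k (fromℕ n)

  square-inverse : ∀ a b h g → (a * b) ≃ 1ᶜ → a ≃ (h * h) → (h * g) ≃ 1ᶜ → b ≃ (g * g)
  square-inverse a b h g ab≃1 a≃h² hg≃1 = begin
    b                         ≈⟨ trans (*-congˡ (trans (*-cong hg≃1 hg≃1) (*-identityˡ 1ᶜ))) (*-identityʳ b) ⟨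
    b * ((h * g) * (h * g))   ≈⟨ solve 3 (λ b h g → b :* ((h :* g) :* (h :* g)) := ((h :* h) :* b) :* (g :* g))
                                   ≈-refl b h g ⟩
    ((h * h) * b) * (g * g)   ≈⟨ *-congʳ (trans (*-congʳ (sym a≃h²)) ab≃1) ⟩
    1ᶜ * (g * g)              ≈⟨ *-identityˡ (g * g) ⟩
    g * g ∎

  -- (η + η⁻¹)² - 2 = η² + η⁻², and uniqueness of inverses identifies η⁻² with ρ⁻¹.
  γ² : ∀ c → (γ c * γ c - ofℕ 2) ≃ φ c
  γ² c = begin
    (η c + g) * (η c + g) - ofℕ 2
      ≈⟨ solve 2 (λ h g → (h :+ g) :* (h :+ g) :- num 2 :=
           (h :* h :+ g :* g) :+ num 2 :* (h :* g :- con 1ℚ)) ≈-refl (η c) g ⟩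
    (η c * η c + g * g) + ofℕ 2 * (η c * g - ofℚ 1ℚ)
      ≈⟨ +-cong (+-cong (sym (η-ρ c)) (sym (square-inverse (ρ c) (inv (ρ c) (ρ#0 c)) (η c) g
             (inv-inverse (ρ c) (ρ#0 c)) (η-ρ c) (inv-inverse (η c) (η#0 c)))))
           (trans (*-congˡ (trans (+-congʳ (inv-inverse (η c) (η#0 c))) (-‿inverseʳ 1ᶜ))) (zeroʳ (ofℕ 2))) ⟩
    (ρ c + inv (ρ c) (ρ#0 c)) + 0ᶜ
      ≈⟨ +-identityʳ _ ⟩
    ρ c + inv (ρ c) (ρ#0 c)
      ≈⟨ ρ-φ c ⟩
    φ c ∎
    where
    g : ℂ
    g = inv (η c) (η#0 c)

  sign : ℕ → ℚ
  sign zero    = 1ℚ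
  sign (suc s) = ℚ.- sign s

  sign-bound : ∀ s → sign s ℚ.≤ 1ℚ × ℚ.- 1ℚ ℚ.≤ sign s
  sign-bound zero    = ℚ.≤-refl , ℚ.*≤* ℤ.-≤+
  sign-bound (suc s) = let (upper , lower) = sign-bound s in ℚ.neg-antimono-≤ lower , ℚ.neg-antimono-≤ upper

  alternating : ℕ → ℚ
  alternating zero    = 0ℚ
  alternating (suc s) = alternating s ℚ.+ sign (suc s)

  alternating≤ : ∀ s → alternating s ℚ.≤ ℕ→ℚ s
  alternating≤ zero    = ℚ.≤-refl
  alternating≤ (suc s) = subst (alternating (suc s) ℚ.≤_) (≡.sym (ℕ→ℚ-suc s))
    (ℚ.+-mono-≤ (alternating≤ s) (proj₁ (sign-bound (suc s))))

  -- At x = -2 the Chebyshev values are T_s(-1) = (-1)^s, each at most 1, so D(-2) = k + n/2 - Σ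
  -- (-1)^s is at least n/2 > 0.
  -2ℚ D[-2] : ℚ
  -2ℚ   = ℚ.- ℕ→ℚ 2
  D[-2] = (ℕ→ℚ k ℚ.- alternating k) ℚ.+ ℕ→ℚ n ℚ.* ½

  D[-2]≢0 : D[-2] ≢ 0ℚ
  D[-2]≢0 eq = ℚ.<-irrefl (≡.sym eq) (ℚ.+-mono-≤-< (≤⇒0≤ (alternating≤ k))
    (subst (ℚ._< ℕ→ℚ n ℚ.* ½) (ℚ.*-zeroʳ (ℕ→ℚ n))
      (ℚ.*-monoʳ-<-pos (ℕ→ℚ n) {{ℚ.positive (0<ℕ→ℚ n)}} {0ℚ} {½} (ℚ.positive⁻¹ ½))))

  -- The values 2 T_s(-1), which `Chebyshev` takes with multiplication by -2 as its operator.
  t : ℕ → ⊤ → ℂ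
  t s _ = ofℕ 2 * ofℚ (sign s)

  t-0 : ∀ i → t 0 i ≃ (ofℕ 2 * one i)
  t-0 _ = ≈-refl

  t-1 : ∀ i → t 1 i ≃ scale (ofℚ -2ℚ) one i
  t-1 _ = trans (*-congˡ (-‿homo 1ℚ)) (solve 0 (num 2 :* (:- con 1ℚ) := con -2ℚ :* con 1ℚ) ≈-refl)

  t-step : ∀ s i → scale (ofℚ -2ℚ) (t (suc s)) i ≃ (t (suc (suc s)) i + t s i)
  t-step s _ = trans (*-congˡ (*-congˡ (-‿homo (sign s)))) (trans
    (solve 1 (λ x → con -2ℚ :* (num 2 :* (:- x)) := num 2 :* (:- (:- x)) :+ num 2 :* x)
      ≈-refl (ofℚ (sign s)))
    (+-congʳ (*-congˡ (sym (trans (-‿homo (sign (suc s))) (-‿cong (-‿homo (sign s))))))))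

  open Chebyshev (scale-Linear (ofℚ -2ℚ)) one t t-0 t-1 t-step using (Σt; act-D)

  Σt-alternating : ∀ s i → Σt s i ≃ (ofℕ 2 * ofℚ (alternating s))
  Σt-alternating zero    i = sym (zeroʳ (ofℕ 2))
  Σt-alternating (suc s) i = trans (+-congʳ (Σt-alternating s i))
    (trans (sym (distribˡ (ofℕ 2) (ofℚ (alternating s)) (ofℚ (sign (suc s)))))
      (*-congˡ (sym (+-homo (alternating s) (sign (suc s))))))

  eval-D[-2] : eval Dν (ofℚ -2ℚ) ≃ ofℚ D[-2]
  eval-D[-2] = begin
    eval Dν (ofℚ -2ℚ)
      ≈⟨ eval-act Dν (ofℚ -2ℚ) ⟩
    act (scale (ofℚ -2ℚ)) Dν one tt
      ≈⟨ act-D k (fromℕ n) tt ⟩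
    (ofℕ k + ofℕ n * ofℚ ½) * 1ᶜ - ofℚ ½ * Σt k tt
      ≈⟨ +-congˡ (-‿cong (*-congˡ (Σt-alternating k tt))) ⟩
    (ofℕ k + ofℕ n * ofℚ ½) * 1ᶜ - ofℚ ½ * (ofℕ 2 * ofℚ (alternating k))
      ≈⟨ solve 3 (λ k n a → (k :+ n :* con ½) :* con 1ℚ :- con ½ :* (num 2 :* a) := (k :- a) :+ n :* con ½)
           ≈-refl (ofℕ k) (ofℕ n) (ofℚ (alternating k)) ⟩
    (ofℕ k - ofℚ (alternating k)) + ofℕ n * ofℚ ½
      ≈⟨ trans (+-homo (ℕ→ℚ k ℚ.- alternating k) (ℕ→ℚ n ℚ.* ½)) (+-cong
           (trans (+-homo (ℕ→ℚ k) (ℚ.- alternating k)) (+-congˡ (-‿homo (alternating k)))) (*-homo (ℕ→ℚ n) ½)) ⟨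
    ofℚ D[-2] ∎

  -- γ² = φ + 2 is a factor of D(φ) - D(-2) = -D(-2).
  γ-unit : ∀ c → ∃ λ u → (γ c * u) ≃ 1ᶜ
  γ-unit c = γ c * (q * s) , (begin
    γ c * (γ c * (q * s))
      ≈⟨ solve 3 (λ γ q s → γ :* (γ :* (q :* s)) := (((γ :* γ :- num 2) :- con -2ℚ) :* q) :* s) ≈-refl (γ c) q s ⟩
    (((γ c * γ c - ofℕ 2) - ofℚ -2ℚ) * q) * s
      ≈⟨ *-congʳ (*-congʳ (+-congʳ (γ² c))) ⟩
    ((φ c - ofℚ -2ℚ) * q) * s
      ≈⟨ solve 3 (λ p d s → p :* s := (p :+ d) :* s :- d :* s) ≈-refl ((φ c - ofℚ -2ℚ) * q) (ofℚ D[-2]) s ⟩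
    ((φ c - ofℚ -2ℚ) * q + ofℚ D[-2]) * s - ofℚ D[-2] * s
      ≈⟨ +-congʳ (trans (*-congʳ (trans (+-congˡ (sym eval-D[-2]))
           (trans (sym (eval-quotient Dν (ofℚ -2ℚ) (φ c))) (φ-root c)))) (zeroˡ s)) ⟩
    0ᶜ - ofℚ D[-2] * s
      ≈⟨ solve 2 (λ d r → con 0ℚ :- d :* (:- r) := d :* r) ≈-refl (ofℚ D[-2]) (ofℚ (recip D[-2])) ⟩
    ofℚ D[-2] * ofℚ (recip D[-2])
      ≈⟨ *-homo D[-2] (recip D[-2]) ⟨
    ofℚ (D[-2] ℚ.* recip D[-2])
      ≈⟨ reflexive (cong ofℚ (recip-inverse D[-2]≢0)) ⟩
    1ᶜ ∎)
    where
    q s : ℂ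
    q = eval (quotient Dν (ofℚ -2ℚ)) (φ c)
    s = - ofℚ (recip D[-2])

-- 𝒜 as a difference of Green function values

module RootsOnCycle (N k n : ℕ) .{{N≢0 : NonZero N}} .{{_ : NonZero n}} (1≤k : 1 ℕ.≤ k) (2k<N : 2 ℕ.* k ℕ.+ 1 ℕ.≤ N)
  (r : RootData k (fromℕ n)) (simple : AllRootsSimple (D k (fromℕ n)))
  (Γ : Fin N → ℚ) (isGreen : ∀ x → CycleOperators.Lap ℚ-ring ℚ-scalars N k (ℕ→ℚ n) Γ x ≡
    CycleOperators.δ ℚ-ring ℚ-scalars N (Cyclic.0ᶠ N) x) where

  open ℂ-Algebra
  open Cyclic N
  open CycleOperators ℂ-commutativeRing ℂ-scalars N
  open CycleTransfer ℂ-commutativeRing ℂ-scalars N k 1≤k 2k<N using (constant-divisible; Lap-superposition; green-difference)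
  open PolynomialAction
  open Polynomials
  open RootData r
  open RootFacts k n r

  τ-Linear : Linear (τ 1)
  τ-Linear = record
    { S-cong   = λ eq x → +-cong (eq _) (eq _)
    ; S-linear = λ a b f g x → solve 6 (λ a b p q s t →
        (a :* p :+ b :* q) :+ (a :* s :+ b :* t) := a :* (p :+ s) :+ b :* (q :+ t))
        ≈-refl a b (f (x ⊞ 1)) (g (x ⊞ 1)) (f (x ⊞ (1 ℕ.* M))) (g (x ⊞ (1 ℕ.* M)))
    }

  module _ (f : Fin N → ℂ) where

    τ-0 : ∀ x → τ 0 f x ≃ (ofℕ 2 * f x)
    τ-0 x = trans (+-cong (reflexive (cong f (⊞-0 x))) (reflexive (cong f (⊞-0 x))))
      (solve 1 (λ f → f :+ f := num 2 :* f) ≈-refl (f x))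

    -- With X the unit shift, (X + X⁻¹)(X^(s+1) + X^(-s-1)) = (X^(s+2) + X^(-s-2)) + (X^s + X^(-s)).
    τ-step : ∀ s x → τ 1 (τ (suc s) f) x ≃ (τ (suc (suc s)) f x + τ s f x)
    τ-step s x = trans
      (+-cong (+-cong (at (≡.trans (⊞-⊞ x 1 (suc s)) refl)) (at (≡.trans (⊞-⊞ x 1 (suc s ℕ.* M)) (step-back-forth x s))))
        (+-cong (at (≡.trans (⊞-⊞ x (1 ℕ.* M) (suc s)) (≡.trans (cong (λ m → x ⊞ (m ℕ.+ suc s)) (ℕ.*-identityˡ M)) (step-forth-back x s))))
          (at (≡.trans (⊞-⊞ x (1 ℕ.* M) (suc s ℕ.* M)) (cong (x ⊞_) (≡.sym (ℕ.*-distribʳ-+ M 1 (suc s))))))))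
      (solve 4 (λ a b c d → (a :+ b) :+ (c :+ d) := (a :+ d) :+ (c :+ b)) ≈-refl
        (f (x ⊞ suc (suc s))) (f (x ⊞ (s ℕ.* M))) (f (x ⊞ s)) (f (x ⊞ (suc (suc s) ℕ.* M))))
      where
      at : ∀ {y z} → y ≡ z → f y ≃ f z
      at y≡z = reflexive (cong f y≡z)

    open Chebyshev τ-Linear f (λ s → τ s f) τ-0 (λ _ → ≈-refl) τ-step using (Σt; act-D)

    Σt-Στ : ∀ k x → Σt k x ≃ Στ k f x
    Σt-Στ zero    x = ≈-refl
    Σt-Στ (suc k) x = +-congʳ (Σt-Στ k x)

    Lap-act-D : ∀ x → Lap k (ℕ→ℚ n) f x ≃ (ofℕ 2 * act (τ 1) Dν f x)
    Lap-act-D x = begin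
      ofℚ (ℕ→ℚ (2 ℕ.* k) ℚ.+ ℕ→ℚ n) * f x - Στ k f x
        ≈⟨ +-congʳ (*-congʳ (trans (+-homo (ℕ→ℚ (2 ℕ.* k)) (ℕ→ℚ n)) (+-congʳ
             (trans (reflexive (cong ofℚ (ℕ→ℚ-* 2 k))) (*-homo (ℕ→ℚ 2) (ℕ→ℚ k)))))) ⟩
      (ofℕ 2 * ofℕ k + ofℕ n) * f x - Στ k f x
        ≈⟨ solve 4 (λ k n f s → (num 2 :* k :+ n) :* f :- s := num 2 :* ((k :+ n :* con ½) :* f :- con ½ :* s))
             ≈-refl (ofℕ k) (ofℕ n) (f x) (Στ k f x) ⟩
      ofℕ 2 * ((ofℕ k + ofℕ n * ofℚ ½) * f x - ofℚ ½ * Στ k f x)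
        ≈⟨ *-congˡ (+-congˡ (-‿cong (*-congˡ (Σt-Στ k x)))) ⟨
      ofℕ 2 * ((ofℕ k + ofℕ n * ofℚ ½) * f x - ofℚ ½ * Σt k x)
        ≈⟨ *-congˡ (act-D k (fromℕ n) x) ⟨
      ofℕ 2 * act (τ 1) Dν f x ∎

  quotients : Fin k → Poly
  quotients c = quotient Dν (φ c)

  Q E : Fin k → Fin N → ℂ
  Q c = act (τ 1) (quotients c) (δ 0ᶠ)
  E c = act (τ 1) (quotients c) (λ _ → 1ᶜ)

  act-Dν : ∀ c f x → act (τ 1) Dν f x ≃ act (τ 1) (quotients c) (λ x → τ 1 f x - φ c * f x) x
  act-Dν c f x = trans (act-quotient τ-Linear Dν (φ c) f x)
    (trans (+-congˡ (trans (*-congʳ (φ-root c)) (zeroˡ (f x)))) (+-identityʳ _))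

  Lap-root : ∀ c f b s → (∀ x → (τ 1 f x - φ c * f x) ≃ (b * δ 0ᶠ x - s)) →
    ∀ x → Lap k (ℕ→ℚ n) f x ≃ (ofℕ 2 * (b * Q c x - s * E c x))
  Lap-root c f b s eq x = trans (Lap-act-D f x) (*-congˡ (trans (act-Dν c f x)
    (trans (act-cong τ-Linear (quotients c) (λ x → trans (eq x)
        (+-congˡ (sym (*-identityʳ (- s))))) x)
      (trans (act-linear τ-Linear (quotients c) b (- s) (δ 0ᶠ) (λ _ → 1ᶜ) x)
        (solve 4 (λ b q s e → b :* q :+ (:- s) :* e := b :* q :- s :* e) ≈-refl b (Q c x) s (E c x))))))

  2-φ : Fin k → ℂ
  2-φ c = ofℕ 2 - φ c

  -- `E c` is D(x)/(x - φ_c) at x = S, applied to 1. Since S doubles constants, multiplying by 2 -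
  -- φ_c leaves D(2) = n/2.
  E-value : ∀ c x → (ofℕ 2 * (2-φ c * E c x)) ≃ ofℕ n
  E-value c x = begin
    ofℕ 2 * (2-φ c * E c x)
      ≈⟨ *-congˡ (Linear.S-* (act-Linear τ-Linear (quotients c)) (2-φ c) (λ _ → 1ᶜ) x) ⟨
    ofℕ 2 * act (τ 1) (quotients c) (λ x → 2-φ c * 1ᶜ) x
      ≈⟨ *-congˡ (act-cong τ-Linear (quotients c)
           {λ _ → (1ᶜ + 1ᶜ) - φ c * 1ᶜ} {λ _ → 2-φ c * 1ᶜ}
           (λ _ → solve 2 (λ φ o → (o :+ o) :- φ :* o := (num 2 :- φ) :* o) ≈-refl (φ c) 1ᶜ) x) ⟨
    ofℕ 2 * act (τ 1) (quotients c) (λ x → (1ᶜ + 1ᶜ) - φ c * 1ᶜ) x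
      ≈⟨ *-congˡ (act-Dν c (λ _ → 1ᶜ) x) ⟨
    ofℕ 2 * act (τ 1) Dν (λ _ → 1ᶜ) x
      ≈⟨ Lap-act-D (λ _ → 1ᶜ) x ⟨
    Lap k (ℕ→ℚ n) (λ _ → 1ᶜ) x
      ≈⟨ trans (Lap-const k (ℕ→ℚ n) 1ᶜ x) (*-identityʳ (ofℕ n)) ⟩
    ofℕ n ∎

  -- By `E-value` the element 2 - φ_c is invertible, with inverse built from `E c 0ᶠ` and 1/n, so
  -- the common value there determines `E c x`.
  E-constant : ∀ c x → E c x ≃ E c 0ᶠ
  E-constant c x = begin
    E c x
      ≈⟨ to-normal (E c x) ⟨
    (m * E c 0ᶠ) * (ofℕ 2 * (2-φ c * E c x))
      ≈⟨ *-congˡ (trans (E-value c x) (sym (E-value c 0ᶠ))) ⟩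
    (m * E c 0ᶠ) * (ofℕ 2 * (2-φ c * E c 0ᶠ))
      ≈⟨ to-normal (E c 0ᶠ) ⟩
    E c 0ᶠ ∎
    where
    m : ℂ
    m = ofℚ (recip (ℕ→ℚ n))
    to-normal : ∀ e → ((m * E c 0ᶠ) * (ofℕ 2 * (2-φ c * e))) ≃ e
    to-normal e = begin
      (m * E c 0ᶠ) * (ofℕ 2 * (2-φ c * e))
        ≈⟨ solve 5 (λ m e₀ t a e → (m :* e₀) :* (t :* (a :* e)) := (m :* (t :* (a :* e₀))) :* e) ≈-refl
             m (E c 0ᶠ) (ofℕ 2) (2-φ c) e ⟩
      (m * (ofℕ 2 * (2-φ c * E c 0ᶠ))) * e
        ≈⟨ *-congʳ (trans (*-congˡ (E-value c 0ᶠ)) (trans (*-comm m (ofℕ n))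
             (trans (sym (*-homo (ℕ→ℚ n) (recip (ℕ→ℚ n)))) (reflexive (cong ofℚ (recip-inverse (ℕ→ℚ≢0 n))))))) ⟩
      1ᶜ * e
        ≈⟨ *-identityˡ e ⟩
      e ∎

  module Root (c : Fin k) where
    open SecondKind.Sequence ℂ-commutativeRing ℂ-scalars (γ c) (V (γ c)) ≈-refl ≈-refl (λ _ → ≈-refl) using (module OnCycle)
    open OnCycle N {{N≢0}} public

    Lap-w : ∀ x → Lap k (ℕ→ℚ n) w x ≃ (ofℕ 2 * ((V (γ c) N * γ c) * Q c x - C * E c x))
    Lap-w = Lap-root c w (V (γ c) N * γ c) C λ x → trans (+-congˡ (-‿cong (*-congʳ (sym (γ² c))))) (τ-w x)

    -- The pairing shows that `C` is divisible by γ V_N; the extra γ is absorbed into the cofactor.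
    V-unit : ∃ λ u → (V (γ c) N * u) ≃ 1ᶜ
    V-unit = unit-from-C (γ c * Z) (trans
      (constant-divisible (ℕ→ℚ n) Γ isGreen (2-φ c) (V (γ c) N * γ c) C w (E c) (Q c) Lap-w (E-value c) w-0)
      (*-assoc (V (γ c) N) (γ c) Z))
      where
      Z : ℂ
      Z = 2-φ c * (ofℕ 2 * sum (λ x → ofℚ (Γ x) * Q c x))

  D′ : Fin k → ℂ
  D′ c = eval (deriv Dν) (φ c)

  nonzeroDenominators : NonzeroDenominators r N
  nonzeroDenominators c =
    let (u , γu≃1) = γ-unit c
        D′#0       = simple (φ c) (φ-root c)
        (v , Vv≃1) = Root.V-unit c
    in Apartness.unit⇒#0 (γ c * D′ c) (u * inv (D′ c) D′#0) (trans
         (solve 4 (λ g d u v → (g :* d) :* (u :* v) := (g :* u) :* (d :* v)) ≈-refl (γ c) (D′ c) u (inv (D′ c) D′#0))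
         (trans (*-cong γu≃1 (inv-inverse (D′ c) D′#0)) (*-identityˡ 1ᶜ)))
       , Apartness.unit⇒#0 (V (γ c) N) v Vv≃1

  module _ (nz : NonzeroDenominators r N) where

    -- `u c` is the Lagrange weight 1/D′(φ_c), `a c` the coefficient of V_x V_(N-x) in 𝒜, and `κ c`
    -- the constant that this term contributes under Λ + ν.
    b i a u κ : Fin k → ℂ
    b c = inv (γ c * D′ c) (proj₁ (nz c))
    i c = inv (V (γ c) N) (proj₂ (nz c))
    a c = b c * i c
    u c = b c * γ c
    κ c = a c * (ofℕ 2 * (Root.C c * E c 0ᶠ))

    term-Lap : ∀ c x → (a c * Lap k (ℕ→ℚ n) (Root.w c) x) ≃ (ofℕ 2 * (u c * Q c x) - κ c)
    term-Lap c x = begin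
      a c * Lap k (ℕ→ℚ n) (Root.w c) x
        ≈⟨ *-congˡ (trans (Root.Lap-w c x) (*-congˡ (+-congˡ (-‿cong (*-congˡ (E-constant c x)))))) ⟩
      a c * (ofℕ 2 * ((V (γ c) N * γ c) * Q c x - Root.C c * E c 0ᶠ))
        ≈⟨ solve 7 (λ b i t v g q ce → (b :* i) :* (t :* ((v :* g) :* q :- ce)) :=
             (v :* i) :* (t :* ((b :* g) :* q)) :- (b :* i) :* (t :* ce)) ≈-refl
             (b c) (i c) (ofℕ 2) (V (γ c) N) (γ c) (Q c x) (Root.C c * E c 0ᶠ) ⟩
      (V (γ c) N * i c) * (ofℕ 2 * (u c * Q c x)) - κ c
        ≈⟨ +-congʳ (trans (*-congʳ (inv-inverse (V (γ c) N) (proj₂ (nz c)))) (*-identityˡ _)) ⟩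
      ofℕ 2 * (u c * Q c x) - κ c ∎

    partition : ∀ x → sum (λ c → u c * Q c x) ≃ δ 0ᶠ x
    partition = lagrange τ-Linear k 1≤k Dν (Deg<-D k (fromℕ n)) φ u φ-distinct φ-root
      (λ c → trans (solve 3 (λ b g d → (b :* g) :* d := (g :* d) :* b) ≈-refl (b c) (γ c) (D′ c))
        (inv-inverse (γ c * D′ c) (proj₁ (nz c)))) (δ 0ᶠ)

    F : Fin N → ℂ
    F x = sum λ c → a c * Root.w c x

    𝒜-F : ∀ x → 𝒜 r N nz (toℕ x) ≃ F x
    𝒜-F x = sum-cong {k} {λ c → b c * (V (γ c) (toℕ x) * V (γ c) (N ℕ.∸ toℕ x) * i c)} {λ c → a c * Root.w c x}
      λ c → solve 3 (λ b w i → b :* (w :* i) := (b :* i) :* w) ≈-refl (b c) (Root.w c x) (i c)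

    𝒜-green : ∀ x → 𝒜 r N nz (toℕ x) ≃ ((- ofℕ 2) * ofℚ (Γ 0ᶠ ℚ.- Γ x))
    𝒜-green x = trans (𝒜-F x) (green-difference (ℕ→ℚ n) (0<ℕ→ℚ n) Γ isGreen F (- ofℕ 2) (- sum κ)
      (Lap-superposition (ℕ→ℚ n) a u κ Root.w Q term-Lap partition)
      (sum-zero {k} λ c → trans (*-congˡ (Root.w-0 c)) (zeroʳ (a c))) x)

-- The formula for general k

module _ where

  open ℚ-Algebra

  -- The weights 3, 15, 12 lose their common 3 against the 1/3 in the prefactor, leaving 1, 5, 4.
  -- The fractions `x` and `y` enter through equations cleared of denominators, and -2b, -2c are the
  -- values of 𝒜 for ν = 2 and ν = 5.
  combine-times : ∀ n d m x y p q b c → x ⊗ m ≡ d → y ⊗ ℕ→ℚ 2 ≡ n ⊗ d →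
    (n ⊗ (d ⊗ recip (ℕ→ℚ 3))) ⊗ (ℕ→ℚ 3 ⊗ (p ⊝ q) ⊕ (ℕ→ℚ 15 ⊗ b ⊕ ℕ→ℚ 12 ⊗ c)) ≡
    x ⊗ ((m ⊗ n) ⊗ p ⊕ (⊖ (m ⊗ n)) ⊗ q) ⊝ y ⊗ (ℕ→ℚ 5 ⊗ (⊖ ℕ→ℚ 2 ⊗ b) ⊕ ℕ→ℚ 4 ⊗ (⊖ ℕ→ℚ 2 ⊗ c))
  combine-times n d m x y p q b c xm≡d 2y≡nd = begin
    (n ⊗ (d ⊗ recip (ℕ→ℚ 3))) ⊗ (ℕ→ℚ 3 ⊗ (p ⊝ q) ⊕ (ℕ→ℚ 15 ⊗ b ⊕ ℕ→ℚ 12 ⊗ c))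
      ≈⟨ solve 5 (λ n d a b c → (n :* (d :* con (recip (ℕ→ℚ 3)))) :*
           (num 3 :* a :+ (num 15 :* b :+ num 12 :* c)) :=
           d :* (n :* a) :+ (n :* d) :* (num 5 :* b :+ num 4 :* c)) refl n d (p ⊝ q) b c ⟩
    d ⊗ (n ⊗ (p ⊝ q)) ⊕ (n ⊗ d) ⊗ (ℕ→ℚ 5 ⊗ b ⊕ ℕ→ℚ 4 ⊗ c)
      ≈⟨ cong₂ (λ u v → u ⊗ (n ⊗ (p ⊝ q)) ⊕ v ⊗ (ℕ→ℚ 5 ⊗ b ⊕ ℕ→ℚ 4 ⊗ c)) xm≡d 2y≡nd ⟨
    (x ⊗ m) ⊗ (n ⊗ (p ⊝ q)) ⊕ (y ⊗ ℕ→ℚ 2) ⊗ (ℕ→ℚ 5 ⊗ b ⊕ ℕ→ℚ 4 ⊗ c)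
      ≈⟨ solve 8 (λ x d n p q y b c → (x :* d) :* (n :* (p :- q)) :+ (y :* num 2) :* (num 5 :* b :+ num 4 :* c) :=
           x :* ((d :* n) :* p :+ (:- (d :* n)) :* q) :-
           y :* (num 5 :* ((:- num 2) :* b) :+ num 4 :* ((:- num 2) :* c)))
           refl x m n p q y b c ⟩
    x ⊗ ((m ⊗ n) ⊗ p ⊕ (⊖ (m ⊗ n)) ⊗ q) ⊝ y ⊗ (ℕ→ℚ 5 ⊗ (⊖ ℕ→ℚ 2 ⊗ b) ⊕ ℕ→ℚ 4 ⊗ (⊖ ℕ→ℚ 2 ⊗ c)) ∎

module _ where

  open ℂ-Algebra

  ofℚ-formula : ∀ s x h y p q A B →
    s ≡ x ℚ.* h ℚ.- y ℚ.* (ℕ→ℚ 5 ℚ.* p ℚ.+ ℕ→ℚ 4 ℚ.* q) → A ≃ ofℚ p → B ≃ ofℚ q →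
    ofℚ s ≃ (ofℚ x * ofℚ h - ofℚ y * (ofℕ 5 * A + ofℕ 4 * B))
  ofℚ-formula s x h y p q A B refl A≃p B≃q = trans (+-homo _ _) (+-cong (*-homo x h) (trans (-‿homo _) (-‿cong
    (trans (*-homo y _) (*-congˡ (trans (+-homo _ _)
      (+-cong (trans (*-homo (ℕ→ℚ 5) p) (*-congˡ (sym A≃p)))
        (trans (*-homo (ℕ→ℚ 4) q) (*-congˡ (sym B≃q))))))))))

module FirstPart (N k : ℕ) .{{N≢0 : NonZero N}} .{{k≢0 : NonZero k}} (2k<N : 2 ℕ.* k ℕ.+ 1 ℕ.≤ N)
  (simple₂ : AllRootsSimple (D k (fromℕ 2))) (simple₅ : AllRootsSimple (D k (fromℕ 5)))
  (r₂ : RootData k (fromℕ 2)) (r₅ : RootData k (fromℕ 5)) (a : Vertex petersen) (ℓ : ℕ) (ℓ<N : ℓ ℕ.< N) where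

  open Cyclic N
  open CycleOperators ℚ-ring ℚ-scalars N using (Lap; δ)

  1≤k : 1 ℕ.≤ k
  1≤k = ℕ.>-nonZero⁻¹ k

  open GreenFunctions N k 1≤k 2k<N using (green; green₀)

  v : Fin N
  v = ℓ mod N

  toℕ-v : toℕ v ≡ ℓ
  toℕ-v = ≡.trans (toℕ-mod ℓ) (ℕ.m<n⇒m%n≡m ℓ<N)

  Γ₀ Γ₂ Γ₅ : Fin N → ℚ
  Γ₀ = proj₁ green₀
  Γ₂ = proj₁ (green (ℕ→ℚ 2) (0<ℕ→ℚ 2) 0ᶠ)
  Γ₅ = proj₁ (green (ℕ→ℚ 5) (0<ℕ→ℚ 5) 0ᶠ)

  isGreen₂ : ∀ x → Lap k (ℕ→ℚ 2) Γ₂ x ≡ δ 0ᶠ x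
  isGreen₂ = proj₂ (green (ℕ→ℚ 2) (0<ℕ→ℚ 2) 0ᶠ)

  isGreen₅ : ∀ x → Lap k (ℕ→ℚ 5) Γ₅ x ≡ δ 0ᶠ x
  isGreen₅ = proj₂ (green (ℕ→ℚ 5) (0<ℕ→ℚ 5) 0ᶠ)

  open WalkHittingTimes N k 1≤k 2k<N Γ₀ v
  open Product Γ₂ Γ₅ a using (startTime; product-hittingTime)

  module Roots₂ = RootsOnCycle N k 2 1≤k 2k<N r₂ simple₂ Γ₂ isGreen₂
  module Roots₅ = RootsOnCycle N k 5 1≤k 2k<N r₅ simple₅ Γ₅ isGreen₅

  nz₂ : NonzeroDenominators r₂ N
  nz₂ = Roots₂.nonzeroDenominators

  nz₅ : NonzeroDenominators r₅ N
  nz₅ = Roots₅.nonzeroDenominators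

  g₀ g₂ g₅ ratio scaling : ℚ
  g₀ = Γ₀ 0ᶠ ℚ.- Γ₀ v
  g₂ = Γ₂ 0ᶠ ℚ.- Γ₂ v
  g₅ = Γ₅ 0ᶠ ℚ.- Γ₅ v
  ratio   = ℚ._/_ (ℤ.+ (2 ℕ.* k ℕ.+ 3)) (2 ℕ.* k) {{ℕ.m*n≢0 2 k}}
  scaling = ℤ.+ (N ℕ.* (2 ℕ.* k ℕ.+ 3)) ℚ./ 2

  startTime-cycleTime : startTime ≡
    ratio ℚ.* cycleTime 0ᶠ ℚ.- scaling ℚ.* (ℕ→ℚ 5 ℚ.* (ℚ.- ℕ→ℚ 2 ℚ.* g₂) ℚ.+ ℕ→ℚ 4 ℚ.* (ℚ.- ℕ→ℚ 2 ℚ.* g₅))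
  startTime-cycleTime = subst
    (λ y → startTime ≡ ratio ℚ.* ((2k ℚ.* ℕ→ℚ N) ℚ.* Γ₀ 0ᶠ ℚ.+ (ℚ.- (2k ℚ.* ℕ→ℚ N)) ℚ.* Γ₀ y) ℚ.-
      scaling ℚ.* (ℕ→ℚ 5 ℚ.* (ℚ.- ℕ→ℚ 2 ℚ.* g₂) ℚ.+ ℕ→ℚ 4 ℚ.* (ℚ.- ℕ→ℚ 2 ℚ.* g₅)))
    (≡.sym (reflect-0 v))
    (combine-times (ℕ→ℚ N) 2k+3 2k ratio scaling (Γ₀ 0ᶠ) (Γ₀ v) g₂ g₅
      (/-* (2 ℕ.* k ℕ.+ 3) (2 ℕ.* k) {{ℕ.m*n≢0 2 k}})
      (≡.trans (/-* (N ℕ.* (2 ℕ.* k ℕ.+ 3)) 2) (ℕ→ℚ-* N (2 ℕ.* k ℕ.+ 3))))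

  𝒜-value : ∀ {n} (r : RootData k (fromℕ n)) (nz : NonzeroDenominators r N) g →
    𝒜 r N nz (toℕ v) ≃ ((- ofℚ (ℕ→ℚ 2)) * ofℚ g) → 𝒜 r N nz ℓ ≃ ofℚ (ℚ.- ℕ→ℚ 2 ℚ.* g)
  𝒜-value r nz g eq = trans (reflexive (cong (𝒜 r N nz) (≡.sym toℕ-v)))
    (trans eq (sym (trans (*-homo (ℚ.- ℕ→ℚ 2) g) (*-congʳ (-‿homo (ℕ→ℚ 2))))))
    where open ℂ-Algebra

  formula : ofℝ (fromℚ startTime) ≃ (ofℚ ratio * ofℝ (fromℚ (cycleTime 0ᶠ))
    - ofℚ scaling * (ofℕ 5 * 𝒜 r₂ N nz₂ ℓ + ofℕ 4 * 𝒜 r₅ N nz₅ ℓ))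
  formula = ofℚ-formula startTime ratio (cycleTime 0ᶠ) scaling (ℚ.- ℕ→ℚ 2 ℚ.* g₂) (ℚ.- ℕ→ℚ 2 ℚ.* g₅)
    (𝒜 r₂ N nz₂ ℓ) (𝒜 r₅ N nz₅ ℓ) startTime-cycleTime
    (𝒜-value {2} r₂ nz₂ g₂ (Roots₂.𝒜-green nz₂ v)) (𝒜-value {5} r₅ nz₅ g₅ (Roots₅.𝒜-green nz₅ v))

  cycle : IsHittingTime (cyclePower N k 2k<N) 0ᶠ v (fromℚ (cycleTime 0ᶠ))
  cycle = cycle-hittingTime (proj₂ green₀) 0ᶠ

  product : IsHittingTime (cyclePower N k 2k<N □ petersen) (0ᶠ , a) (v , a) (fromℚ startTime)
  product = product-hittingTime (proj₂ green₀) isGreen₂ isGreen₅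

-- The case k = 1, where φ = ν + 2.
module NearestNeighbours (R : CommutativeRing 0ℓ 0ℓ) (scalars : ScalarMap R) where

  open Algebraic R scalars

  module Sequence (γ : K) (v : ℕ → K) (v-0 : v 0 ≈ 0#) (v-1 : v 1 ≈ 1#)
    (v-step : ∀ n → v (suc (suc n)) ≈ γ ⊗ v (suc n) ⊝ v n)
    (ν : ℚ) (γ² : γ ⊗ γ ≈ ι (ν ℚ.+ ℕ→ℚ 4)) (N : ℕ) .{{N≢0 : NonZero N}} where

    open Cyclic N
    open CycleOperators R scalars N
    open SecondKind.Sequence R scalars γ v v-0 v-1 v-step using (module OnCycle)
    open OnCycle N {{N≢0}} public

    -- Here Λ + ν is -(S - φ) with φ = γ² - 2, so `τ-w` is already the required equation and no
    -- partial fractions intervene.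
    Lap-w : ∀ x → Lap 1 ν w x ≈ C ⊝ (v N ⊗ γ) ⊗ δ 0ᶠ x
    Lap-w x = begin
      ι (ℕ→ℚ 2 ℚ.+ ν) ⊗ w x ⊝ (0# ⊕ τ 1 w x)
        ≈⟨ +-cong (*-congʳ (+-homo (ℕ→ℚ 2) ν)) (-‿cong (+-identityˡ (τ 1 w x))) ⟩
      (ι (ℕ→ℚ 2) ⊕ ι ν) ⊗ w x ⊝ τ 1 w x
        ≈⟨ solve 3 (λ ν w t → (num 2 :+ ν) :* w :- t := :- (t :- ((ν :+ num 4) :- num 2) :* w))
             ≈-refl (ι ν) (w x) (τ 1 w x) ⟩
      ⊖ (τ 1 w x ⊝ ((ι ν ⊕ ι (ℕ→ℚ 4)) ⊝ ι (ℕ→ℚ 2)) ⊗ w x)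
        ≈⟨ -‿cong (trans (+-congˡ (-‿cong (*-congʳ (+-congʳ (sym (trans γ² (+-homo ν (ℕ→ℚ 4)))))))) (τ-w x)) ⟩
      ⊖ ((v N ⊗ γ) ⊗ δ 0ᶠ x ⊝ C)
        ≈⟨ solve 2 (λ d c → :- (d :- c) := c :- d) ≈-refl ((v N ⊗ γ) ⊗ δ 0ᶠ x) C ⟩
      C ⊝ (v N ⊗ γ) ⊗ δ 0ᶠ x ∎

    module _ (2<N : 2 ℕ.* 1 ℕ.+ 1 ℕ.≤ N) (0<ν : 0ℚ ℚ.< ν) (Γ : Fin N → ℚ)
      (isGreen : ∀ x → CycleOperators.Lap ℚ-ring ℚ-scalars N 1 ν Γ x ≡ CycleOperators.δ ℚ-ring ℚ-scalars N 0ᶠ x) where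

      open CycleTransfer R scalars N 1 (ℕ.s≤s ℕ.z≤n) 2<N using (c≈bνΓ; green-difference)

      v-unit : ∃ λ u → v N ⊗ u ≈ 1#
      v-unit = unit-from-C (γ ⊗ ι (ν ℚ.* Γ 0ᶠ)) (trans
        (c≈bνΓ ν 0<ν Γ isGreen w (v N ⊗ γ) C Lap-w w-0) (*-assoc (v N) γ _))

      w-green : ∀ i → v N ⊗ i ≈ 1# → ∀ x → w x ⊗ i ≈ γ ⊗ ι (Γ 0ᶠ ℚ.- Γ x)
      w-green i vi≈1 x = begin
        w x ⊗ i                                 ≈⟨ *-congʳ (green-difference ν 0<ν Γ isGreen w (v N ⊗ γ) C Lap-w w-0 x) ⟩
        ((v N ⊗ γ) ⊗ ι (Γ 0ᶠ ℚ.- Γ x)) ⊗ i      ≈⟨ solve 4 (λ v γ g i → ((v :* γ) :* g) :* i := (v :* i) :* (γ :* g))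
                                                     ≈-refl (v N) γ (ι (Γ 0ᶠ ℚ.- Γ x)) i ⟩
        (v N ⊗ i) ⊗ (γ ⊗ ι (Γ 0ᶠ ℚ.- Γ x))      ≈⟨ trans (*-congʳ vi≈1) (*-identityˡ _) ⟩
        γ ⊗ ι (Γ 0ᶠ ℚ.- Γ x) ∎

module _ where

  open ℚ-Algebra

  -- For k = 1 the prefactor is 5N/3. The equation for `a` records the explicit massless Green
  -- function, with m = ℓ(N - ℓ).
  combine-times₁ : ∀ n e m a b c → n ⊗ a ≡ ½ ⊗ m → e ≡ ℕ→ℚ 5 ⊗ n →
    (n ⊗ (ℕ→ℚ 5 ⊗ recip (ℕ→ℚ 3))) ⊗ (ℕ→ℚ 3 ⊗ a ⊕ (ℕ→ℚ 15 ⊗ b ⊕ ℕ→ℚ 12 ⊗ c)) ≡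
    (ℤ.+ 5 ℚ./ 2) ⊗ m ⊕ e ⊗ (ℕ→ℚ 5 ⊗ b ⊕ ℕ→ℚ 4 ⊗ c)
  combine-times₁ n e m a b c na≡½m refl = begin
    (n ⊗ (ℕ→ℚ 5 ⊗ recip (ℕ→ℚ 3))) ⊗ (ℕ→ℚ 3 ⊗ a ⊕ (ℕ→ℚ 15 ⊗ b ⊕ ℕ→ℚ 12 ⊗ c))
      ≈⟨ solve 4 (λ n a b c → (n :* (num 5 :* con (recip (ℕ→ℚ 3)))) :*
           (num 3 :* a :+ (num 15 :* b :+ num 12 :* c)) :=
           num 5 :* (n :* a) :+ (num 5 :* n) :* (num 5 :* b :+ num 4 :* c)) refl n a b c ⟩
    ℕ→ℚ 5 ⊗ (n ⊗ a) ⊕ (ℕ→ℚ 5 ⊗ n) ⊗ (ℕ→ℚ 5 ⊗ b ⊕ ℕ→ℚ 4 ⊗ c)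
      ≈⟨ cong (_⊕ (ℕ→ℚ 5 ⊗ n) ⊗ (ℕ→ℚ 5 ⊗ b ⊕ ℕ→ℚ 4 ⊗ c)) (trans (cong (ℕ→ℚ 5 ⊗_) na≡½m)
           (solve 1 (λ m → num 5 :* (con ½ :* m) := con (ℤ.+ 5 ℚ./ 2) :* m) refl m)) ⟩
    (ℤ.+ 5 ℚ./ 2) ⊗ m ⊕ (ℕ→ℚ 5 ⊗ n) ⊗ (ℕ→ℚ 5 ⊗ b ⊕ ℕ→ℚ 4 ⊗ c) ∎

module ℝ-Algebra = Algebraic ℝ-commutativeRing ℝ-scalars

module _ where

  open ℝ-Algebra

  -- Each quotient `A`, `B` is γ times a Green function difference, with γ = √6 and γ = 3. The
  -- weights 5 and 4 are divided by these, which yields 5/√6 and 4/3.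
  fromℚ-formula : ∀ s m e p q γ i A B → s ≡ (ℤ.+ 5 ℚ./ 2) ℚ.* m ℚ.+ e ℚ.* (ℕ→ℚ 5 ℚ.* p ℚ.+ ℕ→ℚ 4 ℚ.* q) →
    (γ *ʳ i) ≃ʳ 1ʳ → A ≃ʳ (γ *ʳ fromℚ p) → B ≃ʳ (fromℕ 3 *ʳ fromℚ q) →
    fromℚ s ≃ʳ (fromℚ (ℤ.+ 5 ℚ./ 2) *ʳ fromℚ m +ʳ fromℚ e *ʳ (fromℕ 5 *ʳ i *ʳ A +ʳ fromℚ (ℤ.+ 4 ℚ./ 3) *ʳ B))
  fromℚ-formula s m e p q γ i A B refl γi≃1 A≃γp B≃3q = trans
    (trans (+-homo _ _) (+-cong (*-homo _ m) (trans (*-homo e _) (*-congˡ (trans (+-homo _ _)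
      (+-cong (*-homo (ℕ→ℚ 5) p) (*-homo (ℕ→ℚ 4) q)))))))
    (+-congˡ (*-congˡ (+-cong
      (sym (trans (*-congˡ A≃γp) (trans
        (solve 4 (λ f i s g → (f :* i) :* (s :* g) := (s :* i) :* (f :* g)) ≈-refl (fromℕ 5) i γ (fromℚ p))
        (trans (*-congʳ γi≃1) (*-identityˡ _)))))
      (sym (trans (*-congˡ B≃3q)
        (solve 1 (λ g → con (ℤ.+ 4 ℚ./ 3) :* (num 3 :* g) := num 4 :* g) ≈-refl (fromℚ q)))))))

-- The explicit formula on the cycle

module SecondPart (N : ℕ) .{{N≢0 : NonZero N}} (2<N : 2 ℕ.* 1 ℕ.+ 1 ℕ.≤ N) (√6 : ℝ) (√6² : IsSqrt (fromℕ 6) √6)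
  (a : Vertex petersen) (ℓ : ℕ) (ℓ<N : ℓ ℕ.< N) where

  open Cyclic N
  open GreenFunctions N 1 (ℕ.s≤s ℕ.z≤n) 2<N using (green)
  private
    module Q = CycleOperators ℚ-ring ℚ-scalars N

  v : Fin N
  v = ℓ mod N

  toℕ-v : toℕ v ≡ ℓ
  toℕ-v = ≡.trans (toℕ-mod ℓ) (ℕ.m<n⇒m%n≡m ℓ<N)

  -- ν = 0 is the degenerate case γ = 2, in which V_n = n and `w x` is x(N - x). It gives the
  -- massless Green function explicitly and is the source of the term ℓ(N - ℓ).
  module W₀ where
    open ℚ-Algebra
    open NearestNeighbours.Sequence ℚ-ring ℚ-scalars (ℕ→ℚ 2) ℕ→ℚ refl refl
      (λ n → trans (trans (ℕ→ℚ-suc (suc n)) (cong (_⊕ 1ℚ) (ℕ→ℚ-suc n)))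
        (sym (trans (cong (λ m → ℕ→ℚ 2 ⊗ m ⊝ ℕ→ℚ n) (ℕ→ℚ-suc n))
          (solve 1 (λ n → num 2 :* (n :+ con 1ℚ) :- n := (n :+ con 1ℚ) :+ con 1ℚ) refl (ℕ→ℚ n)))))
      0ℚ refl N public

    C≡2 : C ≡ ℕ→ℚ 2
    C≡2 = trans (cong (λ n → ℕ→ℚ 2 ⊗ n ⊝ ℕ→ℚ 2 ⊗ ℕ→ℚ M) (trans (cong ℕ→ℚ (≡.sym 1+M≡N)) (ℕ→ℚ-suc M)))
      (solve 1 (λ m → num 2 :* (m :+ con 1ℚ) :- num 2 :* m := num 2) refl (ℕ→ℚ M))

    factor : ℚ
    factor = ⊖ (½ ⊗ recip (ℕ→ℚ N))

    -- Λ w = 2 - 2N δ, hence the coefficient -1/(2N) in `factor`. The summand with coefficient `0ℚ`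
    -- supplies the two-term shape of `Lap-linear`.
    Γ₀ : Fin N → ℚ
    Γ₀ x = factor ⊗ w x ⊕ 0ℚ ⊗ w x

    isGreen₀ : ∀ x → ℕ→ℚ N ⊗ Q.Lap 1 0ℚ Γ₀ x ≡ ℕ→ℚ N ⊗ Q.δ 0ᶠ x ⊝ 1ℚ
    isGreen₀ x = begin
      ℕ→ℚ N ⊗ Q.Lap 1 0ℚ Γ₀ x
        ≈⟨ cong (ℕ→ℚ N ⊗_) (Q.Lap-linear 1 0ℚ factor 0ℚ w w x) ⟩
      ℕ→ℚ N ⊗ (factor ⊗ Q.Lap 1 0ℚ w x ⊕ 0ℚ ⊗ Q.Lap 1 0ℚ w x)
        ≈⟨ cong (λ l → ℕ→ℚ N ⊗ (factor ⊗ l ⊕ 0ℚ ⊗ l)) (trans (Lap-w x) (cong (_⊝ (ℕ→ℚ N ⊗ ℕ→ℚ 2) ⊗ Q.δ 0ᶠ x) C≡2)) ⟩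
      ℕ→ℚ N ⊗ (factor ⊗ (ℕ→ℚ 2 ⊝ (ℕ→ℚ N ⊗ ℕ→ℚ 2) ⊗ Q.δ 0ᶠ x) ⊕ 0ℚ ⊗ (ℕ→ℚ 2 ⊝ (ℕ→ℚ N ⊗ ℕ→ℚ 2) ⊗ Q.δ 0ᶠ x))
        ≈⟨ solve 3 (λ n r d → n :* ((:- (con ½ :* r)) :* (num 2 :- (n :* num 2) :* d) :+
             con 0ℚ :* (num 2 :- (n :* num 2) :* d)) := (n :* r) :* (n :* d :- con 1ℚ))
             refl (ℕ→ℚ N) (recip (ℕ→ℚ N)) (Q.δ 0ᶠ x) ⟩
      (ℕ→ℚ N ⊗ recip (ℕ→ℚ N)) ⊗ (ℕ→ℚ N ⊗ Q.δ 0ᶠ x ⊝ 1ℚ)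
        ≈⟨ cong (_⊗ (ℕ→ℚ N ⊗ Q.δ 0ᶠ x ⊝ 1ℚ)) (recip-inverse (ℕ→ℚ≢0 N)) ⟩
      1ℚ ⊗ (ℕ→ℚ N ⊗ Q.δ 0ᶠ x ⊝ 1ℚ)
        ≈⟨ *-identityˡ _ ⟩
      ℕ→ℚ N ⊗ Q.δ 0ᶠ x ⊝ 1ℚ ∎

    N⊗Γ₀-difference : ℕ→ℚ N ⊗ (Γ₀ 0ᶠ ⊝ Γ₀ v) ≡ ½ ⊗ ℕ→ℚ (ℓ ℕ.* (N ℕ.∸ ℓ))
    N⊗Γ₀-difference = begin
      ℕ→ℚ N ⊗ (Γ₀ 0ᶠ ⊝ Γ₀ v)
        ≈⟨ cong₂ (λ p q → ℕ→ℚ N ⊗ ((factor ⊗ p ⊕ 0ℚ ⊗ p) ⊝ (factor ⊗ q ⊕ 0ℚ ⊗ q))) w-0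
             (trans (cong w̃ toℕ-v) (sym (ℕ→ℚ-* ℓ (N ℕ.∸ ℓ)))) ⟩
      ℕ→ℚ N ⊗ ((factor ⊗ 0ℚ ⊕ 0ℚ ⊗ 0ℚ) ⊝ (factor ⊗ m ⊕ 0ℚ ⊗ m))
        ≈⟨ solve 3 (λ n r m → n :* (((:- (con ½ :* r)) :* con 0ℚ :+ con 0ℚ :* con 0ℚ) :-
             ((:- (con ½ :* r)) :* m :+ con 0ℚ :* m)) := (n :* r) :* (con ½ :* m)) refl (ℕ→ℚ N) (recip (ℕ→ℚ N)) m ⟩
      (ℕ→ℚ N ⊗ recip (ℕ→ℚ N)) ⊗ (½ ⊗ m)
        ≈⟨ trans (cong (_⊗ (½ ⊗ m)) (recip-inverse (ℕ→ℚ≢0 N))) (*-identityˡ _) ⟩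
      ½ ⊗ m ∎
      where
      m : ℚ
      m = ℕ→ℚ (ℓ ℕ.* (N ℕ.∸ ℓ))

  open W₀ using (Γ₀; isGreen₀; N⊗Γ₀-difference)

  Γ₂ Γ₅ : Fin N → ℚ
  Γ₂ = proj₁ (green (ℕ→ℚ 2) (0<ℕ→ℚ 2) 0ᶠ)
  Γ₅ = proj₁ (green (ℕ→ℚ 5) (0<ℕ→ℚ 5) 0ᶠ)

  isGreen₂ : ∀ x → Q.Lap 1 (ℕ→ℚ 2) Γ₂ x ≡ Q.δ 0ᶠ x
  isGreen₂ = proj₂ (green (ℕ→ℚ 2) (0<ℕ→ℚ 2) 0ᶠ)

  isGreen₅ : ∀ x → Q.Lap 1 (ℕ→ℚ 5) Γ₅ x ≡ Q.δ 0ᶠ x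
  isGreen₅ = proj₂ (green (ℕ→ℚ 5) (0<ℕ→ℚ 5) 0ᶠ)

  g₀ g₂ g₅ : ℚ
  g₀ = Γ₀ 0ᶠ ℚ.- Γ₀ v
  g₂ = Γ₂ 0ᶠ ℚ.- Γ₂ v
  g₅ = Γ₅ 0ᶠ ℚ.- Γ₅ v

  open ℝ-Algebra

  -- The required γ² = ν + 4 reads 6 = 2 + 4 for √6, and 9 = 5 + 4 for 3.
  module W₂ = NearestNeighbours.Sequence ℝ-commutativeRing ℝ-scalars √6 (Vʳ √6) ≈-refl ≈-refl (λ _ → ≈-refl)
    (ℕ→ℚ 2) (proj₂ √6²) N
  module W₅ = NearestNeighbours.Sequence ℝ-commutativeRing ℝ-scalars (fromℕ 3) (Vʳ (fromℕ 3)) ≈-refl ≈-refl (λ _ → ≈-refl)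
    (ℕ→ℚ 5) (pointwise λ _ → refl) N

  √6#0 : √6 #ʳ 0ʳ
  √6#0 = Apartness.unit⇒#ʳ0 √6 (√6 *ʳ fromℚ (recip (ℕ→ℚ 6))) (trans (sym (*-assoc √6 √6 _))
    (trans (*-congʳ (proj₂ √6²)) (solve 0 (num 6 :* con (recip (ℕ→ℚ 6)) := con 1ℚ) ≈-refl)))

  V₂#0 : Vʳ √6 N #ʳ 0ʳ
  V₂#0 = let (u , Vu≃1) = W₂.v-unit 2<N (0<ℕ→ℚ 2) Γ₂ isGreen₂ in Apartness.unit⇒#ʳ0 (Vʳ √6 N) u Vu≃1

  V₅#0 : Vʳ (fromℕ 3) N #ʳ 0ʳ
  V₅#0 = let (u , Vu≃1) = W₅.v-unit 2<N (0<ℕ→ℚ 5) Γ₅ isGreen₅ in Apartness.unit⇒#ʳ0 (Vʳ (fromℕ 3) N) u Vu≃1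

  VV/V₂ VV/V₅ : ℕ → ℝ
  VV/V₂ m = Vʳ √6 m *ʳ Vʳ √6 (N ℕ.∸ m) *ʳ invʳ (Vʳ √6 N) V₂#0
  VV/V₅ m = Vʳ (fromℕ 3) m *ʳ Vʳ (fromℕ 3) (N ℕ.∸ m) *ʳ invʳ (Vʳ (fromℕ 3) N) V₅#0

  VV/V₂-green : VV/V₂ ℓ ≃ʳ (√6 *ʳ fromℚ g₂)
  VV/V₂-green = trans (reflexive (cong VV/V₂ (≡.sym toℕ-v)))
    (W₂.w-green 2<N (0<ℕ→ℚ 2) Γ₂ isGreen₂ (invʳ (Vʳ √6 N) V₂#0) (invʳ-inverse (Vʳ √6 N) V₂#0) v)

  VV/V₅-green : VV/V₅ ℓ ≃ʳ (fromℕ 3 *ʳ fromℚ g₅)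
  VV/V₅-green = trans (reflexive (cong VV/V₅ (≡.sym toℕ-v)))
    (W₅.w-green 2<N (0<ℕ→ℚ 5) Γ₅ isGreen₅ (invʳ (Vʳ (fromℕ 3) N) V₅#0) (invʳ-inverse (Vʳ (fromℕ 3) N) V₅#0) v)

  open WalkHittingTimes N 1 (ℕ.s≤s ℕ.z≤n) 2<N Γ₀ v using (module Product)
  open Product Γ₂ Γ₅ a using (startTime; product-hittingTime)

  startTime-explicit : startTime ≡ (ℤ.+ 5 ℚ./ 2) ℚ.* ℕ→ℚ (ℓ ℕ.* (N ℕ.∸ ℓ)) ℚ.+
    ℕ→ℚ (5 ℕ.* N) ℚ.* (ℕ→ℚ 5 ℚ.* g₂ ℚ.+ ℕ→ℚ 4 ℚ.* g₅)
  startTime-explicit = combine-times₁ (ℕ→ℚ N) (ℕ→ℚ (5 ℕ.* N)) (ℕ→ℚ (ℓ ℕ.* (N ℕ.∸ ℓ))) g₀ g₂ g₅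
    N⊗Γ₀-difference (ℕ→ℚ-* 5 N)

  formula : fromℚ startTime ≃ʳ (fromℚ (ℤ.+ 5 ℚ./ 2) *ʳ fromℕ (ℓ ℕ.* (N ℕ.∸ ℓ)) +ʳ fromℕ (5 ℕ.* N)
    *ʳ (fromℕ 5 *ʳ invʳ √6 √6#0 *ʳ VV/V₂ ℓ +ʳ fromℚ (ℤ.+ 4 ℚ./ 3) *ʳ VV/V₅ ℓ))
  formula = fromℚ-formula startTime (ℕ→ℚ (ℓ ℕ.* (N ℕ.∸ ℓ))) (ℕ→ℚ (5 ℕ.* N)) g₂ g₅ √6 (invʳ √6 √6#0)
    (VV/V₂ ℓ) (VV/V₅ ℓ) startTime-explicit (invʳ-inverse √6 √6#0) VV/V₂-green VV/V₅-green

  product : IsHittingTime (cyclePower N 1 2<N □ petersen) (0ᶠ , a) (v , a) (fromℚ startTime)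
  product = product-hittingTime isGreen₀ isGreen₂ isGreen₅

corollary6p9 : (∀ (N k : ℕ) .{{_ : NonZero N}} .{{_ : NonZero k}} (2k<N : 2 ℕ.* k ℕ.+ 1 ℕ.≤ N) →
    AllRootsSimple (D k (fromℕ 2)) →
    AllRootsSimple (D k (fromℕ 5)) →
    (r₂ : RootData k (fromℕ 2)) (r₅ : RootData k (fromℕ 5)) →
    (a : Vertex petersen) (ℓ : ℕ) → ℓ ℕ.< N →
    Σ[ nz₂ ∈ NonzeroDenominators r₂ N ] Σ[ nz₅ ∈ NonzeroDenominators r₅ N ]
    Σ[ h ∈ ℝ ] Σ[ h′ ∈ ℝ ]
    IsHittingTime (cyclePower N k 2k<N) (0 mod N) (ℓ mod N) h ×
    IsHittingTime (cyclePower N k 2k<N □ petersen) (0 mod N , a) (ℓ mod N , a) h′ ×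
    ofℝ h′ ≃
    ofℚ (ℚ._/_ (ℤ.+ (2 ℕ.* k ℕ.+ 3)) (2 ℕ.* k) {{ℕ.m*n≢0 2 k}}) * ofℝ h
    - ofℚ (ℤ.+ (N ℕ.* (2 ℕ.* k ℕ.+ 3)) ℚ./ 2)
    * (ofℕ 5 * 𝒜 r₂ N nz₂ ℓ + ofℕ 4 * 𝒜 r₅ N nz₅ ℓ))
    ×
    (∀ (N : ℕ) .{{_ : NonZero N}} (2<N : 2 ℕ.* 1 ℕ.+ 1 ℕ.≤ N) →
    (√6 : ℝ) → IsSqrt (fromℕ 6) √6 →
    (a : Vertex petersen) (ℓ : ℕ) → ℓ ℕ.< N →
    Σ[ √6#0 ∈ √6 #ʳ 0ʳ ] Σ[ V₂#0 ∈ Vʳ √6 N #ʳ 0ʳ ] Σ[ V₅#0 ∈ Vʳ (fromℕ 3) N #ʳ 0ʳ ]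
    Σ[ h′ ∈ ℝ ]
    IsHittingTime (cyclePower N 1 2<N □ petersen) (0 mod N , a) (ℓ mod N , a) h′ ×
    h′ ≃ʳ
    fromℚ (ℤ.+ 5 ℚ./ 2) *ʳ fromℕ (ℓ ℕ.* (N ℕ.∸ ℓ))
    +ʳ fromℕ (5 ℕ.* N)
    *ʳ (fromℕ 5 *ʳ invʳ √6 √6#0
    *ʳ (Vʳ √6 ℓ *ʳ Vʳ √6 (N ℕ.∸ ℓ) *ʳ invʳ (Vʳ √6 N) V₂#0)
    +ʳ fromℚ (ℤ.+ 4 ℚ./ 3)
    *ʳ (Vʳ (fromℕ 3) ℓ *ʳ Vʳ (fromℕ 3) (N ℕ.∸ ℓ) *ʳ invʳ (Vʳ (fromℕ 3) N) V₅#0)))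
corollary6p9 =
  (λ N k 2k<N simple₂ simple₅ r₂ r₅ a ℓ ℓ<N →
    let open FirstPart N k 2k<N simple₂ simple₅ r₂ r₅ a ℓ ℓ<N
    in nz₂ , nz₅ , _ , _ , cycle , product , formula) ,
  (λ N 2<N √6 √6² a ℓ ℓ<N →
    let open SecondPart N 2<N √6 √6² a ℓ ℓ<N
    in √6#0 , V₂#0 , V₅#0 , _ , product , formula)
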